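{- Let $G$ be a connected unicyclic graph on $n$ vertices such that $G\not\cong C_n$, $G\not\cong D_n$, and $G\not\cong U_n$. Then $C_n\prec G\prec U_n$.
   Context: All graphs are finite, simple and undirected. A connected unicyclic graph is a connected graph containing exactly one cycle. The independence polynomial of a graph $G$ is $I(G,x)=\sum_{k\ge 0} i_kx^k$, where $i_k$ is the number of independent sets of size $k$ in $G$. It is known that the root of $I(G,x)$ of smallest modulus is real and lies in $[-1,0)$; it is denoted $\xi(G)$ (equivalently, $\xi(G)$ is the largest real root of $I(G,x)$). For graphs $G,H$, write $H\preceq G$ if and only if $I(H,x)\ge I(G,x)$ for all $x\in[\xi(G),0]$, and $H\prec G$ if and only if $H\preceq G$ and $I(H,x)\neq I(G,x)$ as polynomials. $C_n$ ($n\ge 3$) is the cycle on $n$ vertices. $D_n$ ($n\ge 3$) is the graph with vertices $u_1,\dots,u_n$ consisting of the triangle $u_1u_2u_3$ together with the path $u_3u_4\cdots u_n$. $U_n$ ($n\ge 3$) is the graph on $n$ vertices obtained from a triangle by attaching $n-3$ pendant vertices (leaves) to one fixed vertex of the triangle. -}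

module Defs where

open import Algebra.Bundles using (RawSemiring)
open import Data.Fin.Base using (Fin; toℕ)
import Data.Fin.Properties as Fin
open import Data.Fin.Subset using (Subset; inside; outside; _∈_; ∣_∣)
open import Data.Fin.Subset.Properties using (_∈?_)
open import Data.List.Base using (List; []; _∷_; _++_; map; filter; length)
open import Data.Nat.Base as ℕ using (ℕ; zero; suc)
import Data.Nat.Properties as ℕ
open import Data.Product.Base using (Σ; ∃; ∃₂; _×_; _,_; proj₁; proj₂)
open import Data.Rational.Base as ℚ using (ℚ; 0ℚ; 1ℚ; ½)
import Data.Rational.Properties as ℚ
open import Data.Rational.Solver using (module +-*-Solver)
open import Data.Sum.Base using (_⊎_; inj₁; inj₂; swap)
open import Data.Vec.Base using ([]; _∷_)
open import Function.Base using (_∘_)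
open import Function.Bundles using (_⇔_; _↔_; module Inverse)
open import Function.Definitions using (Injective)
open import Level using (0ℓ)
open import Relation.Binary.Core using (Rel)
open import Relation.Binary.Construct.Closure.ReflexiveTransitive using (Star)
import Relation.Binary.Definitions as Rel
open import Relation.Binary.PropositionalEquality
  using (_≡_; _≢_; refl; sym; cong; cong₂; subst; trans)
open import Relation.Nullary using (¬_; Dec)
open import Relation.Nullary.Decidable using (_×-dec_; _⊎-dec_; _→-dec_; ¬?)

------------------------------------------------------------------------
-- Real numbers

-- Reals are Cauchy sequences of rationals.  The Cauchy condition is a
-- Σ-type, so a real carries a modulus of convergence.

IsCauchy : (ℕ → ℚ) → Set
IsCauchy s = ∀ ε → 0ℚ ℚ.< ε →
  ∃ λ N → ∀ m n → N ℕ.≤ m → N ℕ.≤ n → ℚ.∣ s m ℚ.- s n ∣ ℚ.≤ ε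

record ℝ : Set where
  constructor mkℝ
  field
    seq    : ℕ → ℚ
    cauchy : IsCauchy seq

open ℝ public

infix 4 _≤ᴿ_ _≈ᴿ_

_≤ᴿ_ : Rel ℝ 0ℓ
x ≤ᴿ y = ∀ ε → 0ℚ ℚ.< ε → ∃ λ N → ∀ n → N ℕ.≤ n → seq x n ℚ.≤ seq y n ℚ.+ ε

_≈ᴿ_ : Rel ℝ 0ℓ
x ≈ᴿ y = ∀ ε → 0ℚ ℚ.< ε → ∃ λ N → ∀ n → N ℕ.≤ n → ℚ.∣ seq x n ℚ.- seq y n ∣ ℚ.≤ ε

fromℚ : ℚ → ℝ
fromℚ q = mkℝ (λ _ → q) λ ε 0<ε → 0 , λ _ _ _ _ →
  subst (ℚ._≤ ε) (sym (cong ℚ.∣_∣ (ℚ.+-inverseʳ q))) (ℚ.<⇒≤ 0<ε)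

0ᴿ 1ᴿ : ℝ
0ᴿ = fromℚ 0ℚ
1ᴿ = fromℚ 1ℚ

private
  0<*½ : ∀ {ε} → 0ℚ ℚ.< ε → 0ℚ ℚ.< ε ℚ.* ½
  0<*½ {ε} 0<ε =
    ℚ.positive⁻¹ (ε ℚ.* ½) {{ℚ.pos*pos⇒pos ε {{ℚ.positive 0<ε}} ½}}

  half+half : ∀ ε → ε ℚ.* ½ ℚ.+ ε ℚ.* ½ ≡ ε
  half+half = solve 1 (λ e → e :* con ½ :+ e :* con ½ := e) refl
    where open +-*-Solver

  bounded : ∀ {s} → IsCauchy s →
    ∃₂ λ N B → ℚ.Positive B × (∀ n → N ℕ.≤ n → ℚ.∣ s n ∣ ℚ.≤ B)
  bounded {s} c with c 1ℚ (ℚ.positive⁻¹ 1ℚ)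
  ... | N , h = N , 1ℚ ℚ.+ ℚ.∣ s N ∣
      , ℚ.pos+nonNeg⇒pos 1ℚ ℚ.∣ s N ∣ {{ℚ.∣-∣-nonNeg (s N)}}
      , λ n N≤n → begin
          ℚ.∣ s n ∣                        ≡⟨ cong ℚ.∣_∣ (lem (s n) (s N)) ⟩
          ℚ.∣ (s n ℚ.- s N) ℚ.+ s N ∣      ≤⟨ ℚ.∣p+q∣≤∣p∣+∣q∣ (s n ℚ.- s N) (s N) ⟩
          ℚ.∣ s n ℚ.- s N ∣ ℚ.+ ℚ.∣ s N ∣  ≤⟨ ℚ.+-monoˡ-≤ ℚ.∣ s N ∣ (h n N N≤n ℕ.≤-refl) ⟩
          1ℚ ℚ.+ ℚ.∣ s N ∣                 ∎
    where
    open ℚ.≤-Reasoning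
    open +-*-Solver
    lem : ∀ a b → a ≡ (a ℚ.- b) ℚ.+ b
    lem = solve 2 (λ a b → a := (a :- b) :+ b) refl

  divide : ∀ B → ℚ.Positive B → ∀ {ε} → 0ℚ ℚ.< ε →
    ∃ λ δ → 0ℚ ℚ.< δ × B ℚ.* δ ≡ ε
  divide B B>0 {ε} 0<ε = B⁻¹ ℚ.* ε
    , ℚ.positive⁻¹ (B⁻¹ ℚ.* ε)
        {{ℚ.pos*pos⇒pos B⁻¹ {{ℚ.1/pos⇒pos B}} ε {{ℚ.positive 0<ε}}}}
    , (begin
        B ℚ.* (B⁻¹ ℚ.* ε)  ≡⟨ ℚ.*-assoc B B⁻¹ ε ⟨
        B ℚ.* B⁻¹ ℚ.* ε    ≡⟨ cong (ℚ._* ε) (ℚ.*-inverseʳ B) ⟩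
        1ℚ ℚ.* ε           ≡⟨ ℚ.*-identityˡ ε ⟩
        ε                  ∎)
    where
    open Relation.Binary.PropositionalEquality.≡-Reasoning
    instance
      _ = B>0
      B≢0 : ℚ.NonZero B
      B≢0 = ℚ.pos⇒nonZero B
    B⁻¹ = ℚ.1/ B

  +-cauchy : ∀ {s t} → IsCauchy s → IsCauchy t → IsCauchy (λ n → s n ℚ.+ t n)
  +-cauchy {s} {t} cs ct ε 0<ε
    with cs (ε ℚ.* ½) (0<*½ 0<ε) | ct (ε ℚ.* ½) (0<*½ 0<ε)
  ... | M , hs | N , ht = M ℕ.⊔ N , λ m n ≤m ≤n → begin
    ℚ.∣ (s m ℚ.+ t m) ℚ.- (s n ℚ.+ t n) ∣
      ≡⟨ cong ℚ.∣_∣ (lem (s m) (t m) (s n) (t n)) ⟩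
    ℚ.∣ (s m ℚ.- s n) ℚ.+ (t m ℚ.- t n) ∣
      ≤⟨ ℚ.∣p+q∣≤∣p∣+∣q∣ (s m ℚ.- s n) (t m ℚ.- t n) ⟩
    ℚ.∣ s m ℚ.- s n ∣ ℚ.+ ℚ.∣ t m ℚ.- t n ∣
      ≤⟨ ℚ.+-mono-≤
           (hs m n (ℕ.m⊔n≤o⇒m≤o M N ≤m) (ℕ.m⊔n≤o⇒m≤o M N ≤n))
           (ht m n (ℕ.m⊔n≤o⇒n≤o M N ≤m) (ℕ.m⊔n≤o⇒n≤o M N ≤n)) ⟩
    ε ℚ.* ½ ℚ.+ ε ℚ.* ½
      ≡⟨ half+half ε ⟩
    ε ∎
    where
    open ℚ.≤-Reasoning
    open +-*-Solver
    lem : ∀ a b c d → (a ℚ.+ b) ℚ.- (c ℚ.+ d) ≡ (a ℚ.- c) ℚ.+ (b ℚ.- d)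
    lem = solve 4 (λ a b c d → (a :+ b) :- (c :+ d) := (a :- c) :+ (b :- d)) refl

  *-bound : ∀ {A} → ℚ.Positive A → ∀ {a b c} →
    ℚ.∣ a ∣ ℚ.≤ A → ℚ.∣ b ∣ ℚ.≤ c → ℚ.∣ a ℚ.* b ∣ ℚ.≤ A ℚ.* c
  *-bound {A} A>0 {a} {b} {c} a≤A b≤c = begin
    ℚ.∣ a ℚ.* b ∣        ≡⟨ ℚ.∣p*q∣≡∣p∣*∣q∣ a b ⟩
    ℚ.∣ a ∣ ℚ.* ℚ.∣ b ∣  ≤⟨ ℚ.*-monoʳ-≤-nonNeg ℚ.∣ b ∣ {{ℚ.∣-∣-nonNeg b}} a≤A ⟩
    A ℚ.* ℚ.∣ b ∣        ≤⟨ ℚ.*-monoˡ-≤-nonNeg A {{ℚ.pos⇒nonNeg A {{A>0}}}} b≤c ⟩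
    A ℚ.* c              ∎
    where open ℚ.≤-Reasoning

  *-close : ∀ {A B δ η} → ℚ.Positive A → ℚ.Positive B → ∀ a b c d →
    ℚ.∣ a ∣ ℚ.≤ A → ℚ.∣ d ∣ ℚ.≤ B →
    ℚ.∣ b ℚ.- d ∣ ℚ.≤ δ → ℚ.∣ a ℚ.- c ∣ ℚ.≤ η →
    ℚ.∣ a ℚ.* b ℚ.- c ℚ.* d ∣ ℚ.≤ A ℚ.* δ ℚ.+ B ℚ.* η
  *-close {A} {B} {δ} {η} A>0 B>0 a b c d a≤A d≤B bd≤δ ac≤η = begin
    ℚ.∣ a ℚ.* b ℚ.- c ℚ.* d ∣
      ≡⟨ cong ℚ.∣_∣ (lem a b c d) ⟩
    ℚ.∣ a ℚ.* (b ℚ.- d) ℚ.+ d ℚ.* (a ℚ.- c) ∣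
      ≤⟨ ℚ.∣p+q∣≤∣p∣+∣q∣ (a ℚ.* (b ℚ.- d)) (d ℚ.* (a ℚ.- c)) ⟩
    ℚ.∣ a ℚ.* (b ℚ.- d) ∣ ℚ.+ ℚ.∣ d ℚ.* (a ℚ.- c) ∣
      ≤⟨ ℚ.+-mono-≤ (*-bound A>0 {a} {b ℚ.- d} a≤A bd≤δ)
                    (*-bound B>0 {d} {a ℚ.- c} d≤B ac≤η) ⟩
    A ℚ.* δ ℚ.+ B ℚ.* η ∎
    where
    open ℚ.≤-Reasoning
    open +-*-Solver
    lem : ∀ a b c d → a ℚ.* b ℚ.- c ℚ.* d ≡ a ℚ.* (b ℚ.- d) ℚ.+ d ℚ.* (a ℚ.- c)
    lem = solve 4 (λ a b c d → a :* b :- c :* d := a :* (b :- d) :+ d :* (a :- c)) refl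

  *-cauchy : ∀ {s t} → IsCauchy s → IsCauchy t → IsCauchy (λ n → s n ℚ.* t n)
  *-cauchy {s} {t} cs ct ε 0<ε =
    let K , A , A>0 , s≤A = bounded cs
        L , B , B>0 , t≤B = bounded ct
        δ , 0<δ , Aδ≡     = divide A A>0 (0<*½ 0<ε)
        η , 0<η , Bη≡     = divide B B>0 (0<*½ 0<ε)
        M , ht            = ct δ 0<δ
        N , hs            = cs η 0<η
    in (K ℕ.⊔ L) ℕ.⊔ (M ℕ.⊔ N) , combine K L M N A>0 B>0 s≤A t≤B ht hs
         (trans (cong₂ ℚ._+_ Aδ≡ Bη≡) (half+half ε))
    where
    combine : ∀ K L M N {A B δ η} → ℚ.Positive A → ℚ.Positive B →
      (∀ n → K ℕ.≤ n → ℚ.∣ s n ∣ ℚ.≤ A) → (∀ n → L ℕ.≤ n → ℚ.∣ t n ∣ ℚ.≤ B) →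
      (∀ m n → M ℕ.≤ m → M ℕ.≤ n → ℚ.∣ t m ℚ.- t n ∣ ℚ.≤ δ) →
      (∀ m n → N ℕ.≤ m → N ℕ.≤ n → ℚ.∣ s m ℚ.- s n ∣ ℚ.≤ η) →
      A ℚ.* δ ℚ.+ B ℚ.* η ≡ ε →
      ∀ m n → (K ℕ.⊔ L) ℕ.⊔ (M ℕ.⊔ N) ℕ.≤ m → (K ℕ.⊔ L) ℕ.⊔ (M ℕ.⊔ N) ℕ.≤ n →
      ℚ.∣ s m ℚ.* t m ℚ.- s n ℚ.* t n ∣ ℚ.≤ ε
    combine K L M N A>0 B>0 s≤A t≤B ht hs eq m n ≤m ≤n =
      let KL≤m = ℕ.m⊔n≤o⇒m≤o (K ℕ.⊔ L) (M ℕ.⊔ N) ≤m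
          MN≤m = ℕ.m⊔n≤o⇒n≤o (K ℕ.⊔ L) (M ℕ.⊔ N) ≤m
          KL≤n = ℕ.m⊔n≤o⇒m≤o (K ℕ.⊔ L) (M ℕ.⊔ N) ≤n
          MN≤n = ℕ.m⊔n≤o⇒n≤o (K ℕ.⊔ L) (M ℕ.⊔ N) ≤n
      in ℚ.≤-trans
        (*-close A>0 B>0 (s m) (t m) (s n) (t n)
          (s≤A m (ℕ.m⊔n≤o⇒m≤o K L KL≤m))
          (t≤B n (ℕ.m⊔n≤o⇒n≤o K L KL≤n))
          (ht m n (ℕ.m⊔n≤o⇒m≤o M N MN≤m) (ℕ.m⊔n≤o⇒m≤o M N MN≤n))
          (hs m n (ℕ.m⊔n≤o⇒n≤o M N MN≤m) (ℕ.m⊔n≤o⇒n≤o M N MN≤n)))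
        (ℚ.≤-reflexive eq)

infixl 6 _+ᴿ_
infixl 7 _*ᴿ_

_+ᴿ_ _*ᴿ_ : ℝ → ℝ → ℝ
x +ᴿ y = mkℝ (λ n → seq x n ℚ.+ seq y n) (+-cauchy {seq x} {seq y} (cauchy x) (cauchy y))
x *ᴿ y = mkℝ (λ n → seq x n ℚ.* seq y n) (*-cauchy {seq x} {seq y} (cauchy x) (cauchy y))

ℝ-rawSemiring : RawSemiring 0ℓ 0ℓ
ℝ-rawSemiring = record
  { Carrier = ℝ
  ; _≈_     = _≈ᴿ_
  ; _+_     = _+ᴿ_
  ; _*_     = _*ᴿ_
  ; 0#      = 0ᴿ
  ; 1#      = 1ᴿ
  }

------------------------------------------------------------------------
-- Graphs

-- Adj u v need not be a proposition; only its inhabitation is ever used.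

record Graph (n : ℕ) : Set₁ where
  field
    Adj     : Rel (Fin n) 0ℓ
    adj?    : Rel.Decidable Adj
    symm    : Rel.Symmetric Adj
    irrefl  : Rel.Irreflexive _≡_ Adj

open Graph public

fromRel : ∀ {n} (R : Rel (Fin n) 0ℓ) → Rel.Decidable R → Graph n
fromRel R R? = record
  { Adj    = λ u v → u ≢ v × (R u v ⊎ R v u)
  ; adj?   = λ u v → ¬? (u Fin.≟ v) ×-dec (R? u v ⊎-dec R? v u)
  ; symm   = λ (u≢v , r) → u≢v ∘ sym , swap r
  ; irrefl = λ u≡v (u≢v , _) → u≢v u≡v
  }

infix 4 _≅_

record _≅_ {m n} (G : Graph m) (H : Graph n) : Set where
  field
    bijection : Fin m ↔ Fin n
    adj-⇔     : ∀ u v →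
      Adj G u v ⇔ Adj H (Inverse.to bijection u) (Inverse.to bijection v)

-- The three families are intended for n ≥ 3; vertices are numbered from 0,
-- so u₁ is vertex 0.

C : ∀ n → Graph n
C n = fromRel
  (λ u v → suc (toℕ u) ≡ toℕ v ⊎ (toℕ u ≡ 0 × suc (toℕ v) ≡ n))
  (λ u v → (suc (toℕ u) ℕ.≟ toℕ v)
             ⊎-dec ((toℕ u ℕ.≟ 0) ×-dec (suc (toℕ v) ℕ.≟ n)))

D : ∀ n → Graph n
D n = fromRel
  (λ u v → suc (toℕ u) ≡ toℕ v ⊎ (toℕ u ≡ 0 × toℕ v ≡ 2))
  (λ u v → (suc (toℕ u) ℕ.≟ toℕ v)
             ⊎-dec ((toℕ u ℕ.≟ 0) ×-dec (toℕ v ℕ.≟ 2)))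

-- The triangle is 0, 1, 2 and the leaves are attached to 0.

U : ∀ n → Graph n
U n = fromRel
  (λ u v → toℕ u ≡ 0 ⊎ (toℕ u ≡ 1 × toℕ v ≡ 2))
  (λ u v → (toℕ u ℕ.≟ 0) ⊎-dec ((toℕ u ℕ.≟ 1) ×-dec (toℕ v ℕ.≟ 2)))

Connected : ∀ {n} → Graph n → Set
Connected G = ∀ u v → Star (Adj G) u v

-- A cycle of G is presented by an embedding of some C k, k ≥ 3, in G.  The
-- same cycle has several presentations (rotations and reflections), so two
-- of them are identified when they have the same edges.

record Cycle {n} (G : Graph n) : Set where
  field
    len       : ℕ
    3≤len     : 3 ℕ.≤ len
    vertex    : Fin len → Fin n
    injective : Injective _≡_ _≡_ vertex
    adjacent  : ∀ i j → Adj (C len) i j → Adj G (vertex i) (vertex j)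

  Edge : Rel (Fin n) 0ℓ
  Edge u v = ∃₂ λ i j → Adj (C len) i j × vertex i ≡ u × vertex j ≡ v

SameCycle : ∀ {n} {G : Graph n} → Rel (Cycle G) 0ℓ
SameCycle c d = ∀ u v → Cycle.Edge c u v ⇔ Cycle.Edge d u v

Unicyclic : ∀ {n} → Graph n → Set
Unicyclic G = Σ (Cycle G) λ c → ∀ d → SameCycle c d

------------------------------------------------------------------------
-- The independence polynomial

Independent : ∀ {n} → Graph n → Subset n → Set
Independent G S = ∀ u v → u ∈ S → v ∈ S → ¬ Adj G u v

independent? : ∀ {n} (G : Graph n) S → Dec (Independent G S)
independent? G S = Fin.all? λ u → Fin.all? λ v →
  (u ∈? S) →-dec ((v ∈? S) →-dec ¬? (adj? G u v))

subsets : ∀ n → List (Subset n)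
subsets zero    = [] ∷ []
subsets (suc n) = map (outside ∷_) (subsets n) ++ map (inside ∷_) (subsets n)

numIndependent : ∀ {n} → Graph n → ℕ → ℕ
numIndependent {n} G k = length
  (filter (λ S → independent? G S ×-dec (∣ S ∣ ℕ.≟ k)) (subsets n))

-- The sum stops at n because numIndependent G k vanishes for k > n.

I : ∀ {n} → Graph n → ℝ → ℝ
I {n} G x = sum {suc n} λ k → numIndependent G (toℕ k) · x ^ toℕ k
  where open import Algebra.Definitions.RawSemiring ℝ-rawSemiring
          using (sum; _^_) renaming (_×_ to infixr 7 _·_)

SamePolynomial : ∀ {m n} → Graph m → Graph n → Set
SamePolynomial H G = ∀ k → numIndependent H k ≡ numIndependent G k

-- Every graph with at least one vertex has exactly one such ξ, up to _≈ᴿ_.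
-- The root of I G of smallest modulus is known to be real, and all real roots
-- are negative, so that root is the largest real one.

IsLargestRoot : ∀ {n} → Graph n → ℝ → Set
IsLargestRoot G ξ = I G ξ ≈ᴿ 0ᴿ × (∀ r → I G r ≈ᴿ 0ᴿ → r ≤ᴿ ξ)

infix 4 _⪯_ _≺_

_⪯_ : ∀ {m n} → Graph m → Graph n → Set
H ⪯ G = ∀ ξ → IsLargestRoot G ξ →
  ∀ x → ξ ≤ᴿ x → x ≤ᴿ 0ᴿ → I G x ≤ᴿ I H x

_≺_ : ∀ {m n} → Graph m → Graph n → Set
H ≺ G = H ⪯ G × ¬ SamePolynomial H G

{-# OPTIONS --safe #-}

-- Write x = −p.  The comparisons are made at rational p > 0 at which all induced
-- subgraphs of G have a positive independence polynomial.  Every p with ξ(G) < −p is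
-- such a point: otherwise bisection finds a limit p′ ≤ p with positivity just below p′
-- and an induced subgraph H with I(H) ≤ 0 just above it, and since adding a vertex to H
-- subtracts p′ times an almost nonnegative number, −p′ is a root of I(G) larger than ξ(G).
--
-- A connected unicyclic graph arises from a cycle by adding leaves, and a new leaf at u
-- changes I(G) into I(G) − p I(G − u).  For Uₙ one needs an upper bound of I(G − u): this
-- graph has an edge, so the bound is (1 − 2p)(1 − p)ⁿ⁻³, attained only if there is no other
-- edge.  For Cₙ one needs the lower bound c_{n−1} I(G) ≤ c_n I(G − u), where c_n = I(Cₙ).
-- It is proved by splitting G at u along a bridge or through the cycle, together with the
-- analogous bound for trees in terms of paths, and is attained only if G is Dₙ and u the
-- end of its path.
--
-- Continuity carries the inequalities from rational to real x.  At a sufficiently small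
-- p > 0 all graphs on n vertices are positive and the inequalities are strict, so the
-- polynomials differ.

module Submission where

open import Defs
open import Algebra.Definitions.RawSemiring ℝ-rawSemiring using ()
  renaming (sum to sumᴿ; _^_ to _^ᴿ_; _×_ to _·ᴿ_)
open import Data.Fin.Base using (Fin; toℕ; fromℕ<; opposite; zero; suc)
import Data.Fin.Properties as Fin
open import Data.Fin.Subset using (Subset; inside; outside)
import Data.Fin.Subset as Subset
import Data.Fin.Subset.Properties as Subset
import Data.Integer.Base as ℤ
import Data.Integer.Properties as ℤ
open import Data.List.Base
  using (List; []; _∷_; _++_; [_]; length; lookup; map; filter; allFin; tabulate)
open import Data.List.Membership.Propositional using (_∈_; _∉_)
open import Data.List.Membership.Propositional.Properties
  using (∈-∃++; ∈-++⁻; ∈-++⁺ʳ; ∈-allFin; ∈-lookup)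
import Data.List.Membership.DecPropositional as DecMembership
open import Data.List.Properties
  using (++-assoc; ++-identityʳ; length-++; length-filter; length-tabulate;
         filter-++; filter-all; filter-none; filter-accept; filter-reject)
open import Data.List.Relation.Binary.Permutation.Propositional
  using (_↭_; prep; swap; ↭-refl; ↭-sym; ↭-trans; ↭-reflexive; ↭⇒↭ₛ)
import Data.List.Relation.Binary.Permutation.Propositional as Perm
open import Data.List.Relation.Binary.Permutation.Propositional.Properties
  using (filter-↭; drop-∷; shift; ++-comm; ∈-resp-↭; All-resp-↭; ↭-length; ++⁺ˡ; ++⁺ʳ)
import Data.List.Relation.Binary.Permutation.Setoid.Properties as SetoidPerm
open import Data.List.Relation.Unary.All as All using (All; []; _∷_)
import Data.List.Relation.Unary.All.Properties as All
open import Data.List.Relation.Unary.AllPairs using (AllPairs; []; _∷_)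
import Data.List.Relation.Unary.AllPairs.Properties as AllPairs
open import Data.List.Relation.Unary.Any as Any using (here; there)
open import Data.List.Relation.Unary.Any.Properties using (lookup-index)
open import Data.List.Relation.Unary.Unique.Propositional using (Unique)
open import Data.List.Relation.Unary.Unique.Propositional.Properties using (allFin⁺)
open import Data.Nat.Base as ℕ using (ℕ; zero; suc; s≤s; z≤n)
open import Data.Nat.DivMod
  using (_%_; m%n<n; m<n⇒m%n≡m; %-distribˡ-+; [m+n]%n≡m%n; m≤n⇒[n∸m]%m≡n%m)
import Data.Nat.Properties as ℕ
open import Data.Product.Base using (Σ; ∃; ∃₂; _×_; _,_; proj₁; proj₂)
open import Data.Rational.Base
  using (ℚ; mkℚ; 0ℚ; 1ℚ; ½; _+_; _*_; _-_; -_; 1/_; ∣_∣; _≤_; _<_; toℚᵘ; positive; nonNegative)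
import Data.Rational.Base as ℚ
import Data.Rational.Properties as ℚ
open import Data.Rational.Properties
  using (≤-refl; ≤-reflexive; ≤-trans; <-≤-trans; ≤-<-trans; <⇒≤)
open import Data.Rational.Solver using (module +-*-Solver)
import Data.Rational.Unnormalised.Base as ℚᵘ
import Data.Rational.Unnormalised.Properties as ℚᵘ
open import Data.Sum.Base using (_⊎_; inj₁; inj₂)
open import Data.Unit.Base using (⊤; tt)
open import Data.Vec.Base using ([]; _∷_; here; there)
open import Function.Base using (_∘_; id)
open import Function.Bundles using (_⇔_; mk⇔; mk↔ₛ′; module Equivalence)
open import Level using (0ℓ)
open import Relation.Binary.Construct.Closure.ReflexiveTransitive using (Star; _◅_)
  renaming (ε to stay)
open import Relation.Binary.Definitions using (tri<; tri≈; tri>)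
open import Relation.Binary.PropositionalEquality
  using (_≡_; _≢_; refl; sym; trans; cong; cong₂; subst; subst₂; setoid; module ≡-Reasoning)
open import Relation.Nullary using (¬_; Dec; yes; no; contradiction)
open import Relation.Nullary.Decidable using (¬?; _×-dec_)
open import Relation.Unary using (Pred; Decidable)

open +-*-Solver

-- Rational inequalities and the two polynomial sequences

-- A bound on I(G) alone does not survive the addition of a leaf at u: I(G) - p I(G - u) also asks
-- for a lower bound of I(G - u), and G - u need be neither connected nor unicyclic. The statement
-- carried through the induction therefore bounds the quotient I(G) / I(G - u), for every vertex u
-- at once and written without division. When G is split at u, the quotient bounds of the two pieces
-- multiply to one for G because the path and cycle sequences obey a common quadratic identity,
-- `product-identity`, whose remainder has a sign. The same remainder decides where the bound is
-- strict.
--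
-- These products and cancellations need positive values for all pieces, hence the demand on all
-- induced subgraphs. For the path and cycle sequences positivity is proved along with the bounds.
--
-- The comparison with Uₙ takes place where Uₙ is known to be positive. Positivity of G at these
-- points has to be extracted from the comparison itself.

0≤* : ∀ {a b} → 0ℚ ≤ a → 0ℚ ≤ b → 0ℚ ≤ a * b
0≤* {a} {b} 0≤a 0≤b = subst (_≤ a * b) (ℚ.*-zeroʳ a)
  (ℚ.*-monoˡ-≤-nonNeg a {{nonNegative 0≤a}} 0≤b)

0<* : ∀ {a b} → 0ℚ < a → 0ℚ < b → 0ℚ < a * b
0<* {a} {b} 0<a 0<b = subst (_< a * b) (ℚ.*-zeroʳ a)
  (ℚ.*-monoʳ-<-pos a {{positive 0<a}} 0<b)

0≤+ : ∀ {a b} → 0ℚ ≤ a → 0ℚ ≤ b → 0ℚ ≤ a + b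
0≤+ = ℚ.+-mono-≤

0<+ : ∀ {a b} → 0ℚ < a → 0ℚ ≤ b → 0ℚ < a + b
0<+ = ℚ.+-mono-<-≤

0<1 : 0ℚ < 1ℚ
0<1 = ℚ.positive⁻¹ 1ℚ

0≤- : ∀ {a b} → a ≤ b → 0ℚ ≤ b - a
0≤- {a} {b} a≤b = subst (_≤ b - a) (ℚ.+-inverseʳ a) (ℚ.+-monoˡ-≤ (- a) a≤b)

0<- : ∀ {a b} → a < b → 0ℚ < b - a
0<- {a} {b} a<b = subst (_< b - a) (ℚ.+-inverseʳ a) (ℚ.+-monoˡ-< (- a) a<b)

private
  add-back : ∀ a b → b - a + a ≡ b
  add-back = solve 2 (λ a b → b :- a :+ a := b) refl

≤-by : ∀ {a b d} → 0ℚ ≤ d → b - a ≡ d → a ≤ b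
≤-by {a} {b} {d} 0≤d eq = subst₂ _≤_ (ℚ.+-identityˡ a)
  (trans (cong (_+ a) (sym eq)) (add-back a b)) (ℚ.+-monoˡ-≤ a 0≤d)

<-by : ∀ {a b d} → 0ℚ < d → b - a ≡ d → a < b
<-by {a} {b} {d} 0<d eq = subst₂ _<_ (ℚ.+-identityˡ a)
  (trans (cong (_+ a) (sym eq)) (add-back a b)) (ℚ.+-monoˡ-< a 0<d)

cancel-≤ : ∀ {c a b} → 0ℚ < c → c * a ≤ c * b → a ≤ b
cancel-≤ {c} 0<c = ℚ.*-cancelˡ-≤-pos c {{positive 0<c}}

cancel-< : ∀ {c a b} → 0ℚ < c → c * a < c * b → a < b
cancel-< {c} 0<c = ℚ.*-cancelˡ-<-nonNeg c {{nonNegative (<⇒≤ 0<c)}}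

pos-cancel : ∀ {c a} → 0ℚ < c → 0ℚ < c * a → 0ℚ < a
pos-cancel {c} {a} 0<c 0<ca =
  cancel-< 0<c (subst (_< c * a) (sym (ℚ.*-zeroʳ c)) 0<ca)

*-mono-≤ : ∀ {a b c d} → 0ℚ ≤ a → a ≤ b → 0ℚ ≤ c → c ≤ d → a * c ≤ b * d
*-mono-≤ {a} {b} {c} {d} 0≤a a≤b 0≤c c≤d = ≤-by
  (0≤+ (0≤* (0≤- a≤b) (≤-trans 0≤c c≤d)) (0≤* 0≤a (0≤- c≤d)))
  (solve 4 (λ a b c d → b :* d :- a :* c := (b :- a) :* d :+ a :* (d :- c)) refl a b c d)

*-mono-<ʳ : ∀ {a b c d} → 0ℚ < a → a ≤ b → 0ℚ ≤ c → c < d → a * c < b * d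
*-mono-<ʳ {a} {b} {c} {d} 0<a a≤b 0≤c c<d = <-by
  (0<+ (0<* 0<a (0<- c<d)) (0≤* (0≤- a≤b) (≤-trans 0≤c (<⇒≤ c<d))))
  (solve 4 (λ a b c d → b :* d :- a :* c := a :* (d :- c) :+ (b :- a) :* d) refl a b c d)

infixr 8 _^_
_^_ : ℚ → ℕ → ℚ
x ^ zero  = 1ℚ
x ^ suc n = x * x ^ n

^-pos : ∀ {x} n → 0ℚ < x → 0ℚ < x ^ n
^-pos zero    0<x = 0<1
^-pos (suc n) 0<x = 0<* 0<x (^-pos n 0<x)

le-add : ∀ {a b} → 0ℚ ≤ b → a ≤ a + b
le-add {a} {b} 0≤b = ≤-by 0≤b (solve 2 (λ a b → a :+ b :- a := b) refl a b)

lt-add : ∀ {a b} → 0ℚ < b → a < a + b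
lt-add {a} {b} 0<b = <-by 0<b (solve 2 (λ a b → a :+ b :- a := b) refl a b)

module Recurrence (p : ℚ) where

  IsRec : (ℕ → ℚ) → Set
  IsRec s = ∀ j → s (suc (suc j)) ≡ s (suc j) - p * s j

  -- I(Pₘ, −p) is pa (m + 2); the shift makes the addition formula hold from 0 on.
  pa : ℕ → ℚ
  pa 0             = 0ℚ
  pa 1             = 1ℚ
  pa (suc (suc j)) = pa (suc j) - p * pa j

  -- I(Cₙ, −p) for n ≥ 3, continued backwards along its recurrence.
  cy : ℕ → ℚ
  cy 0             = 1ℚ + 1ℚ
  cy 1             = 1ℚ
  cy (suc (suc j)) = cy (suc j) - p * cy j

  pa-rec : IsRec pa
  pa-rec j = refl

  cy-rec : IsRec cy
  cy-rec j = refl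

  addition : ∀ s → IsRec s → ∀ m n →
    s (suc (m ℕ.+ n)) ≡ pa (suc m) * s (suc n) - p * pa m * s n
  addition s r zero n =
    solve 3 (λ p x y → x := con 1ℚ :* x :- p :* con 0ℚ :* y) refl p (s (suc n)) (s n)
  addition s r (suc m) n = trans (cong (λ k → s (suc k)) (sym (ℕ.+-suc m n)))
    (trans (addition s r m (suc n))
    (trans (cong (λ t → pa (suc m) * t - p * pa m * s (suc n)) (r n))
      (solve 5 (λ p a a' x y → a' :* (x :- p :* y) :- p :* a :* x
                  := (a' :- p :* a) :* x :- p :* a' :* y)
        refl p (pa m) (pa (suc m)) (s (suc n)) (s n))))

  step-back : ∀ s → IsRec s → ∀ j → s (suc j) ≡ s (suc (suc j)) + p * s j
  step-back s r j = sym (trans (cong (_+ p * s j) (r j))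
    (solve 2 (λ x y → x :- y :+ y := x) refl (s (suc j)) (p * s j)))

  -- With `u`, `v`, `w` as below, `addition` gives the outer terms as `u - p * v` and `w - p * u`,
  -- and `step-back` writes the middle term through these two. The factor of `p` in the last summand
  -- becomes `K` in `Join`.
  product-identity : ∀ s → IsRec s → ∀ a b →
    pa (1 ℕ.+ a) * s (1 ℕ.+ b) * s (2 ℕ.+ (a ℕ.+ b)) ≡
    pa (2 ℕ.+ a) * s (2 ℕ.+ b) * s (1 ℕ.+ (a ℕ.+ b))
      + p * (pa a * s b * s (3 ℕ.+ (a ℕ.+ b)))
  product-identity s r a b = begin
    u * s (2 ℕ.+ (a ℕ.+ b))                                ≡⟨ cong (u *_) (step-back s r (suc (a ℕ.+ b))) ⟩
    u * (s (3 ℕ.+ (a ℕ.+ b)) + p * s (1 ℕ.+ (a ℕ.+ b)))    ≡⟨ cong₂ (λ x y → u * (x + p * y)) S₃ S₁ ⟩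
    u * (w - p * u + p * (u - p * v))                      ≡⟨ identity p u v w ⟩
    w * (u - p * v) + p * (v * (w - p * u))                ≡⟨ cong₂ (λ x y → w * y + p * (v * x)) S₃ S₁ ⟨
    w * s (1 ℕ.+ (a ℕ.+ b)) + p * (v * s (3 ℕ.+ (a ℕ.+ b))) ∎
    where
    open ≡-Reasoning
    u = pa (1 ℕ.+ a) * s (1 ℕ.+ b)
    v = pa a * s b
    w = pa (2 ℕ.+ a) * s (2 ℕ.+ b)
    S₁ : s (1 ℕ.+ (a ℕ.+ b)) ≡ u - p * v
    S₁ = trans (addition s r a b) (cong (λ t → u - t) (ℚ.*-assoc p (pa a) (s b)))
    S₃ : s (3 ℕ.+ (a ℕ.+ b)) ≡ w - p * u
    S₃ = trans (cong (λ k → s (2 ℕ.+ k)) (sym (ℕ.+-suc a b)))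
      (trans (addition s r (suc a) (suc b))
        (cong (λ t → w - t) (ℚ.*-assoc p (pa (suc a)) (s (suc b)))))
    identity : ∀ p u v w → u * (w - p * u + p * (u - p * v)) ≡
                           w * (u - p * v) + p * (v * (w - p * u))
    identity = solve 4 (λ p u v w → u :* (w :- p :* u :+ p :* (u :- p :* v)) :=
                           w :* (u :- p :* v) :+ p :* (v :* (w :- p :* u))) refl

  cy-pa : ∀ j → cy j ≡ pa (suc j) + pa (suc j) - pa j
  cy-pa 0 = refl
  cy-pa 1 = solve 1 (λ p → con 1ℚ := (con 1ℚ :- p :* con 0ℚ) :+ (con 1ℚ :- p :* con 0ℚ) :- con 1ℚ) refl p
  cy-pa (suc (suc j)) = trans (cong₂ (λ x y → x - p * y) (cy-pa (suc j)) (cy-pa j))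
    (solve 3 (λ p a b → (b :- p :* a :+ (b :- p :* a) :- b) :- p :* (b :+ b :- a)
               := (b :- p :* a :- p :* b) :+ (b :- p :* a :- p :* b) :- (b :- p :* a))
      refl p (pa j) (pa (suc j)))

  cy-cycle : ∀ j → cy (2 ℕ.+ j) ≡ pa (3 ℕ.+ j) - p * pa (1 ℕ.+ j)
  cy-cycle j = trans (cy-pa (2 ℕ.+ j))
    (solve 3 (λ p a b → (b :- p :* a) :+ (b :- p :* a) :- b := b :- p :* a :- p :* a)
      refl p (pa (suc j)) (pa (suc (suc j))))

  -- Deletion of the edge that joins two paths into one: the product also counts the sets that
  -- contain both ends of this edge, and they account for the summand with `p * p`.
  pa-merge : ∀ a b → pa (2 ℕ.+ a) * pa (2 ℕ.+ b) ≡ pa (2 ℕ.+ (a ℕ.+ b)) + p * p * (pa a * pa b)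
  pa-merge a b = sym (trans (cong (_+ p * p * (pa a * pa b)) (addition pa pa-rec (suc a) b))
    (solve 5 (λ p a0 a1 b0 b1 → ((a1 :- p :* a0) :* b1 :- p :* a1 :* b0) :+ p :* p :* (a0 :* b0)
                := (a1 :- p :* a0) :* (b1 :- p :* b0))
      refl p (pa a) (pa (suc a)) (pa b) (pa (suc b))))

  -- The comparison of `tree-ends` in the case of a path on t + 2 vertices whose two ends are
  -- removed. The last summand is its slack, which vanishes for t = 0.
  cy-pa-product : ∀ t → pa (2 ℕ.+ t) * cy (2 ℕ.+ t) ≡
    cy (1 ℕ.+ t) * pa (4 ℕ.+ t) + p * (cy (3 ℕ.+ t) * pa t)
  cy-pa-product t
    rewrite cy-pa t | cy-pa (suc t) =
    solve 3 (λ p a b →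
      let a2 = b :- p :* a
          a3 = a2 :- p :* b
          a4 = a3 :- p :* a2
          c0 = b :+ b :- a
          c1 = a2 :+ a2 :- b
          c2 = c1 :- p :* c0
      in a2 :* c2 := c1 :* a4 :+ p :* ((c2 :- p :* c1) :* a))
    refl p (pa t) (pa (suc t))

  two-ends-identity : ∀ a b → pa (2 ℕ.+ a) * pa (2 ℕ.+ b) * cy (2 ℕ.+ (a ℕ.+ b)) ≡
    cy (1 ℕ.+ (a ℕ.+ b)) * pa (4 ℕ.+ (a ℕ.+ b))
      + (p * (cy (3 ℕ.+ (a ℕ.+ b)) * pa (a ℕ.+ b))
         + p * p * (pa a * pa b) * cy (2 ℕ.+ (a ℕ.+ b)))
  two-ends-identity a b = trans (cong (_* cy (2 ℕ.+ (a ℕ.+ b))) (pa-merge a b))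
    (trans (ℚ.*-distribʳ-+ (cy (2 ℕ.+ (a ℕ.+ b))) (pa (2 ℕ.+ (a ℕ.+ b))) (p * p * (pa a * pa b)))
    (trans (cong (_+ p * p * (pa a * pa b) * cy (2 ℕ.+ (a ℕ.+ b))) (cy-pa-product (a ℕ.+ b)))
      (ℚ.+-assoc (cy (1 ℕ.+ (a ℕ.+ b)) * pa (4 ℕ.+ (a ℕ.+ b)))
                 (p * (cy (3 ℕ.+ (a ℕ.+ b)) * pa (a ℕ.+ b))) _)))

  module _ (0<p : 0ℚ < p) where

    -- The determinant of two solutions of one linear recurrence: each step multiplies it by `p`,
    -- and it starts at 2.
    casoratian-pos : ∀ j → 0ℚ < cy j * pa (suc j) - cy (suc j) * pa j
    casoratian-pos zero    = ℚ.positive⁻¹ (1ℚ + 1ℚ)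
    casoratian-pos (suc j) = subst (0ℚ <_)
      (solve 5 (λ p a b c d → p :* (c :* b :- d :* a)
                  := d :* (b :- p :* a) :- (d :- p :* c) :* b)
        refl p (pa j) (pa (suc j)) (cy j) (cy (suc j)))
      (0<* 0<p (casoratian-pos j))

    cy-pos-back : ∀ j → 0ℚ < pa (suc j) → 0ℚ ≤ pa j → 0ℚ < cy (suc j) → 0ℚ < cy j
    cy-pos-back j 0<a' 0≤a 0<c = pos-cancel 0<a'
      (subst (0ℚ <_) (solve 4 (λ a b c d → (c :* b :- d :* a) :+ d :* a := b :* c)
          refl (pa j) (pa (suc j)) (cy j) (cy (suc j)))
        (0<+ (casoratian-pos j) (0≤* (<⇒≤ 0<c) 0≤a)))

    -- In the applications a vertex v is joined to R and to K, without edges between R and K. `Y`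
    -- and `F` are I(R) and I(K), `Z` is p I(R - N(v)) and `G` is I(K - N(v)). The product of the
    -- bounds of the two pieces is multiplied by `S₂`; replacing `A₁ * s₁ * S₂` by the identity
    -- leaves the factor `A₂ * s₂` to cancel and `p * p * (Y * F) * K` to spare.
    module Join {A₁ A₂ s₁ s₂ S₁ S₂ K Y Z F G : ℚ}
      (0<A₁ : 0ℚ < A₁) (0<A₂ : 0ℚ < A₂) (0<s₁ : 0ℚ < s₁) (0<s₂ : 0ℚ < s₂)
      (0<S₂ : 0ℚ < S₂) (0<Y : 0ℚ < Y) (0<F : 0ℚ < F)
      (identity : A₁ * s₁ * S₂ ≡ A₂ * s₂ * S₁ + p * K)
      (left : p * A₁ * Y ≤ A₂ * Z)
      where

      private
        lower : A₂ * s₂ * (p * S₁ * (Y * F)) + p * p * (Y * F) * K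
              ≡ S₂ * (p * A₁ * Y * (s₁ * F))
        lower = trans
          (solve 7 (λ p A s S Y F K →
              A :* s :* (p :* S :* (Y :* F)) :+ p :* p :* (Y :* F) :* K
                := p :* (Y :* F) :* (A :* s :* S :+ p :* K))
            refl p A₂ s₂ S₁ Y F K)
          (trans (cong (p * (Y * F) *_) (sym identity))
            (solve 6 (λ p A s S Y F →
                p :* (Y :* F) :* (A :* s :* S) := S :* (p :* A :* Y :* (s :* F)))
              refl p A₁ s₁ S₂ Y F))

        upper : A₂ * s₂ * (S₂ * (Z * G)) ≡ S₂ * (A₂ * Z * (s₂ * G))
        upper = solve 5 (λ A s S Z G →
          A :* s :* (S :* (Z :* G)) := S :* (A :* Z :* (s :* G))) refl A₂ s₂ S₂ Z G

        0<pYF = 0<* (0<* 0<p 0<p) (0<* 0<Y 0<F)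

        0<left : 0ℚ < p * A₁ * Y
        0<left = 0<* (0<* 0<p 0<A₁) 0<Y

        mid-≤ : s₁ * F ≤ s₂ * G → S₂ * (p * A₁ * Y * (s₁ * F)) ≤ S₂ * (A₂ * Z * (s₂ * G))
        mid-≤ right = *-mono-≤ (<⇒≤ 0<S₂) ≤-refl
          (0≤* (<⇒≤ 0<left) (<⇒≤ (0<* 0<s₁ 0<F)))
          (*-mono-≤ (<⇒≤ 0<left) left (<⇒≤ (0<* 0<s₁ 0<F)) right)

      join-≤ : 0ℚ ≤ K → s₁ * F ≤ s₂ * G → p * S₁ * (Y * F) ≤ S₂ * (Z * G)
      join-≤ 0≤K right = cancel-≤ (0<* 0<A₂ 0<s₂)
        (≤-trans (le-add (0≤* (<⇒≤ 0<pYF) 0≤K))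
        (≤-trans (≤-reflexive lower) (≤-trans (mid-≤ right) (≤-reflexive (sym upper)))))

      join-<ᴷ : 0ℚ < K → s₁ * F ≤ s₂ * G → p * S₁ * (Y * F) < S₂ * (Z * G)
      join-<ᴷ 0<K right = cancel-< (0<* 0<A₂ 0<s₂)
        (<-≤-trans (lt-add (0<* 0<pYF 0<K))
        (≤-trans (≤-reflexive lower) (≤-trans (mid-≤ right) (≤-reflexive (sym upper)))))

      join-<ᴿ : 0ℚ ≤ K → s₁ * F < s₂ * G → p * S₁ * (Y * F) < S₂ * (Z * G)
      join-<ᴿ 0≤K right = cancel-< (0<* 0<A₂ 0<s₂)
        (≤-<-trans (le-add (0≤* (<⇒≤ 0<pYF) 0≤K))
        (≤-<-trans (≤-reflexive lower)
        (<-≤-trans (*-mono-<ʳ 0<S₂ ≤-refl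
           (0≤* (<⇒≤ 0<left) (<⇒≤ (0<* 0<s₁ 0<F)))
           (*-mono-<ʳ 0<left left (<⇒≤ (0<* 0<s₁ 0<F)) right))
          (≤-reflexive (sym upper)))))

    -- For a tree with two marked vertices, split at the first one as for `Join`, with the second
    -- one in K. `G` belongs to K without the neighbour of the first vertex, `H` to K without the
    -- second vertex. The product of `left` and `right` bounds `T` by a multiple of the path value
    -- `P`; then `right′` trades `F` for `H`, and `D` is the slack.
    module TwoEnds {A₁ A₂ B₁ B₂ P c₁ c₂ D Y Z F G H T : ℚ}
      (0<A₁ : 0ℚ < A₁) (0<A₂ : 0ℚ < A₂) (0<B₁ : 0ℚ < B₁) (0<B₂ : 0ℚ < B₂)
      (0<c₁ : 0ℚ < c₁) (0<c₂ : 0ℚ < c₂) (0<Y : 0ℚ < Y) (0<F : 0ℚ < F)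
      (P-eq : P ≡ A₂ * B₂ - p * A₁ * B₁)
      (identity : A₂ * B₁ * c₂ ≡ c₁ * P + D)
      (T-eq : T ≡ Y * F - Z * G)
      (left : p * A₁ * Y ≤ A₂ * Z)
      (right : B₁ * F ≤ B₂ * G) (right′ : B₁ * F ≤ B₂ * H)
      where

      private
        0<BF = 0<* 0<B₁ 0<F

        lower : A₂ * B₂ * (c₁ * T) ≤ c₁ * P * (Y * F)
        lower = ≤-by
          (0≤* (<⇒≤ 0<c₁) (0≤- (*-mono-≤ (<⇒≤ (0<* (0<* 0<p 0<A₁) 0<Y)) left (<⇒≤ 0<BF) right)))
          (trans (cong₂ (λ P T → c₁ * P * (Y * F) - A₂ * B₂ * (c₁ * T)) P-eq T-eq)
            (regroup (A₂ * B₂) p A₁ B₁ c₁ Y F Z G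
              (solve 4 (λ a b z g → a :* z :* (b :* g) := a :* b :* (z :* g)) refl A₂ B₂ Z G)))
          where
          regroup : ∀ AB p A₁ B₁ c Y F Z G {t} → t ≡ AB * (Z * G) →
            c * (AB - p * A₁ * B₁) * (Y * F) - AB * (c * (Y * F - Z * G)) ≡
            c * (t - p * A₁ * Y * (B₁ * F))
          regroup AB p A₁ B₁ c Y F Z G refl = trans
            (solve 6 (λ AB x c y f zg → c :* (AB :- x) :* (y :* f) :- AB :* (c :* (y :* f :- zg))
                := c :* (AB :* zg :- x :* (y :* f))) refl AB (p * A₁ * B₁) c Y F (Z * G))
            (cong (λ u → c * (AB * (Z * G) - u))
              (solve 5 (λ p a b y f → p :* a :* b :* (y :* f) := p :* a :* y :* (b :* f))
                refl p A₁ B₁ Y F))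

        upper : c₁ * P * (Y * F) + D * (Y * F) ≤ A₂ * B₂ * (c₂ * (Y * H))
        upper = ≤-by (0≤* (<⇒≤ (0<* (0<* 0<A₂ 0<c₂) 0<Y)) (0≤- right′))
          (trans (cong (λ t → A₂ * B₂ * (c₂ * (Y * H)) - t)
                   (trans (sym (ℚ.*-distribʳ-+ (Y * F) (c₁ * P) D)) (cong (_* (Y * F)) (sym identity))))
            (solve 7 (λ a b₁ b₂ c y f h → a :* b₂ :* (c :* (y :* h)) :- a :* b₁ :* c :* (y :* f)
                := a :* c :* y :* (b₂ :* h :- b₁ :* f)) refl A₂ B₁ B₂ c₂ Y F H))

      two-ends-≤ : 0ℚ ≤ D → c₁ * T ≤ c₂ * (Y * H)
      two-ends-≤ 0≤D = cancel-≤ (0<* 0<A₂ 0<B₂)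
        (≤-trans lower (≤-trans (le-add (0≤* 0≤D (<⇒≤ (0<* 0<Y 0<F)))) upper))

      two-ends-< : 0ℚ < D → c₁ * T < c₂ * (Y * H)
      two-ends-< 0<D = cancel-< (0<* 0<A₂ 0<B₂)
        (≤-<-trans lower (<-≤-trans (lt-add (0<* 0<D (0<* 0<Y 0<F))) upper))

    private
      swap-eq : ∀ S₁ S₂ W V → (S₂ - p * S₁) * W - S₂ * (W - V) ≡ S₂ * V - p * S₁ * W
      swap-eq = solve 5 (λ p S₁ S₂ W V →
        (S₂ :- p :* S₁) :* W :- S₂ :* (W :- V) := S₂ :* V :- p :* S₁ :* W) refl p

    -- `W` is I(G - v) and `W - V` is I(G). The term `S₂ * W` occurs on both sides of the quotient
    -- bound, and what remains is the form in which `Join` concludes. `ratio-left` goes the other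
    -- way, to supply `left`.
    ratio-≤ : ∀ S₁ S₂ W V → p * S₁ * W ≤ S₂ * V → S₂ * (W - V) ≤ (S₂ - p * S₁) * W
    ratio-≤ S₁ S₂ W V h = ≤-by (0≤- h) (swap-eq S₁ S₂ W V)

    ratio-< : ∀ S₁ S₂ W V → p * S₁ * W < S₂ * V → S₂ * (W - V) < (S₂ - p * S₁) * W
    ratio-< S₁ S₂ W V h = <-by (0<- h) (swap-eq S₁ S₂ W V)

    ratio-left : ∀ S₁ S₂ X Y → S₂ * X ≤ (S₂ - p * S₁) * Y → p * S₁ * Y ≤ S₂ * (Y - X)
    ratio-left S₁ S₂ X Y h = ≤-by (0≤- h)
      (solve 5 (λ p S₁ S₂ X Y → S₂ :* (Y :- X) :- p :* S₁ :* Y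
          := (S₂ :- p :* S₁) :* Y :- S₂ :* X) refl p S₁ S₂ X Y)

    -- f₁ belongs to a graph, and f₁ − p g to the same graph with one more leaf.
    module Extend {A₀ A₁ f₁ g : ℚ} (0<A₁ : 0ℚ < A₁) (0<f₁ : 0ℚ < f₁) (f₁≤A₁ : f₁ ≤ A₁)
      (ratio : A₀ * f₁ ≤ A₁ * g) (0<f : 0ℚ < f₁ - p * g) where

      private
        step-eq : (A₁ - p * A₀) * f₁ - A₁ * (f₁ - p * g) ≡ p * (A₁ * g - A₀ * f₁)
        step-eq = solve 5 (λ p A₀ A₁ f g → (A₁ :- p :* A₀) :* f :- A₁ :* (f :- p :* g)
          := p :* (A₁ :* g :- A₀ :* f)) refl p A₀ A₁ f₁ g

        step-≤ : A₁ * (f₁ - p * g) ≤ (A₁ - p * A₀) * f₁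
        step-≤ = ≤-by (0≤* (<⇒≤ 0<p) (0≤- ratio)) step-eq

      -- The next path or cycle value inherits its positivity from the graph: `A₁ * (f₁ - p * g)` is
      -- positive and at most `(A₁ - p * A₀) * f₁`.
      extend-pos : 0ℚ < A₁ - p * A₀
      extend-pos = pos-cancel 0<f₁ (<-≤-trans (0<* 0<A₁ 0<f)
        (≤-trans step-≤ (≤-reflexive (ℚ.*-comm (A₁ - p * A₀) f₁))))

      private
        to-A : (A₁ - p * A₀) * f₁ ≤ A₁ * (A₁ - p * A₀)
        to-A = ≤-trans
          (*-mono-≤ (<⇒≤ extend-pos) ≤-refl (<⇒≤ 0<f₁) f₁≤A₁)
          (≤-reflexive (ℚ.*-comm (A₁ - p * A₀) A₁))

      extend-≤ : f₁ - p * g ≤ A₁ - p * A₀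
      extend-≤ = cancel-≤ 0<A₁ (≤-trans step-≤ to-A)

      extend-< : A₀ * f₁ < A₁ * g → f₁ - p * g < A₁ - p * A₀
      extend-< h = cancel-< 0<A₁ (<-≤-trans (<-by (0<* 0<p (0<- h)) step-eq) to-A)

-- Independence polynomials of lists of vertices

-- Sets of vertices are lists considered up to _↭_.

∈⇒↭ : ∀ {A : Set} {x : A} {L} → x ∈ L → ∃ λ L₀ → L ↭ x ∷ L₀
∈⇒↭ {x = x} x∈L with ∈-∃++ x∈L
... | X , Y , refl = X ++ Y , shift x X Y

↭⇒∈ : ∀ {A : Set} {x : A} {L L₀} → L ↭ x ∷ L₀ → x ∈ L
↭⇒∈ σ = ∈-resp-↭ (↭-sym σ) (here refl)

++-∈⇒↭ˡ : ∀ {A : Set} {x : A} {L L₀ X} Y → L ↭ x ∷ L₀ → L ↭ X ++ Y → x ∈ X →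
  ∃ λ X₀ → X ↭ x ∷ X₀ × L₀ ↭ X₀ ++ Y
++-∈⇒↭ˡ Y σ τ x∈X with ∈⇒↭ x∈X
... | X₀ , ρ = X₀ , ρ , drop-∷ (↭-trans (↭-sym σ) (↭-trans τ (++⁺ʳ Y ρ)))

filter-complement : ∀ {A : Set} {P : Pred A 0ℓ} (P? : Decidable P) L →
  ∃ λ R → L ↭ filter P? L ++ R
filter-complement P? []      = [] , ↭-refl
filter-complement P? (x ∷ L) with filter-complement P? L | P? x
... | R , σ | yes _ = R , prep x σ
... | R , σ | no  _ = x ∷ R , ↭-trans (prep x σ) (↭-sym (shift x (filter P? L) R))

filter-comm : ∀ {A : Set} {P Q : Pred A 0ℓ} (P? : Decidable P) (Q? : Decidable Q) L →
  filter P? (filter Q? L) ≡ filter Q? (filter P? L)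
filter-comm P? Q? [] = refl
filter-comm P? Q? (x ∷ L) with P? x in eqP | Q? x in eqQ
... | yes _ | yes _ rewrite eqP | eqQ = cong (x ∷_) (filter-comm P? Q? L)
... | yes _ | no _  rewrite eqQ = filter-comm P? Q? L
... | no _  | yes _ rewrite eqP = filter-comm P? Q? L
... | no _  | no _  = filter-comm P? Q? L

module Independence {n : ℕ} (G : Graph n) where

  V = Fin n

  infix 4 _~_ _≁_
  _~_ _≁_ : V → V → Set
  u ~ v = Adj G u v
  u ≁ v = ¬ Adj G u v

  ≁-sym : ∀ {u v} → u ≁ v → v ≁ u
  ≁-sym u≁v = u≁v ∘ symm G

  away : V → List V → List V
  away v = filter (λ w → ¬? (adj? G v w))

  away-none : ∀ {v L} → All (v ≁_) L → away v L ≡ L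
  away-none {v} = filter-all (λ w → ¬? (adj? G v w))

  away-adj : ∀ {v w} L → v ~ w → away v (w ∷ L) ≡ away v L
  away-adj {v} L v~w = filter-reject (λ w → ¬? (adj? G v w)) (λ v≁w → v≁w v~w)

  away-nonadj : ∀ {v w} L → v ≁ w → away v (w ∷ L) ≡ w ∷ away v L
  away-nonadj {v} L v≁w = filter-accept (λ w → ¬? (adj? G v w)) v≁w

  away-↭ : ∀ v {L L′} → L ↭ L′ → away v L ↭ away v L′
  away-↭ v = filter-↭ (λ w → ¬? (adj? G v w))

  away-++ : ∀ v X Y → away v (X ++ Y) ≡ away v X ++ away v Y
  away-++ v = filter-++ (λ w → ¬? (adj? G v w))

  away-length : ∀ v L → length (away v L) ℕ.≤ length L
  away-length v = length-filter (λ w → ¬? (adj? G v w))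

  away-complement : ∀ v L → ∃ λ R → L ↭ away v L ++ R
  away-complement v = filter-complement (λ w → ¬? (adj? G v w))

  private
    -- `away v L` is not a structural part of `v ∷ L`, so the counter bounds the length. By `fuel`
    -- any sufficient counter gives the same value.
    ind′ : ℚ → ℕ → List V → ℚ
    ind′ p _       []      = 1ℚ
    ind′ p zero    (_ ∷ _) = 1ℚ
    ind′ p (suc m) (v ∷ L) = ind′ p m L - p * ind′ p m (away v L)

    fuel : ∀ p m m′ L → length L ℕ.≤ m → length L ℕ.≤ m′ → ind′ p m L ≡ ind′ p m′ L
    fuel p _       _        []      _        _        = refl
    fuel p (suc m) (suc m′) (v ∷ L) (s≤s ≤m) (s≤s ≤m′) = cong₂ (λ a b → a - p * b)
      (fuel p m m′ L ≤m ≤m′)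
      (fuel p m m′ (away v L) (ℕ.≤-trans (away-length v L) ≤m) (ℕ.≤-trans (away-length v L) ≤m′))

  abstract
    -- The independence polynomial of the subgraph induced on L, at −p.
    ind : ℚ → List V → ℚ
    ind p L = ind′ p (length L) L

    ind-[] : ∀ p → ind p [] ≡ 1ℚ
    ind-[] p = refl

    ind-∷ : ∀ p v L → ind p (v ∷ L) ≡ ind p L - p * ind p (away v L)
    ind-∷ p v L = cong (λ t → ind p L - p * t)
      (fuel p _ _ (away v L) (away-length v L) ℕ.≤-refl)

  module _ (p : ℚ) where

    ind-∷-none : ∀ {v L} → All (v ≁_) L → ind p (v ∷ L) ≡ (1ℚ - p) * ind p L
    ind-∷-none {v} {L} none = trans (ind-∷ p v L)
      (trans (cong (λ X → ind p L - p * ind p X) (away-none none))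
        (solve 2 (λ p x → x :- p :* x := (con 1ℚ :- p) :* x) refl p (ind p L)))

    private
      ind-swap : ∀ x y L → ind p (x ∷ y ∷ L) ≡ ind p (y ∷ x ∷ L)
      ind-swap x y L with adj? G x y
      ... | yes x~y
        rewrite ind-∷ p x (y ∷ L) | ind-∷ p y (x ∷ L)
              | away-adj L x~y | away-adj L (symm G x~y)
              | ind-∷ p x L | ind-∷ p y L =
        solve 3 (λ l a b → l :- b :- a := l :- a :- b) refl
          (ind p L) (p * ind p (away x L)) (p * ind p (away y L))
      ... | no x≁y
        rewrite ind-∷ p x (y ∷ L) | ind-∷ p y (x ∷ L)
              | away-nonadj L x≁y | away-nonadj L (≁-sym x≁y)
              | ind-∷ p x L | ind-∷ p y L
              | ind-∷ p y (away x L) | ind-∷ p x (away y L)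
              | filter-comm (λ w → ¬? (adj? G y w)) (λ w → ¬? (adj? G x w)) L =
        solve 5 (λ p l a b c → l :- p :* b :- p :* (a :- p :* c)
                            := l :- p :* a :- p :* (b :- p :* c)) refl
          p (ind p L) (ind p (away x L)) (ind p (away y L)) (ind p (away x (away y L)))

      -- In the case `prep` the permutation of `away x L` is newly made and not a part of the given
      -- one. The induction is therefore on the length bound first and on the permutation second.
      ind-↭′ : ∀ m {L L′} → length L ℕ.≤ m → L ↭ L′ → ind p L ≡ ind p L′
      ind-↭′ m ≤m Perm.refl = refl
      ind-↭′ (suc m) {x ∷ L} {x ∷ L′} (s≤s ≤m) (prep x σ) = trans (ind-∷ p x L)
        (trans (cong₂ (λ a b → a - p * b) (ind-↭′ m ≤m σ)
                 (ind-↭′ m (ℕ.≤-trans (away-length x L) ≤m) (away-↭ x σ)))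
          (sym (ind-∷ p x L′)))
      ind-↭′ (suc (suc m)) {x ∷ y ∷ L} {y ∷ x ∷ L′} (s≤s (s≤s ≤m)) (swap x y σ) =
        trans (ind-swap x y L) (trans (ind-∷ p y (x ∷ L))
          (trans (cong₂ (λ a b → a - p * b) (ind-↭′ (suc m) (s≤s ≤m) (prep x σ))
                   (ind-↭′ (suc m) (ℕ.≤-trans (away-length y (x ∷ L)) (s≤s ≤m))
                     (away-↭ y (prep x σ))))
            (sym (ind-∷ p y (x ∷ L′)))))
      ind-↭′ m ≤m (Perm.trans σ τ) = trans (ind-↭′ m ≤m σ)
        (ind-↭′ m (subst (ℕ._≤ m) (↭-length σ) ≤m) τ)

    ind-↭ : ∀ {L L′} → L ↭ L′ → ind p L ≡ ind p L′
    ind-↭ = ind-↭′ _ ℕ.≤-refl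

  NoCross : List V → List V → Set
  NoCross X K = All (λ x → All (x ≁_) K) X

  noCross-sym : ∀ {X K} → NoCross X K → NoCross K X
  noCross-sym {X} {K} nc = All.tabulate λ k∈K → All.tabulate λ x∈X →
    ≁-sym (All.lookup (All.lookup nc x∈X) k∈K)

  noCross-away : ∀ {X K} v → NoCross X K → NoCross (away v X) K
  noCross-away v = All.filter⁺ (λ w → ¬? (adj? G v w))

  ind-++ : ∀ p X K → NoCross X K → ind p (X ++ K) ≡ ind p X * ind p K
  ind-++ p X K = go (length X) X ℕ.≤-refl
    where
    go : ∀ m X → length X ℕ.≤ m → NoCross X K → ind p (X ++ K) ≡ ind p X * ind p K
    go m       []      _        _          =
      sym (trans (cong (_* ind p K) (ind-[] p)) (ℚ.*-identityˡ (ind p K)))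
    go (suc m) (x ∷ X) (s≤s ≤m) (x≁K ∷ nc) = trans (ind-∷ p x (X ++ K))
      (trans (cong₂ (λ a b → a - p * b) (go m X ≤m nc)
               (trans (cong (ind p) (trans (away-++ x X K) (cong (away x X ++_) (away-none x≁K))))
                 (go m (away x X) (ℕ.≤-trans (away-length x X) ≤m) (noCross-away x nc))))
      (trans (solve 4 (λ p a b k → a :* k :- p :* (b :* k) := (a :- p :* b) :* k) refl
               p (ind p X) (ind p (away x X)) (ind p K))
        (cong (_* ind p K) (sym (ind-∷ p x X)))))

  -- Hereditary by definition, hence available for every piece of a split. It also makes `ind`
  -- decrease when vertices are added, see `ind-++-<`.
  Pos : ℚ → List V → Set
  Pos p L = ∀ {H R} → L ↭ H ++ R → 0ℚ < ind p H

  module _ {p : ℚ} where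

    pos-sub : ∀ {L H R} → L ↭ H ++ R → Pos p L → Pos p H
    pos-sub {R = R} σ pos {H′} {R′} τ = pos {R = R′ ++ R}
      (↭-trans σ (↭-trans (++⁺ʳ R τ) (↭-reflexive (++-assoc H′ R′ R))))

    pos-self : ∀ {L} → Pos p L → 0ℚ < ind p L
    pos-self {L} pos = pos {R = []} (↭-reflexive (sym (++-identityʳ L)))

    pos-↭ : ∀ {L L′} → L ↭ L′ → Pos p L → Pos p L′
    pos-↭ σ pos τ = pos (↭-trans σ τ)

    pos-tail : ∀ {v L} → Pos p (v ∷ L) → Pos p L
    pos-tail {v} {L} = pos-sub (++-comm [ v ] L)

    pos-++ˡ : ∀ {X Y} → Pos p (X ++ Y) → Pos p X
    pos-++ˡ {X} {Y} = pos-sub (↭-refl {x = X ++ Y})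

    pos-++ʳ : ∀ X {Y} → Pos p (X ++ Y) → Pos p Y
    pos-++ʳ X {Y} = pos-sub (++-comm X Y)

    pos-away : ∀ v {L} → Pos p L → Pos p (away v L)
    pos-away v {L} pos with away-complement v L
    ... | R , σ = pos-sub σ pos

    ind-cons-< : ∀ {v L} → 0ℚ < p → Pos p L → ind p (v ∷ L) < ind p L
    ind-cons-< {v} {L} 0<p pos = <-by (0<* 0<p (pos-self (pos-away v pos)))
      (trans (cong (λ t → ind p L - t) (ind-∷ p v L))
        (solve 2 (λ a b → a :- (a :- b) := b) refl (ind p L) (p * ind p (away v L))))

    ind-++-≤ : ∀ X {L} → 0ℚ < p → Pos p (X ++ L) → ind p (X ++ L) ≤ ind p L
    ind-++-≤ []      0<p pos = ≤-refl
    ind-++-≤ (x ∷ X) 0<p pos = ≤-trans (<⇒≤ (ind-cons-< {x} 0<p (pos-tail pos)))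
      (ind-++-≤ X 0<p (pos-tail pos))

    ind-++-< : ∀ x X {L} → 0ℚ < p → Pos p (x ∷ X ++ L) → ind p (x ∷ X ++ L) < ind p L
    ind-++-< x X 0<p pos = <-≤-trans (ind-cons-< {x} 0<p (pos-tail pos))
      (ind-++-≤ X 0<p (pos-tail pos))

-- Trees and unicyclic graphs

module Shapes {n : ℕ} (G : Graph n) where
  open Independence G
  open DecMembership (Fin._≟_ {n}) using (_∈?_)

  -- Read in two ways: `z` is a new leaf attached to `L`, or, in `Split`, the edge from `z` to `u`
  -- is a bridge to a whole piece `L`.
  record LeafAt (z u : V) (L : List V) : Set where
    constructor leafAt
    field
      {others} : List V
      perm     : L ↭ u ∷ others
      adjacent : z ~ u
      isolated : All (z ≁_) others

  leaf-∈ : ∀ {z u L} → LeafAt z u L → u ∈ L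
  leaf-∈ (leafAt σ _ _) = ↭⇒∈ σ

  leaf-restrict : ∀ {z u L X Y} → LeafAt z u L → L ↭ X ++ Y → u ∈ X →
    LeafAt z u X × All (z ≁_) Y
  leaf-restrict {X = X} {Y} (leafAt σ z~u iso) τ u∈X with ++-∈⇒↭ˡ Y σ τ u∈X
  ... | X₀ , ρ , π with All.++⁻ X₀ (All-resp-↭ π iso)
  ... | isoX , isoY = leafAt ρ z~u isoX , isoY

  data Tree : List V → Set where
    single : ∀ {L v} → L ↭ [ v ] → Tree L
    leaf   : ∀ {L L′ z u} → Tree L → LeafAt z u L → L′ ↭ z ∷ L → Tree L′

  tree-↭ : ∀ {L L′} → L′ ↭ L → Tree L → Tree L′
  tree-↭ σ (single τ)   = single (↭-trans σ τ)
  tree-↭ σ (leaf t l τ) = leaf t l (↭-trans σ τ)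

  arc : (ℕ → V) → ℕ → ℕ → List V
  arc c i zero    = []
  arc c i (suc m) = c i ∷ arc c (suc i) m

  -- c runs periodically through a cycle of length 3 + j.
  record CyclicOrder (j : ℕ) (c : ℕ → V) : Set where
    field
      periodic : ∀ i → c (i ℕ.+ (3 ℕ.+ j)) ≡ c i
      next     : ∀ i → c i ~ c (suc i)
      last     : ∀ i → c i ~ c (2 ℕ.+ j ℕ.+ i)
      chord    : ∀ i d → d ℕ.< j → c i ≁ c (2 ℕ.+ d ℕ.+ i)

  data Uni : List V → Set where
    cycle : ∀ {L j c} → CyclicOrder j c → L ↭ arc c 0 (3 ℕ.+ j) → Uni L
    leaf  : ∀ {L L′ z u} → Uni L → LeafAt z u L → L′ ↭ z ∷ L → Uni L′

  uni-↭ : ∀ {L L′} → L′ ↭ L → Uni L → Uni L′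
  uni-↭ σ (cycle c τ)  = cycle c (↭-trans σ τ)
  uni-↭ σ (leaf t l τ) = leaf t l (↭-trans σ τ)

  arc-snoc : ∀ c i m → arc c i (suc m) ≡ arc c i m ++ [ c (m ℕ.+ i) ]
  arc-snoc c i zero    = refl
  arc-snoc c i (suc m) = cong (c i ∷_) (trans (arc-snoc c (suc i) m)
    (cong (λ k → arc c (suc i) m ++ [ c k ]) (ℕ.+-suc m i)))

  arc-All : ∀ {P : V → Set} c i m → (∀ d → d ℕ.< m → P (c (d ℕ.+ i))) → All P (arc c i m)
  arc-All c i zero    f = []
  arc-All {P} c i (suc m) f = f 0 (s≤s z≤n) ∷
    arc-All c (suc i) m (λ d d<m → subst (P ∘ c) (sym (ℕ.+-suc d i)) (f (suc d) (s≤s d<m)))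

  arc-∈ : ∀ {v} c i m → v ∈ arc c i m → ∃ λ d → d ℕ.< m × v ≡ c (d ℕ.+ i)
  arc-∈ c i (suc m) (here refl) = 0 , s≤s z≤n , refl
  arc-∈ c i (suc m) (there v∈) with arc-∈ c (suc i) m v∈
  ... | d , d<m , refl = suc d , s≤s d<m , cong c (ℕ.+-suc d i)

  arc-length : ∀ c i m → length (arc c i m) ≡ m
  arc-length c i zero    = refl
  arc-length c i (suc m) = cong suc (arc-length c (suc i) m)

  module _ {j c} (cyc : CyclicOrder j c) where
    open CyclicOrder cyc

    arc-rotate : ∀ i → arc c 0 (3 ℕ.+ j) ↭ arc c i (3 ℕ.+ j)
    arc-rotate zero    = ↭-refl
    arc-rotate (suc i) = ↭-trans (arc-rotate i)
      (↭-trans (++-comm [ c i ] (arc c (suc i) (2 ℕ.+ j)))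
        (↭-reflexive (sym (trans (arc-snoc c (suc i) (2 ℕ.+ j))
          (cong (λ v → arc c (suc i) (2 ℕ.+ j) ++ [ v ]) eq)))))
      where
      eq : c (2 ℕ.+ j ℕ.+ suc i) ≡ c i
      eq = trans (cong c (trans (ℕ.+-suc (2 ℕ.+ j) i) (ℕ.+-comm (3 ℕ.+ j) i))) (periodic i)

    arc-chord : ∀ i m → m ℕ.≤ j → All (c i ≁_) (arc c (2 ℕ.+ i) m)
    arc-chord i m m≤j = arc-All c (2 ℕ.+ i) m λ d d<m →
      subst (λ k → c i ≁ c k) (sym (trans (ℕ.+-suc d (suc i)) (cong suc (ℕ.+-suc d i))))
        (chord i d (ℕ.≤-trans d<m m≤j))

    arc-leaf : ∀ i m → m ℕ.≤ j → LeafAt (c i) (c (suc i)) (arc c (suc i) (suc m))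
    arc-leaf i m m≤j = leafAt ↭-refl (next i) (arc-chord i m m≤j)

    arc-tree : ∀ i m → m ℕ.≤ suc j → Tree (arc c i (suc m))
    arc-tree i zero    _         = single ↭-refl
    arc-tree i (suc m) (s≤s m≤j) =
      leaf (arc-tree (suc i) m (ℕ.m≤n⇒m≤1+n m≤j)) (arc-leaf i m m≤j) ↭-refl

    arc-ends : ∀ i → arc c (suc i) (2 ℕ.+ j) ↭ c (suc i) ∷ c (2 ℕ.+ j ℕ.+ i) ∷ arc c (2 ℕ.+ i) j
    arc-ends i = prep (c (suc i)) (↭-trans (↭-reflexive (trans (arc-snoc c (2 ℕ.+ i) j)
        (cong (λ k → arc c (2 ℕ.+ i) j ++ [ c k ]) (trans (ℕ.+-suc j (suc i)) (cong suc (ℕ.+-suc j i))))))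
      (++-comm (arc c (2 ℕ.+ i) j) [ c (2 ℕ.+ j ℕ.+ i) ]))

  -- `K` is one branch at `v`, hanging by the edge to `b`; `R` collects all other branches. There
  -- are two predicates because only one of the pieces can contain the cycle.
  record Split (Φ Ψ : List V → Set) (L : List V) (v : V) : Set where
    field
      {R K}  : List V
      {b}    : V
      perm   : L ↭ v ∷ R ++ K
      left   : Φ (v ∷ R)
      right  : Ψ K
      cross  : NoCross R K
      bridge : LeafAt v b K

  -- v lies on the cycle, whose other vertices are in T.
  record CycleSplit (L : List V) (v : V) : Set where
    field
      {R T T₀} : List V
      {w₁ w₂}  : V
      perm     : L ↭ v ∷ R ++ T
      left     : Tree (v ∷ R)
      right    : Tree T
      cross    : NoCross R T
      ends     : T ↭ w₁ ∷ w₂ ∷ T₀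
      v~w₁     : v ~ w₁
      v~w₂     : v ~ w₂
      isolated : All (v ≁_) T₀

  LeafClosed : (List V → Set) → Set
  LeafClosed Φ = ∀ {L L′ z u} → Φ L → LeafAt z u L → L′ ↭ z ∷ L → Φ L′

  private
    into-right : ∀ {L L′} {z v : V} R K → L′ ↭ z ∷ L → L ↭ v ∷ R ++ K → L′ ↭ v ∷ R ++ z ∷ K
    into-right {z = z} {v} R K τ σ =
      ↭-trans τ (↭-trans (prep z σ) (↭-sym (shift z (v ∷ R) K)))

    into-left : ∀ {L L′} {z v : V} R K → L′ ↭ z ∷ L → L ↭ v ∷ R ++ K → L′ ↭ v ∷ (z ∷ R) ++ K
    into-left {z = z} {v} R K τ σ = ↭-trans τ (↭-trans (prep z σ) (swap z v ↭-refl))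

    not-right : ∀ {u v : V} {L R K} → L ↭ v ∷ R ++ K → u ∈ L → u ∉ K → u ∈ v ∷ R
    not-right {v = v} {R = R} σ u∈L u∉K with ∈-++⁻ (v ∷ R) (∈-resp-↭ σ u∈L)
    ... | inj₁ u∈ = u∈
    ... | inj₂ u∈ = contradiction u∈ u∉K

  -- The new leaf joins the piece that contains its neighbour. The two extra facts about `K` let
  -- `tree-split` follow the vertex it aims at.
  split-leaf : ∀ {Φ Ψ} → LeafClosed Φ → LeafClosed Ψ →
    ∀ {L L′ z u v} (s : Split Φ Ψ L v) → LeafAt z u L → L′ ↭ z ∷ L →
    Σ (Split Φ Ψ L′ v) λ s′ →
      (u ∈ Split.K s → z ∈ Split.K s′) × (∀ {w} → w ∈ Split.K s → w ∈ Split.K s′)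
  split-leaf φ ψ {z = z} {u} {v} s l τ with u ∈? Split.K s
  ... | yes u∈K with leaf-restrict l (↭-trans (Split.perm s) (++-comm (v ∷ Split.R s) (Split.K s))) u∈K
  ... | lK , z≁v ∷ z≁R = record
    { perm   = into-right R K τ perm
    ; left   = left
    ; right  = ψ right lK ↭-refl
    ; cross  = noCross-sym (z≁R ∷ noCross-sym cross)
    ; bridge = leafAt (↭-trans (prep z (LeafAt.perm bridge)) (swap z _ ↭-refl))
                 (LeafAt.adjacent bridge) (≁-sym z≁v ∷ LeafAt.isolated bridge)
    } , (λ _ → here refl) , there
    where open Split s
  split-leaf φ ψ {z = z} {u} {v} s l τ | no u∉K
    with leaf-restrict l (Split.perm s) (not-right {R = Split.R s} (Split.perm s) (leaf-∈ l) u∉K)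
  ... | lR , z≁K = record
    { perm   = into-left R K τ perm
    ; left   = φ left lR (swap v z ↭-refl)
    ; right  = right
    ; cross  = z≁K ∷ cross
    ; bridge = bridge
    } , (λ u∈K → contradiction u∈K u∉K) , id
    where open Split s

  cycleSplit-leaf : ∀ {L L′ z u v} → CycleSplit L v → LeafAt z u L → L′ ↭ z ∷ L →
    CycleSplit L′ v
  cycleSplit-leaf {z = z} {u} {v} s l τ with u ∈? CycleSplit.T s
  ... | yes u∈T
    with leaf-restrict l (↭-trans (CycleSplit.perm s) (++-comm (v ∷ CycleSplit.R s) (CycleSplit.T s))) u∈T
  ... | lT , z≁v ∷ z≁R = record
    { perm     = into-right R T τ perm
    ; left     = left
    ; right    = leaf right lT ↭-refl
    ; cross    = noCross-sym (z≁R ∷ noCross-sym cross)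
    ; ends     = ↭-trans (prep z ends) (↭-sym (shift z (w₁ ∷ w₂ ∷ []) T₀))
    ; v~w₁     = v~w₁
    ; v~w₂     = v~w₂
    ; isolated = ≁-sym z≁v ∷ isolated
    }
    where open CycleSplit s
  cycleSplit-leaf {z = z} {u} {v} s l τ | no u∉T
    with leaf-restrict l (CycleSplit.perm s)
           (not-right {R = CycleSplit.R s} (CycleSplit.perm s) (leaf-∈ l) u∉T)
  ... | lR , z≁T = record
    { perm     = into-left R T τ perm
    ; left     = leaf left lR (swap v z ↭-refl)
    ; right    = right
    ; cross    = z≁T ∷ cross
    ; ends     = ends
    ; v~w₁     = v~w₁
    ; v~w₂     = v~w₂
    ; isolated = isolated
    }
    where open CycleSplit s

  private
    old : ∀ {L L′ M : List V} {z v : V} → L′ ↭ z ∷ L → L′ ↭ v ∷ M → v ≢ z →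
      ∃ λ M′ → L ↭ v ∷ M′ × M ↭ z ∷ M′
    old {L} {L′} {M} {z} {v} σ τ v≢z with ∈-resp-↭ σ (↭⇒∈ τ)
    ... | here v≡z  = contradiction v≡z v≢z
    ... | there v∈L with ∈⇒↭ v∈L
    ... | M′ , ρ = M′ , ρ , drop-∷ (↭-trans (↭-sym τ)
      (↭-trans σ (↭-trans (prep z ρ) (swap z v ↭-refl))))

  leaf-split : ∀ {Ψ L L′ z u} → Ψ L → LeafAt z u L → L′ ↭ z ∷ L → Split Tree Ψ L′ z
  leaf-split ψ l σ = record
    { R = [] ; perm = σ ; left = single ↭-refl ; right = ψ ; cross = [] ; bridge = l }

  -- The vertex `w` selects the branch at `v`. `tree-ends` relies on this choice to have its second
  -- marked vertex in `K`.
  tree-split : ∀ {L v M w} → Tree L → L ↭ v ∷ M → w ∈ M →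
    Σ (Split Tree Tree L v) λ s → w ∈ Split.K s
  tree-split {M = x ∷ M} (single σ) τ w∈M
    with () ← ↭-length (↭-trans (↭-sym τ) σ)
  tree-split {v = v} {M} {w} (leaf {z = z} {u} t l σ) τ w∈M with v Fin.≟ z
  ... | yes refl = leaf-split t l σ , ∈-resp-↭ (drop-∷ (↭-trans (↭-sym τ) σ)) w∈M
  ... | no v≢z with old σ τ v≢z
  ... | M′ , ρ , π with ∈-resp-↭ π w∈M
  ... | there w∈M′ =
    let s , w∈K        = tree-split t ρ w∈M′
        s′ , _ , keeps = split-leaf leaf leaf s l σ
    in s′ , keeps w∈K
  -- Here `w` is the new leaf `z`. If it hangs on `v`, it forms a branch alone; otherwise its branch
  -- is that of its neighbour `u`.
  ... | here refl with u Fin.≟ v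
  ... | yes refl = record
    { perm   = ↭-trans σ (↭-trans (prep z (LeafAt.perm l)) (++-comm [ z ] (v ∷ LeafAt.others l)))
    ; left   = tree-↭ (↭-sym (LeafAt.perm l)) t
    ; right  = single ↭-refl
    ; cross  = noCross-sym (LeafAt.isolated l ∷ [])
    ; bridge = leafAt ↭-refl (symm G (LeafAt.adjacent l)) []
    } , here refl
  ... | no u≢v with ∈-resp-↭ ρ (leaf-∈ l)
  ... | here u≡v   = contradiction u≡v u≢v
  ... | there u∈M′ =
    let s , u∈K      = tree-split t ρ u∈M′
        s′ , new , _ = split-leaf leaf leaf s l σ
    in s′ , new u∈K

  data UniSplit (L : List V) (v : V) : Set where
    cycle-right : Split Tree Uni L v → UniSplit L v
    cycle-left  : Split Uni Tree L v → UniSplit L v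
    on-cycle    : CycleSplit L v → UniSplit L v

  uni-split : ∀ {L v M} → Uni L → L ↭ v ∷ M → UniSplit L v
  uni-split {L} (cycle {j = j} {c} cyc σ) τ with arc-∈ c 0 (3 ℕ.+ j) (∈-resp-↭ σ (↭⇒∈ τ))
  ... | i , _ , refl rewrite ℕ.+-identityʳ i = on-cycle (record
    { R        = []
    ; perm     = ↭-trans σ (arc-rotate cyc i)
    ; left     = single ↭-refl
    ; right    = arc-tree cyc (suc i) (suc j) ℕ.≤-refl
    ; cross    = []
    ; ends     = arc-ends cyc i
    ; v~w₁     = CyclicOrder.next cyc i
    ; v~w₂     = CyclicOrder.last cyc i
    ; isolated = arc-chord cyc i j ℕ.≤-refl
    })
  uni-split {v = v} (leaf {z = z} t l σ) τ with v Fin.≟ z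
  ... | yes refl = cycle-right (leaf-split t l σ)
  ... | no v≢z with old σ τ v≢z
  ... | M′ , ρ , π with uni-split t ρ
  ... | cycle-right s = cycle-right (proj₁ (split-leaf leaf leaf s l σ))
  ... | cycle-left s  = cycle-left (proj₁ (split-leaf leaf leaf s l σ))
  ... | on-cycle s    = on-cycle (cycleSplit-leaf s l σ)

  uni-length : ∀ {L} → Uni L → ∃ λ j → length L ≡ 3 ℕ.+ j
  uni-length (cycle {j = j} {c} _ σ) = j , trans (↭-length σ) (arc-length c 0 (3 ℕ.+ j))
  uni-length (leaf t _ σ) with uni-length t
  ... | j , eq = suc j , trans (↭-length σ) (cong suc eq)

  -- The vertices of some Dₘ, listed from the end of its path to the triangle.
  data DList : List V → Set where
    triangle : ∀ {a b c} → a ~ b → a ~ c → b ~ c → DList (a ∷ b ∷ c ∷ [])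
    extend   : ∀ {x y l} → x ~ y → All (x ≁_) l → DList (y ∷ l) → DList (x ∷ y ∷ l)

  DShape : List V → V → Set
  DShape L v = ∃ λ l → L ↭ v ∷ l × DList (v ∷ l)

  dshape-leaf : ∀ {L K v b} → L ↭ v ∷ K → LeafAt v b K → DShape K b → DShape L v
  dshape-leaf {v = v} {b} σ (leafAt τ v~b iso) (l , ρ , d) = b ∷ l ,
    ↭-trans σ (prep v ρ) ,
    extend v~b (All-resp-↭ (drop-∷ (↭-trans (↭-sym τ) ρ)) iso) d

  IsCycle : List V → Set
  IsCycle L = ∃₂ λ j c → CyclicOrder j c × L ↭ arc c 0 (3 ℕ.+ j)

-- Comparison with paths and cycles

module Comparison {n : ℕ} (G : Graph n) (p : ℚ) (0<p : 0ℚ < p) where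
  open Independence G
  open Shapes G
  open Recurrence p

  pa-2 : pa 2 ≡ 1ℚ
  pa-2 = solve 1 (λ p → con 1ℚ :- p :* con 0ℚ := con 1ℚ) refl p

  ind-leaf : ∀ {z u L} (l : LeafAt z u L) → ind p (z ∷ L) ≡ ind p L - p * ind p (LeafAt.others l)
  ind-leaf {z} {u} {L} (leafAt {X} σ z~u iso) = trans (ind-∷ p z L)
    (cong (λ t → ind p L - p * t) (trans (ind-↭ p (away-↭ z σ))
      (cong (ind p) (trans (away-adj X z~u) (away-none iso)))))

  -- The vertex recurrence at `v`, with `p * ind p (away v R)` written as a difference, because in
  -- this form the quotient bound of `v ∷ R` at `v` applies to it. `K₀` lacks one neighbour of `v`
  -- in a bridge split and two in a split on the cycle.
  ind-join : ∀ {L v R K K₀} → L ↭ v ∷ R ++ K → NoCross R K → away v K ↭ K₀ →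
    ind p L ≡ ind p R * ind p K - (ind p R - ind p (v ∷ R)) * ind p K₀
  ind-join {L} {v} {R} {K} {K₀} σ nc τ = begin
    ind p L                                                     ≡⟨ ind-↭ p σ ⟩
    ind p (v ∷ R ++ K)                                          ≡⟨ ind-∷ p v (R ++ K) ⟩
    ind p (R ++ K) - p * ind p (away v (R ++ K))                ≡⟨ cong₂ (λ a b → a - p * b) (ind-++ p R K nc) eq ⟩
    ind p R * ind p K - p * (ind p (away v R) * ind p K₀)       ≡⟨ regroup ⟩
    ind p R * ind p K - (ind p R - (ind p R - p * ind p (away v R))) * ind p K₀
      ≡⟨ cong (λ t → ind p R * ind p K - (ind p R - t) * ind p K₀) (ind-∷ p v R) ⟨
    ind p R * ind p K - (ind p R - ind p (v ∷ R)) * ind p K₀    ∎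
    where
    open ≡-Reasoning
    eq : ind p (away v (R ++ K)) ≡ ind p (away v R) * ind p K₀
    eq = trans (cong (ind p) (away-++ v R K))
      (trans (ind-++ p (away v R) (away v K) (All.map (λ x≁K → All.filter⁺ _ x≁K) (noCross-away v nc)))
        (cong (ind p (away v R) *_) (ind-↭ p τ)))
    regroup : ind p R * ind p K - p * (ind p (away v R) * ind p K₀) ≡
      ind p R * ind p K - (ind p R - (ind p R - p * ind p (away v R))) * ind p K₀
    regroup = solve 5 (λ p r k a k₀ → r :* k :- p :* (a :* k₀) := r :* k :- (r :- (r :- p :* a)) :* k₀)
      refl p (ind p R) (ind p K) (ind p (away v R)) (ind p K₀)

  leaf-away : ∀ {v b K} (l : LeafAt v b K) → away v K ↭ LeafAt.others l
  leaf-away {v} (leafAt {X} σ v~b iso) = ↭-trans (away-↭ v σ)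
    (↭-reflexive (trans (away-adj X v~b) (away-none iso)))

  -- `ratio` bounds I(T) / I(T - v) by I(Pₙ) / I(Pₙ₋₁). The three facts are proved together: `ratio`
  -- at the neighbour of a new leaf gives the next `pos` and `bound`.
  record TreeBounds (L : List V) : Set where
    field
      pos   : ∀ j → j ℕ.≤ length L → 0ℚ < pa (2 ℕ.+ j)
      bound : ind p L ≤ pa (2 ℕ.+ length L)
      ratio : ∀ {v M} → L ↭ v ∷ M →
        pa (2 ℕ.+ length M) * ind p L ≤ pa (3 ℕ.+ length M) * ind p M

    pos₁ : ∀ j → j ℕ.≤ length L → 0ℚ < pa (1 ℕ.+ j)
    pos₁ zero    _ = 0<1
    pos₁ (suc j) ≤ = pos j (ℕ.≤-trans (ℕ.n≤1+n j) ≤)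

    nonneg : ∀ j → j ℕ.≤ length L → 0ℚ ≤ pa j
    nonneg zero    _ = ≤-refl
    nonneg (suc j) ≤ = <⇒≤ (pos₁ j (ℕ.≤-trans (ℕ.n≤1+n j) ≤))

    left : ∀ {v M} → L ↭ v ∷ M →
      p * pa (1 ℕ.+ length M) * ind p M ≤ pa (2 ℕ.+ length M) * (ind p M - ind p (v ∷ M))
    left {v} {M} σ = ratio-left 0<p (pa (1 ℕ.+ length M)) (pa (2 ℕ.+ length M)) (ind p (v ∷ M)) (ind p M)
      (subst (λ t → pa (2 ℕ.+ length M) * t ≤ pa (3 ℕ.+ length M) * ind p M) (ind-↭ p σ) (ratio σ))

  below-suc : ∀ {P : ℕ → Set} {m} → (∀ j → j ℕ.≤ m → P j) → P (suc m) → ∀ j → j ℕ.≤ suc m → P j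
  below-suc {P} {m} below top j j≤ with j ℕ.≟ suc m
  ... | yes refl = top
  ... | no  j≢   = below j (ℕ.≤-pred (ℕ.≤∧≢⇒< j≤ j≢))

  private
    nonempty : ∀ {A : Set} {x : A} {K} → x ∈ K → ∃ λ k → length K ≡ suc k
    nonempty {K = _ ∷ K} _ = length K , refl

    sizes : ∀ {A : Set} {L K : List A} R {v m} → L ↭ v ∷ R ++ K → length L ℕ.≤ suc m →
      length R ℕ.+ length K ℕ.≤ m
    sizes R {m = m} σ ≤m = ℕ.≤-pred (subst (ℕ._≤ suc m)
      (trans (↭-length σ) (cong suc (length-++ R))) ≤m)

    size-tail : ∀ {A : Set} {L M X : List A} {v w} → L ↭ v ∷ M → L ↭ w ∷ X → length M ≡ length X
    size-tail σ τ = ℕ.suc-injective (trans (sym (↭-length σ)) (↭-length τ))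

  tree-bounds : ∀ m {L} → length L ℕ.≤ m → Tree L → Pos p L → TreeBounds L
  tree-bounds zero {x ∷ L} ()
  tree-bounds zero {[]} _ (single σ) with () ← ↭-length σ
  tree-bounds zero {[]} _ (leaf _ _ σ) with () ← ↭-length σ
  tree-bounds (suc m) {L} ≤m (single {v = x} σ) pos = record
    { pos   = subst (λ k → ∀ j → j ℕ.≤ k → 0ℚ < pa (2 ℕ.+ j)) (sym |L|)
                (below-suc {P = λ j → 0ℚ < pa (2 ℕ.+ j)}
                  (λ { zero _ → subst (0ℚ <_) (sym pa-2) 0<1 })
                  (subst (0ℚ <_) ind-L (pos-self pos)))
    ; bound = ≤-reflexive (trans ind-L (cong (λ k → pa (2 ℕ.+ k)) (sym |L|)))
    ; ratio = λ τ → ratio′ τ (ℕ.suc-injective (trans (sym (↭-length τ)) |L|))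
    }
    where
    |L| : length L ≡ 1
    |L| = ↭-length σ
    ind-L : ind p L ≡ pa 3
    ind-L = trans (ind-↭ p σ) (trans (ind-∷ p x [])
      (cong₂ (λ a b → a - p * b) (trans (ind-[] p) (sym pa-2)) (ind-[] p)))
    ratio′ : ∀ {v M} → L ↭ v ∷ M → length M ≡ 0 →
      pa (2 ℕ.+ length M) * ind p L ≤ pa (3 ℕ.+ length M) * ind p M
    ratio′ {M = []} τ _ = ≤-reflexive (trans (ℚ.*-comm (pa 2) (ind p L))
      (cong₂ _*_ ind-L (trans pa-2 (sym (ind-[] p)))))
  tree-bounds (suc m) {L} ≤m tree@(leaf {L = L₁} {z = z} {u} t l σ) pos = record
    { pos   = subst (λ k → ∀ j → j ℕ.≤ k → 0ℚ < pa (2 ℕ.+ j)) (sym |L|)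
                (below-suc {P = λ j → 0ℚ < pa (2 ℕ.+ j)} (TreeBounds.pos IH)
                  (subst (λ k → 0ℚ < pa (3 ℕ.+ k)) (sym |L₁|) E.extend-pos))
    ; bound = ≤-trans (≤-reflexive ind-L) (≤-trans E.extend-≤
                (≤-reflexive (cong (λ k → pa (2 ℕ.+ k)) (sym (trans |L| (cong suc |L₁|))))))
    ; ratio = ratio′
    }
    where
    X = LeafAt.others l
    |L| : length L ≡ suc (length L₁)
    |L| = ↭-length σ
    |L₁| : length L₁ ≡ suc (length X)
    |L₁| = ↭-length (LeafAt.perm l)
    pos₁ : Pos p L₁
    pos₁ = pos-tail (pos-↭ σ pos)
    IH : TreeBounds L₁
    IH = tree-bounds m (ℕ.≤-pred (subst (ℕ._≤ suc m) |L| ≤m)) t pos₁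
    ind-L : ind p L ≡ ind p L₁ - p * ind p X
    ind-L = trans (ind-↭ p σ) (ind-leaf l)
    module E = Extend 0<p {A₀ = pa (2 ℕ.+ length X)} {A₁ = pa (3 ℕ.+ length X)}
      (subst (λ k → 0ℚ < pa (2 ℕ.+ k)) |L₁| (TreeBounds.pos IH (length L₁) ℕ.≤-refl))
      (pos-self pos₁)
      (subst (λ k → ind p L₁ ≤ pa (2 ℕ.+ k)) |L₁| (TreeBounds.bound IH))
      (TreeBounds.ratio IH (LeafAt.perm l))
      (subst (0ℚ <_) ind-L (pos-self pos))
    ratio′ : ∀ {v M} → L ↭ v ∷ M →
      pa (2 ℕ.+ length M) * ind p L ≤ pa (3 ℕ.+ length M) * ind p M
    ratio′ {v} {[]} τ with () ← trans (sym (trans |L| (cong suc |L₁|))) (↭-length τ)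
    -- Any other vertex `w` provides a nonempty branch at `v`, so both pieces of the split are
    -- smaller than `L` and the induction hypothesis covers their quotients.
    ratio′ {v} {w ∷ M₀} τ with tree-split tree τ (here refl)
    ... | s , _ = go s
      where
      M = w ∷ M₀
      go : Split Tree Tree L v → pa (2 ℕ.+ length M) * ind p L ≤ pa (3 ℕ.+ length M) * ind p M
      go s = subst (λ q → pa (2 ℕ.+ q) * ind p L ≤ pa (3 ℕ.+ q) * ind p M) (sym |M|)
        (≤-trans (≤-reflexive (cong (pa (2 ℕ.+ (r ℕ.+ k)) *_) (ind-join perm cross (leaf-away bridge))))
        (≤-trans (ratio-≤ 0<p (pa (1 ℕ.+ (r ℕ.+ k))) (pa (2 ℕ.+ (r ℕ.+ k))) (Y * F) ((Y - ind p (v ∷ R)) * H)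
          (J.join-≤
            (0≤* (0≤* (TR.nonneg r (ℕ.n≤1+n r)) (TK.nonneg k ℕ.≤-refl)) (<⇒≤ 0<S₃))
            (TK′ bridge)))
          (≤-reflexive (cong (pa (3 ℕ.+ (r ℕ.+ k)) *_) (sym ind-M)))))
        where
        open Split s hiding (left)
        r = length R
        k = length K
        Y = ind p R
        F = ind p K
        H = ind p (LeafAt.others bridge)
        M↭ : M ↭ R ++ K
        M↭ = drop-∷ (↭-trans (↭-sym τ) perm)
        |M| : length M ≡ r ℕ.+ k
        |M| = trans (↭-length M↭) (length-++ R)
        ind-M : ind p M ≡ Y * F
        ind-M = trans (ind-↭ p M↭) (ind-++ p R K cross)
        r+k≤m : r ℕ.+ k ℕ.≤ m
        r+k≤m = sizes R perm ≤m
        0<k : 0 ℕ.< k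
        0<k with nonempty (leaf-∈ bridge)
        ... | _ , eq = subst (0 ℕ.<_) (sym eq) (s≤s z≤n)
        pos-L : Pos p (v ∷ R ++ K)
        pos-L = pos-↭ perm pos
        module TR = TreeBounds (tree-bounds m
          (ℕ.≤-trans (subst (ℕ._≤ r ℕ.+ k) (ℕ.+-comm r 1) (ℕ.+-monoʳ-≤ r 0<k)) r+k≤m)
          (Split.left s) (pos-++ˡ pos-L))
        module TK = TreeBounds (tree-bounds m (ℕ.≤-trans (ℕ.m≤n+m k r) r+k≤m) right (pos-++ʳ (v ∷ R) pos-L))
        TK′ : ∀ {b} (l : LeafAt v b K) → pa (1 ℕ.+ k) * F ≤ pa (2 ℕ.+ k) * ind p (LeafAt.others l)
        TK′ l = subst (λ q → pa (1 ℕ.+ q) * F ≤ pa (2 ℕ.+ q) * ind p (LeafAt.others l))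
          (sym (↭-length (LeafAt.perm l))) (TK.ratio (LeafAt.perm l))
        bound-pos : ∀ j → j ℕ.≤ r ℕ.+ k → 0ℚ < pa (2 ℕ.+ j)
        bound-pos j j≤ = TreeBounds.pos IH j (ℕ.≤-trans j≤ (ℕ.≤-reflexive
          (ℕ.suc-injective (trans (sym (trans (↭-length perm) (cong suc (length-++ R)))) |L|))))
        0<S₃ : 0ℚ < pa (3 ℕ.+ (r ℕ.+ k))
        0<S₃ = subst (λ q → 0ℚ < pa (2 ℕ.+ q))
          (trans (sym (trans |L| (cong suc |L₁|))) (trans (↭-length perm) (cong suc (length-++ R))))
          E.extend-pos
        module J = Join 0<p {A₁ = pa (1 ℕ.+ r)} {A₂ = pa (2 ℕ.+ r)} {s₁ = pa (1 ℕ.+ k)} {s₂ = pa (2 ℕ.+ k)}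
          {S₁ = pa (1 ℕ.+ (r ℕ.+ k))} {S₂ = pa (2 ℕ.+ (r ℕ.+ k))}
          {K = pa r * pa k * pa (3 ℕ.+ (r ℕ.+ k))}
          {Y = Y} {Z = Y - ind p (v ∷ R)} {F = F} {G = H}
          (TR.pos₁ r (ℕ.n≤1+n r)) (TR.pos r (ℕ.n≤1+n r)) (TK.pos₁ k ℕ.≤-refl) (TK.pos k ℕ.≤-refl)
          (bound-pos (r ℕ.+ k) ℕ.≤-refl)
          (pos-self (pos-tail (pos-++ˡ pos-L))) (pos-self (pos-++ʳ (v ∷ R) pos-L))
          (product-identity pa pa-rec r k)
          (TR.left ↭-refl)

  -- Serves a vertex v of the cycle whose neighbours in `T` are `w₁` and `w₂`, so that `T₀` is T -
  -- N(v). The tree is split at `w₁` towards `w₂`, and the quotient bound of the branch is used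
  -- twice: at the far end of the bridge and at `w₂`. The slack contains `pa (r ℕ.+ k)`, which is
  -- positive as soon as `T₀` is nonempty.
  tree-ends : ∀ {T w₁ w₂ T₀} → Tree T → Pos p T → T ↭ w₁ ∷ w₂ ∷ T₀ →
    (∀ j → j ℕ.≤ 3 ℕ.+ length T₀ → 0ℚ < cy j) →
    cy (1 ℕ.+ length T₀) * ind p T ≤ cy (2 ℕ.+ length T₀) * ind p T₀ ×
    (0 ℕ.< length T₀ → cy (1 ℕ.+ length T₀) * ind p T < cy (2 ℕ.+ length T₀) * ind p T₀)
  tree-ends {T} {w₁} {w₂} {T₀} tree pos σ cpos with tree-split tree σ (here refl)
  ... | s , w₂∈K with ∈⇒↭ w₂∈K
  ... | K₂ , κ =
      subst (λ q → cy (1 ℕ.+ q) * ind p T ≤ cy (2 ℕ.+ q) * ind p T₀) (sym |T₀|)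
        (≤-trans (E.two-ends-≤ (0≤+ (0≤* (<⇒≤ 0<p) (0≤* (<⇒≤ (cpos₀ 3 ℕ.≤-refl)) (TT.nonneg _ t≤))) 0≤D₂))
          (≤-reflexive eq₀))
    , λ 0<t → subst (λ q → cy (1 ℕ.+ q) * ind p T < cy (2 ℕ.+ q) * ind p T₀) (sym |T₀|)
        (<-≤-trans (E.two-ends-< (0<+ (0<* 0<p (0<* (cpos₀ 3 ℕ.≤-refl) (pa-t (subst (0 ℕ.<_) |T₀| 0<t) t≤))) 0≤D₂))
          (≤-reflexive eq₀))
    where
    open Split s hiding (left)
    r = length R
    k = length K₂
    Y = ind p R
    F = ind p K
    H = ind p (LeafAt.others bridge)
    T₀↭ : T₀ ↭ R ++ K₂
    T₀↭ = drop-∷ (↭-trans (drop-∷ (↭-trans (↭-sym σ) perm)) (↭-trans (++⁺ˡ R κ) (shift w₂ R K₂)))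
    |T₀| : length T₀ ≡ r ℕ.+ k
    |T₀| = trans (↭-length T₀↭) (length-++ R)
    |T| : length T ≡ 2 ℕ.+ (r ℕ.+ k)
    |T| = trans (↭-length σ) (cong (2 ℕ.+_) |T₀|)
    |K| : length K ≡ suc k
    |K| = ↭-length κ
    module TT = TreeBounds (tree-bounds (length T) ℕ.≤-refl tree pos)
    t≤ : r ℕ.+ k ℕ.≤ length T
    t≤ = subst (r ℕ.+ k ℕ.≤_) (sym |T|) (ℕ.m≤n+m _ 2)
    pa-t : ∀ {q} → 0 ℕ.< q → q ℕ.≤ length T → 0ℚ < pa q
    pa-t {suc q} _ q≤ = TT.pos₁ q (ℕ.≤-trans (ℕ.n≤1+n q) q≤)
    cpos₀ : ∀ i → i ℕ.≤ 3 → 0ℚ < cy (i ℕ.+ (r ℕ.+ k))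
    cpos₀ i i≤ = cpos _ (ℕ.+-mono-≤ i≤ (ℕ.≤-reflexive (sym |T₀|)))
    pos-L : Pos p (w₁ ∷ R ++ K)
    pos-L = pos-↭ perm pos
    module TR = TreeBounds (tree-bounds (length (w₁ ∷ R)) ℕ.≤-refl (Split.left s) (pos-++ˡ pos-L))
    module TK = TreeBounds (tree-bounds (length K) ℕ.≤-refl right (pos-++ʳ (w₁ ∷ R) pos-L))
    k≤ : ∀ i → i ℕ.≤ suc k → i ℕ.≤ length K
    k≤ i = subst (i ℕ.≤_) (sym |K|)
    TK′ : ∀ {w K₀} → K ↭ w ∷ K₀ → pa (2 ℕ.+ k) * F ≤ pa (3 ℕ.+ k) * ind p K₀
    TK′ {K₀ = K₀} ρ = subst (λ q → pa (2 ℕ.+ q) * F ≤ pa (3 ℕ.+ q) * ind p K₀)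
      (size-tail ρ κ) (TK.ratio ρ)
    0≤D₂ : 0ℚ ≤ p * p * (pa r * pa k) * cy (2 ℕ.+ (r ℕ.+ k))
    0≤D₂ = 0≤* (0≤* (<⇒≤ (0<* 0<p 0<p))
        (0≤* (TR.nonneg r (ℕ.n≤1+n r)) (TK.nonneg k (k≤ k (ℕ.n≤1+n k)))))
      (<⇒≤ (cpos₀ 2 (s≤s (s≤s z≤n))))
    eq₀ : cy (2 ℕ.+ (r ℕ.+ k)) * (Y * ind p K₂) ≡ cy (2 ℕ.+ (r ℕ.+ k)) * ind p T₀
    eq₀ = cong (cy (2 ℕ.+ (r ℕ.+ k)) *_) (sym (trans (ind-↭ p T₀↭) (ind-++ p R K₂ nc)))
      where
      nc : NoCross R K₂
      nc = All.map (λ x≁K → All.tail (All-resp-↭ κ x≁K)) cross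
    module E = TwoEnds 0<p {A₁ = pa (1 ℕ.+ r)} {A₂ = pa (2 ℕ.+ r)} {B₁ = pa (2 ℕ.+ k)} {B₂ = pa (3 ℕ.+ k)}
      {P = pa (4 ℕ.+ (r ℕ.+ k))} {c₁ = cy (1 ℕ.+ (r ℕ.+ k))} {c₂ = cy (2 ℕ.+ (r ℕ.+ k))}
      {D = p * (cy (3 ℕ.+ (r ℕ.+ k)) * pa (r ℕ.+ k)) + p * p * (pa r * pa k) * cy (2 ℕ.+ (r ℕ.+ k))}
      {Y = Y} {Z = Y - ind p (w₁ ∷ R)} {F = F} {G = H} {H = ind p K₂} {T = ind p T}
      (TR.pos₁ r (ℕ.n≤1+n r)) (TR.pos r (ℕ.n≤1+n r))
      (TK.pos k (k≤ k (ℕ.n≤1+n k))) (TK.pos (suc k) (k≤ (suc k) ℕ.≤-refl))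
      (cpos₀ 1 (s≤s z≤n)) (cpos₀ 2 (s≤s (s≤s z≤n)))
      (pos-self (pos-tail (pos-++ˡ pos-L))) (pos-self (pos-++ʳ (w₁ ∷ R) pos-L))
      (trans (cong (λ q → pa (2 ℕ.+ q)) (trans (cong suc (sym (ℕ.+-suc r k))) (sym (ℕ.+-suc r (suc k)))))
        (addition pa pa-rec (suc r) (2 ℕ.+ k)))
      (two-ends-identity r k)
      (ind-join perm cross (leaf-away bridge))
      (TR.left ↭-refl)
      (TK′ (LeafAt.perm bridge))
      (TK′ κ)

  tree-edge : ∀ {T w₁ w₂} → Tree T → T ↭ w₁ ∷ w₂ ∷ [] → w₁ ~ w₂
  tree-edge tree σ with tree-split tree σ (here refl)
  ... | s , _ with ∈-resp-↭ (drop-∷ (↭-trans (↭-sym (Split.perm s)) σ))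
                     (∈-++⁺ʳ (Split.R s) (leaf-∈ (Split.bridge s)))
  ... | here refl = LeafAt.adjacent (Split.bridge s)

  -- Unicyclic graphs against cycles

  Extremal : List V → Set
  Extremal L = IsCycle L ⊎ ∃ (DShape L)

  -- Each non-strict alternative carries the shape that permits it. `Extremal` has two cases because
  -- Dₙ and Cₙ have the same independence polynomial.
  record UniBounds (L : List V) : Set where
    field
      pos   : ∀ j → j ℕ.≤ length L → 0ℚ < cy j
      bound : ind p L < cy (length L) ⊎ ind p L ≤ cy (length L) × Extremal L
      ratio : ∀ {v M} → L ↭ v ∷ M →
        cy (length M) * ind p L < cy (1 ℕ.+ length M) * ind p M ⊎
        cy (length M) * ind p L ≤ cy (1 ℕ.+ length M) * ind p M × DShape L v

    bound-≤ : ind p L ≤ cy (length L)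
    bound-≤ with bound
    ... | inj₁ lt       = <⇒≤ lt
    ... | inj₂ (le , _) = le

    ratio-≤′ : ∀ {v M} → L ↭ v ∷ M → cy (length M) * ind p L ≤ cy (1 ℕ.+ length M) * ind p M
    ratio-≤′ σ with ratio σ
    ... | inj₁ lt       = <⇒≤ lt
    ... | inj₂ (le , _) = le

    left : ∀ {v M q} → L ↭ v ∷ M → length M ≡ suc q →
      p * cy q * ind p M ≤ cy (suc q) * (ind p M - ind p (v ∷ M))
    left {v} {M} {q} σ |M| = ratio-left 0<p (cy q) (cy (suc q)) (ind p (v ∷ M)) (ind p M)
      (subst₂ (λ k t → cy k * t ≤ cy (suc k) * ind p M) |M| (ind-↭ p σ) (ratio-≤′ σ))

  private
    finish-≤ : ∀ {L M Y F Z H} q → length M ≡ suc q →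
      ind p L ≡ Y * F - Z * H → ind p M ≡ Y * F →
      p * cy q * (Y * F) ≤ cy (suc q) * (Z * H) →
      cy (length M) * ind p L ≤ cy (1 ℕ.+ length M) * ind p M
    finish-≤ {L} {M} {Y} {F} {Z} {H} q |M| eqL eqM h rewrite |M| | eqL | eqM =
      ratio-≤ 0<p (cy q) (cy (suc q)) (Y * F) (Z * H) h

    finish-< : ∀ {L M Y F Z H} q → length M ≡ suc q →
      ind p L ≡ Y * F - Z * H → ind p M ≡ Y * F →
      p * cy q * (Y * F) < cy (suc q) * (Z * H) →
      cy (length M) * ind p L < cy (1 ℕ.+ length M) * ind p M
    finish-< {L} {M} {Y} {F} {Z} {H} q |M| eqL eqM h rewrite |M| | eqL | eqM =
      ratio-< 0<p (cy q) (cy (suc q)) (Y * F) (Z * H) h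

  module _ {m : ℕ} (IH : ∀ {K} → length K ℕ.≤ m → Uni K → Pos p K → UniBounds K)
    {L v M} (≤m : length L ℕ.≤ suc m) (pos : Pos p L)
    (cpos : ∀ j → j ℕ.≤ length L → 0ℚ < cy j) (σ : L ↭ v ∷ M) where

    private
      Goal = cy (length M) * ind p L < cy (1 ℕ.+ length M) * ind p M ⊎
             cy (length M) * ind p L ≤ cy (1 ℕ.+ length M) * ind p M × DShape L v

      module Parts {R K} (perm : L ↭ v ∷ R ++ K) (cross : NoCross R K) where
        r = length R
        k = length K
        Y = ind p R
        F = ind p K
        Z = Y - ind p (v ∷ R)
        M↭ : M ↭ R ++ K
        M↭ = drop-∷ (↭-trans (↭-sym σ) perm)
        |M| : length M ≡ r ℕ.+ k
        |M| = trans (↭-length M↭) (length-++ R)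
        |L| : length L ≡ suc (r ℕ.+ k)
        |L| = trans (↭-length σ) (cong suc |M|)
        ind-M : ind p M ≡ Y * F
        ind-M = trans (ind-↭ p M↭) (ind-++ p R K cross)
        r+k≤m : r ℕ.+ k ℕ.≤ m
        r+k≤m = sizes R perm ≤m
        cy-pos : ∀ {q} → length M ≡ 2 ℕ.+ q → ∀ i → i ℕ.≤ 3 → 0ℚ < cy (i ℕ.+ q)
        cy-pos {q} eq i i≤ = cpos (i ℕ.+ q) (subst (i ℕ.+ q ℕ.≤_) (sym (trans (↭-length σ) (cong suc eq)))
          (ℕ.+-monoˡ-≤ q i≤))
        cpos′ : ∀ j → j ℕ.≤ suc (r ℕ.+ k) → 0ℚ < cy j
        cpos′ j j≤ = cpos j (subst (j ℕ.≤_) (sym |L|) j≤)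
        pos-vR : Pos p (v ∷ R)
        pos-vR = pos-++ˡ (pos-↭ perm pos)
        pos-K : Pos p K
        pos-K = pos-++ʳ (v ∷ R) (pos-↭ perm pos)
        0<Y : 0ℚ < Y
        0<Y = pos-self (pos-tail pos-vR)
        0<F : 0ℚ < F
        0<F = pos-self pos-K

      -- The remainder in `Join` has the factor `pa r`, which is zero for empty `R` and positive
      -- otherwise. So equality survives only if `v` is a leaf, and then it is inherited from the
      -- quotient of `K` at `b`: the path of a Dₘ grows by one vertex.
      split-right : Split Tree Uni L v → Goal
      split-right s with uni-length (Split.right s)
      ... | j , |K|≡ = go R refl
        where
        open Split s hiding (left)
        open Parts perm cross
        b′ = suc j
        H = ind p (LeafAt.others bridge)
        |others| : length (LeafAt.others bridge) ≡ 1 ℕ.+ b′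
        |others| = ℕ.suc-injective (trans (sym (↭-length (LeafAt.perm bridge))) |K|≡)
        module TR = TreeBounds (tree-bounds (length (v ∷ R)) ℕ.≤-refl (Split.left s) pos-vR)
        module UK = UniBounds (IH (ℕ.≤-trans (ℕ.m≤n+m k r) r+k≤m) right pos-K)
        |M|′ : length M ≡ 2 ℕ.+ (r ℕ.+ b′)
        |M|′ = trans |M| (trans (cong (r ℕ.+_) |K|≡)
          (trans (ℕ.+-suc r (suc b′)) (cong suc (ℕ.+-suc r b′))))
        kpos : ∀ i → i ℕ.≤ 2 → 0ℚ < cy (i ℕ.+ b′)
        kpos i i≤ = UK.pos _ (subst (i ℕ.+ b′ ℕ.≤_) (sym |K|≡) (ℕ.+-monoˡ-≤ b′ i≤))
        module J = Join 0<p {A₁ = pa (1 ℕ.+ r)} {A₂ = pa (2 ℕ.+ r)} {s₁ = cy (1 ℕ.+ b′)} {s₂ = cy (2 ℕ.+ b′)}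
          {S₁ = cy (1 ℕ.+ (r ℕ.+ b′))} {S₂ = cy (2 ℕ.+ (r ℕ.+ b′))}
          {K = pa r * cy b′ * cy (3 ℕ.+ (r ℕ.+ b′))} {Y = Y} {Z = Z} {F = F} {G = H}
          (TR.pos₁ r (ℕ.n≤1+n r)) (TR.pos r (ℕ.n≤1+n r))
          (kpos 1 (s≤s z≤n)) (kpos 2 ℕ.≤-refl) (cy-pos |M|′ 2 (s≤s (s≤s z≤n))) 0<Y 0<F
          (product-identity cy cy-rec r b′) (TR.left ↭-refl)
        join-eq = ind-join perm cross (leaf-away bridge)
        0≤K : 0ℚ ≤ pa r * cy b′ * cy (3 ℕ.+ (r ℕ.+ b′))
        0≤K = 0≤* (0≤* (TR.nonneg r (ℕ.n≤1+n r)) (<⇒≤ (kpos 0 z≤n))) (<⇒≤ (cy-pos |M|′ 3 ℕ.≤-refl))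
        right-≤ : cy (1 ℕ.+ b′) * F ≤ cy (2 ℕ.+ b′) * H
        right-≤ = subst (λ q → cy q * F ≤ cy (suc q) * H) |others| (UK.ratio-≤′ (LeafAt.perm bridge))
        go : ∀ R′ → R ≡ R′ → Goal
        go (x ∷ R′) refl = inj₁ (finish-< {L} {M} {Y} {F} {Z} {H} (1 ℕ.+ (r ℕ.+ b′)) |M|′ join-eq ind-M
          (J.join-<ᴷ (0<* (0<* (TR.pos₁ (length R′) (ℕ.m≤n+m (length R′) 2)) (kpos 0 z≤n)) (cy-pos |M|′ 3 ℕ.≤-refl)) right-≤))
        go [] refl with UK.ratio (LeafAt.perm bridge)
        ... | inj₁ lt = inj₁ (finish-< {L} {M} {Y} {F} {Z} {H} (1 ℕ.+ (r ℕ.+ b′)) |M|′ join-eq ind-M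
          (J.join-<ᴿ 0≤K (subst (λ q → cy q * F < cy (suc q) * H) |others| lt)))
        ... | inj₂ (_ , d) = inj₂
          ( finish-≤ {L} {M} {Y} {F} {Z} {H} (1 ℕ.+ (r ℕ.+ b′)) |M|′ join-eq ind-M (J.join-≤ 0≤K right-≤)
          , dshape-leaf perm bridge d )

      -- The cycle is on the side of `v`, so `pa` and `cy` exchange their roles in
      -- `product-identity`. The branch `K` is nonempty, which makes `pa k` and the remainder
      -- positive: this case is always strict.
      split-left : Split Uni Tree L v → Goal
      split-left s with uni-length (Split.left s) | nonempty (leaf-∈ (Split.bridge s))
      ... | j , |vR| | k₀ , |K|≡ = inj₁ (finish-< {L} {M} {Y} {F} {Z} {H} (1 ℕ.+ (k ℕ.+ r′)) |M|′ join-eq ind-M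
          (J.join-<ᴷ (0<* (0<* pa-k (cpos′ r′ r′≤)) (cy-pos |M|′ 3 ℕ.≤-refl)) right-≤))
        where
        open Split s hiding (left)
        open Parts perm cross
        r′ = j
        |R| : r ≡ 2 ℕ.+ r′
        |R| = ℕ.suc-injective |vR|
        H = ind p (LeafAt.others bridge)
        module TK = TreeBounds (tree-bounds k ℕ.≤-refl right pos-K)
        suc-r≤m : suc r ℕ.≤ m
        suc-r≤m = ℕ.≤-trans (ℕ.≤-trans (ℕ.m≤m+n (suc r) k₀)
          (ℕ.≤-reflexive (trans (sym (ℕ.+-suc r k₀)) (cong (r ℕ.+_) (sym |K|≡))))) r+k≤m
        module UR = UniBounds (IH suc-r≤m (Split.left s) pos-vR)
        |M|′ : length M ≡ 2 ℕ.+ (k ℕ.+ r′)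
        |M|′ = trans |M| (trans (ℕ.+-comm r k) (trans (cong (k ℕ.+_) |R|)
          (trans (ℕ.+-suc k (suc r′)) (cong suc (ℕ.+-suc k r′)))))
        rpos : ∀ i → i ℕ.≤ 2 → 0ℚ < cy (i ℕ.+ r′)
        rpos i i≤ = UR.pos _ (ℕ.≤-trans (ℕ.≤-trans (ℕ.+-monoˡ-≤ r′ i≤) (ℕ.≤-reflexive (sym |R|))) (ℕ.n≤1+n r))
        r′≤ : r′ ℕ.≤ suc (r ℕ.+ k)
        r′≤ = ℕ.≤-trans (ℕ.≤-trans (ℕ.m≤n+m r′ 2) (ℕ.≤-reflexive (sym |R|)))
          (ℕ.≤-trans (ℕ.m≤m+n r k) (ℕ.n≤1+n _))
        pa-k : 0ℚ < pa k
        pa-k = subst (λ q → 0ℚ < pa q) (sym |K|≡)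
          (TK.pos₁ k₀ (subst (k₀ ℕ.≤_) (sym |K|≡) (ℕ.n≤1+n k₀)))
        join-eq = ind-join perm cross (leaf-away bridge)
        right-≤ : pa (1 ℕ.+ k) * F ≤ pa (2 ℕ.+ k) * H
        right-≤ = subst (λ q → pa (1 ℕ.+ q) * F ≤ pa (2 ℕ.+ q) * H)
          (sym (↭-length (LeafAt.perm bridge))) (TK.ratio (LeafAt.perm bridge))
        module J = Join 0<p {A₁ = cy (1 ℕ.+ r′)} {A₂ = cy (2 ℕ.+ r′)} {s₁ = pa (1 ℕ.+ k)} {s₂ = pa (2 ℕ.+ k)}
          {S₁ = cy (1 ℕ.+ (k ℕ.+ r′))} {S₂ = cy (2 ℕ.+ (k ℕ.+ r′))}
          {K = pa k * cy r′ * cy (3 ℕ.+ (k ℕ.+ r′))} {Y = Y} {Z = Z} {F = F} {G = H}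
          (rpos 1 (s≤s z≤n)) (rpos 2 ℕ.≤-refl) (TK.pos₁ k ℕ.≤-refl) (TK.pos k ℕ.≤-refl)
          (cy-pos |M|′ 2 (s≤s (s≤s z≤n))) 0<Y 0<F
          (trans (cong (_* cy (2 ℕ.+ (k ℕ.+ r′))) (ℚ.*-comm (cy (1 ℕ.+ r′)) (pa (1 ℕ.+ k))))
            (trans (product-identity cy cy-rec k r′)
              (cong (λ x → x * cy (1 ℕ.+ (k ℕ.+ r′)) + p * (pa k * cy r′ * cy (3 ℕ.+ (k ℕ.+ r′))))
                (ℚ.*-comm (pa (2 ℕ.+ k)) (cy (2 ℕ.+ r′))))))
          (UR.left ↭-refl |R|)

      -- `R` nonempty makes the remainder of `Join` positive, and `T₀` nonempty makes `tree-ends`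
      -- strict. If both are empty, `L` is a triangle, the smallest Dₘ.
      split-cycle : CycleSplit L v → Goal
      split-cycle s = go R refl T₀ refl
        where
        open CycleSplit s hiding (left)
        open Parts perm cross
        t = length T₀
        H = ind p T₀
        |T| : k ≡ 2 ℕ.+ t
        |T| = ↭-length ends
        module TR = TreeBounds (tree-bounds (length (v ∷ R)) ℕ.≤-refl (CycleSplit.left s) pos-vR)
        |M|′ : length M ≡ 2 ℕ.+ (r ℕ.+ t)
        |M|′ = trans |M| (trans (cong (r ℕ.+_) |T|)
          (trans (ℕ.+-suc r (suc t)) (cong suc (ℕ.+-suc r t))))
        tpos : ∀ i → i ℕ.≤ 3 ℕ.+ t → 0ℚ < cy i
        tpos i i≤ = cpos i (ℕ.≤-trans i≤ (subst (3 ℕ.+ t ℕ.≤_) (sym (trans (↭-length σ) (cong suc |M|′)))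
          (ℕ.+-monoʳ-≤ 3 (ℕ.m≤n+m t r))))
        ends-ratio = tree-ends right pos-K ends tpos
        module J = Join 0<p {A₁ = pa (1 ℕ.+ r)} {A₂ = pa (2 ℕ.+ r)} {s₁ = cy (1 ℕ.+ t)} {s₂ = cy (2 ℕ.+ t)}
          {S₁ = cy (1 ℕ.+ (r ℕ.+ t))} {S₂ = cy (2 ℕ.+ (r ℕ.+ t))}
          {K = pa r * cy t * cy (3 ℕ.+ (r ℕ.+ t))} {Y = Y} {Z = Z} {F = F} {G = H}
          (TR.pos₁ r (ℕ.n≤1+n r)) (TR.pos r (ℕ.n≤1+n r))
          (tpos (1 ℕ.+ t) (ℕ.m≤n+m _ 2)) (tpos (2 ℕ.+ t) (ℕ.m≤n+m _ 1)) (cy-pos |M|′ 2 (s≤s (s≤s z≤n))) 0<Y 0<F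
          (product-identity cy cy-rec r t) (TR.left ↭-refl)
        away-T : away v T ↭ T₀
        away-T = ↭-trans (away-↭ v ends)
          (↭-reflexive (trans (away-adj (w₂ ∷ T₀) v~w₁) (trans (away-adj T₀ v~w₂) (away-none isolated))))
        join-eq = ind-join perm cross away-T
        0≤K : 0ℚ ≤ pa r * cy t * cy (3 ℕ.+ (r ℕ.+ t))
        0≤K = 0≤* (0≤* (TR.nonneg r (ℕ.n≤1+n r)) (<⇒≤ (tpos t (ℕ.m≤n+m t 3)))) (<⇒≤ (cy-pos |M|′ 3 ℕ.≤-refl))
        go : ∀ R′ → R ≡ R′ → ∀ T′ → T₀ ≡ T′ → Goal
        go (x ∷ R′) refl _ _ = inj₁ (finish-< {L} {M} {Y} {F} {Z} {H} (1 ℕ.+ (r ℕ.+ t)) |M|′ join-eq ind-M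
          (J.join-<ᴷ (0<* (0<* (TR.pos₁ (length R′) (ℕ.m≤n+m (length R′) 2)) (tpos t (ℕ.m≤n+m t 3))) (cy-pos |M|′ 3 ℕ.≤-refl))
            (proj₁ ends-ratio)))
        go [] refl (_ ∷ _) refl = inj₁ (finish-< {L} {M} {Y} {F} {Z} {H} (1 ℕ.+ (r ℕ.+ t)) |M|′ join-eq ind-M
          (J.join-<ᴿ 0≤K (proj₂ ends-ratio (s≤s z≤n))))
        go [] refl [] refl = inj₂
          ( finish-≤ {L} {M} {Y} {F} {Z} {H} (1 ℕ.+ (r ℕ.+ t)) |M|′ join-eq ind-M (J.join-≤ 0≤K (proj₁ ends-ratio))
          , w₁ ∷ w₂ ∷ [] , ↭-trans perm (prep v ends) , triangle v~w₁ v~w₂ (tree-edge right ends) )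

    uni-ratio : UniSplit L v → Goal
    uni-ratio (cycle-right s) = split-right s
    uni-ratio (cycle-left s)  = split-left s
    uni-ratio (on-cycle s)    = split-cycle s

  ind-single : ∀ v → ind p [ v ] ≡ 1ℚ - p * 1ℚ
  ind-single v = trans (ind-∷ p v []) (cong (λ t → t - p * t) (ind-[] p))

  module _ {j c} (cyc : CyclicOrder j c) where

    ind-arc : ∀ i m → m ℕ.≤ 2 ℕ.+ j → ind p (arc c i m) ≡ pa (2 ℕ.+ m)
    ind-arc i zero          _         = trans (ind-[] p) (sym pa-2)
    ind-arc i (suc zero)    _         = trans (ind-single (c i))
      (cong (λ t → t - p * 1ℚ) (sym pa-2))
    ind-arc i (suc (suc m)) (s≤s (s≤s m≤j)) = trans (ind-leaf (arc-leaf cyc i m m≤j))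
      (cong₂ (λ a b → a - p * b) (ind-arc (suc i) (suc m) (s≤s (ℕ.m≤n⇒m≤1+n m≤j)))
        (ind-arc (2 ℕ.+ i) m (ℕ.≤-trans m≤j (ℕ.m≤n+m j 2))))

    ind-cycle : ∀ {L} → L ↭ arc c 0 (3 ℕ.+ j) → ind p L ≡ cy (3 ℕ.+ j)
    ind-cycle σ = trans (ind-↭ p σ) (trans (ind-∷ p (c 0) (arc c 1 (2 ℕ.+ j)))
      (trans (cong₂ (λ a b → a - p * b) (ind-arc 1 (2 ℕ.+ j) ℕ.≤-refl)
               (trans (ind-↭ p away-0) (ind-arc 2 j (ℕ.m≤n+m j 2))))
        (sym (cy-cycle (suc j)))))
      where
      away-0 : away (c 0) (arc c 1 (2 ℕ.+ j)) ↭ arc c 2 j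
      away-0 = ↭-trans (away-↭ (c 0) (arc-ends cyc 0))
        (↭-reflexive (trans (away-adj _ (CyclicOrder.next cyc 0))
          (trans (away-adj _ (CyclicOrder.last cyc 0)) (away-none (arc-chord cyc 0 j ℕ.≤-refl)))))

  private
    -- Shorter cycles are not induced subgraphs of a cycle, but shorter paths are. Positivity of
    -- `cy` therefore descends from the full cycle by `cy-pos-back`, with path values as
    -- coefficients.
    cy-pos-below : ∀ m → (∀ j → j ℕ.≤ m → 0ℚ < pa (1 ℕ.+ j)) → 0ℚ < cy (suc m) →
      ∀ j → j ℕ.≤ suc m → 0ℚ < cy j
    cy-pos-below zero    ppos 0<c = below-suc {P = λ j → 0ℚ < cy j}
      (λ { zero _ → ℚ.positive⁻¹ (1ℚ + 1ℚ) }) 0<c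
    cy-pos-below (suc m) ppos 0<c = below-suc {P = λ j → 0ℚ < cy j}
      (cy-pos-below m (λ j j≤ → ppos j (ℕ.m≤n⇒m≤1+n j≤))
        (cy-pos-back 0<p (suc m) (ppos (suc m) ℕ.≤-refl) (<⇒≤ (ppos m (ℕ.n≤1+n m))) 0<c)) 0<c

  uni-bounds : ∀ m {L} → length L ℕ.≤ m → Uni L → Pos p L → UniBounds L
  uni-bounds zero {L} ≤0 uni pos with uni-length uni
  ... | j , eq with () ← subst (ℕ._≤ 0) eq ≤0
  uni-bounds (suc m) {L} ≤m uni@(cycle {j = j} {c} cyc σ) pos = record
    { pos   = cpos
    ; bound = inj₂ (≤-reflexive (trans (ind-cycle cyc σ) (cong cy (sym |L|))) , inj₁ (j , c , cyc , σ))
    ; ratio = λ τ → uni-ratio (uni-bounds m) ≤m pos cpos τ (uni-split uni τ)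
    }
    where
    |L| : length L ≡ 3 ℕ.+ j
    |L| = trans (↭-length σ) (arc-length c 0 (3 ℕ.+ j))
    ppos : ∀ i → i ℕ.≤ 2 ℕ.+ j → 0ℚ < pa (1 ℕ.+ i)
    ppos zero    _  = 0<1
    ppos (suc i) i≤ = subst (0ℚ <_) (ind-arc cyc 0 i (ℕ.≤-trans (ℕ.n≤1+n i) i≤))
      (pos-self (pos-sub (↭-reflexive (arc-split 0 i (3 ℕ.+ j) (ℕ.≤-trans (ℕ.n≤1+n i) (ℕ.m≤n⇒m≤1+n i≤))))
        (pos-↭ σ pos)))
      where
      arc-split : ∀ i a b → a ℕ.≤ b → arc c i b ≡ arc c i a ++ arc c (a ℕ.+ i) (b ℕ.∸ a)
      arc-split i zero    b       _         = refl
      arc-split i (suc a) (suc b) (s≤s a≤b) = cong (c i ∷_) (trans (arc-split (suc i) a b a≤b)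
        (cong (λ k → arc c (suc i) a ++ arc c k (b ℕ.∸ a)) (ℕ.+-suc a i)))
    cpos : ∀ i → i ℕ.≤ length L → 0ℚ < cy i
    cpos = subst (λ k → ∀ i → i ℕ.≤ k → 0ℚ < cy i) (sym |L|)
      (cy-pos-below (2 ℕ.+ j) ppos (subst (0ℚ <_) (ind-cycle cyc σ) (pos-self pos)))
  uni-bounds (suc m) {L} ≤m uni@(leaf {L = L₁} {z = z} {u} t l σ) pos = record
    { pos   = cpos
    ; bound = bound′ (IH.ratio (LeafAt.perm l))
    ; ratio = λ τ → uni-ratio (uni-bounds m) ≤m pos cpos τ (uni-split uni τ)
    }
    where
    X = LeafAt.others l
    |L₁| : length L₁ ≡ suc (length X)
    |L₁| = ↭-length (LeafAt.perm l)
    |L| : length L ≡ 2 ℕ.+ length X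
    |L| = trans (↭-length σ) (cong suc |L₁|)
    pos₁ : Pos p L₁
    pos₁ = pos-tail (pos-↭ σ pos)
    module IH = UniBounds (uni-bounds m (ℕ.≤-pred (subst (ℕ._≤ suc m) (↭-length σ) ≤m)) t pos₁)
    ind-L : ind p L ≡ ind p L₁ - p * ind p X
    ind-L = trans (ind-↭ p σ) (ind-leaf l)
    module E = Extend 0<p {A₀ = cy (length X)} {A₁ = cy (1 ℕ.+ length X)}
      (subst (λ k → 0ℚ < cy k) |L₁| (IH.pos (length L₁) ℕ.≤-refl))
      (pos-self pos₁)
      (subst (λ k → ind p L₁ ≤ cy k) |L₁| IH.bound-≤)
      (IH.ratio-≤′ (LeafAt.perm l))
      (subst (0ℚ <_) ind-L (pos-self pos))
    cpos : ∀ i → i ℕ.≤ length L → 0ℚ < cy i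
    cpos = subst (λ k → ∀ i → i ℕ.≤ k → 0ℚ < cy i) (sym |L|)
      (below-suc {P = λ j → 0ℚ < cy j}
        (λ i i≤ → IH.pos i (subst (i ℕ.≤_) (sym |L₁|) i≤)) E.extend-pos)
    bound′ : cy (length X) * ind p L₁ < cy (1 ℕ.+ length X) * ind p X ⊎
             cy (length X) * ind p L₁ ≤ cy (1 ℕ.+ length X) * ind p X × DShape L₁ u →
      ind p L < cy (length L) ⊎ ind p L ≤ cy (length L) × Extremal L
    bound′ (inj₁ lt) = inj₁ (subst₂ (λ a k → a < cy k) (sym ind-L) (sym |L|) (E.extend-< lt))
    bound′ (inj₂ (_ , d)) = inj₂
      ( subst₂ (λ a k → a ≤ cy k) (sym ind-L) (sym |L|) E.extend-≤
      , inj₂ (z , dshape-leaf σ l d) )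

-- Positivity of induced subgraphs

times : ℕ → ℚ → ℚ
times zero    x = 0ℚ
times (suc n) x = x + times n x

times-nonneg : ∀ n {x} → 0ℚ ≤ x → 0ℚ ≤ times n x
times-nonneg zero    0≤x = ≤-refl
times-nonneg (suc n) 0≤x = 0≤+ 0≤x (times-nonneg n 0≤x)

times-mono : ∀ {m n x} → 0ℚ ≤ x → m ℕ.≤ n → times m x ≤ times n x
times-mono {n = n} 0≤x z≤n       = times-nonneg n 0≤x
times-mono {x = x} 0≤x (s≤s m≤n) = ℚ.+-monoʳ-≤ x (times-mono 0≤x m≤n)

times-* : ∀ n x y → times n x * y ≡ times n (x * y)
times-* zero    x y = ℚ.*-zeroˡ y
times-* (suc n) x y = trans (ℚ.*-distribʳ-+ y x (times n x)) (cong (x * y +_) (times-* n x y))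

-- The denominator is at least 1, so the absolute value of the numerator is large enough.
archimedean : ∀ r → ∃ λ n → r ≤ times n 1ℚ
archimedean r@(mkℚ num d _) = ℤ.∣ num ∣ ,
  ℚ.toℚᵘ-cancel-≤ (ℚᵘ.≤-trans r≤ (ℚᵘ.≤-reflexive (ℚᵘ.≃-sym (embed ℤ.∣ num ∣))))
  where
  embed : ∀ n → toℚᵘ (times n 1ℚ) ℚᵘ.≃ ℚᵘ.mkℚᵘ (ℤ.+ n) 0
  embed zero    = ℚᵘ.≃-refl
  embed (suc n) = ℚᵘ.≃-trans (ℚ.toℚᵘ-homo-+ 1ℚ (times n 1ℚ))
    (ℚᵘ.≃-trans (ℚᵘ.+-congʳ (toℚᵘ 1ℚ) (embed n))
      (ℚᵘ.*≡* (cong (ℤ._* ℤ.+ 1) (trans (cong (λ i → (ℤ.+ 1) ℤ.+ i) (ℤ.*-identityʳ (ℤ.+ n))) refl))))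
  r≤ : toℚᵘ r ℚᵘ.≤ ℚᵘ.mkℚᵘ (ℤ.+ ℤ.∣ num ∣) 0
  r≤ = ℚᵘ.*≤* (ℤ.≤-trans (ℤ.≤-reflexive (ℤ.*-identityʳ num))
    (ℤ.≤-trans (i≤∣i∣ num)
      (ℤ.≤-trans (ℤ.≤-reflexive (sym (ℤ.*-identityʳ (ℤ.+ ℤ.∣ num ∣))))
        (ℤ.*-monoˡ-≤-nonNeg (ℤ.+ ℤ.∣ num ∣) (ℤ.+≤+ (s≤s z≤n))))))
    where
    i≤∣i∣ : ∀ i → i ℤ.≤ ℤ.+ ℤ.∣ i ∣
    i≤∣i∣ (ℤ.+ n)      = ℤ.≤-refl
    i≤∣i∣ (ℤ.-[1+ n ]) = ℤ.-≤+

halves : ℚ → ℕ → ℚ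
halves w zero    = w
halves w (suc k) = halves w k * ½

halves-pos : ∀ {w} k → 0ℚ < w → 0ℚ < halves w k
halves-pos zero    0<w = 0<w
halves-pos (suc k) 0<w = 0<* (halves-pos k 0<w) (ℚ.positive⁻¹ ½)

halves-scale : ∀ c w k → c * halves w k ≡ halves (c * w) k
halves-scale c w zero    = refl
halves-scale c w (suc k) = trans (sym (ℚ.*-assoc c (halves w k) ½)) (cong (_* ½) (halves-scale c w k))

-- Amounts to k + 1 ≤ 2ᵏ, the form in which `archimedean` makes the halves small.
halves-times : ∀ {w} k → 0ℚ < w → halves w k * times (suc k) 1ℚ ≤ w
halves-times {w} zero    0<w = ≤-reflexive (ℚ.*-identityʳ w)
halves-times {w} (suc k) 0<w = ≤-trans
  (≤-by (0≤* (<⇒≤ (0<* (halves-pos k 0<w) (ℚ.positive⁻¹ ½))) (times-nonneg k (<⇒≤ 0<1)))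
    (solve 2 (λ h t → h :* (con 1ℚ :+ t) :- h :* con ½ :* (con 1ℚ :+ (con 1ℚ :+ t)) := h :* con ½ :* t)
      refl (halves w k) (times k 1ℚ)))
  (halves-times k 0<w)

abstract
  halves-small : ∀ {w ε} → 0ℚ < w → 0ℚ < ε → ∃ λ k → halves w k ≤ ε
  halves-small {w} {ε} 0<w 0<ε = conclude (archimedean (w * ε⁻¹))
    where
    instance
      ε-positive : ℚ.Positive ε
      ε-positive = ℚ.positive 0<ε
      ε-nonZero : ℚ.NonZero ε
      ε-nonZero = ℚ.pos⇒nonZero ε
    ε⁻¹ : ℚ
    ε⁻¹ = 1/ ε
    conclude : (∃ λ n → w * ε⁻¹ ≤ times n 1ℚ) → ∃ λ k → halves w k ≤ ε
    conclude (n , w/ε≤n) = n , cancel-≤ 0<t (≤-trans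
        (≤-trans (≤-reflexive (ℚ.*-comm (times (suc n) 1ℚ) (halves w n))) (halves-times n 0<w))
        (≤-trans w≤ (≤-by (<⇒≤ 0<ε)
          (solve 2 (λ t e → (con 1ℚ :+ t) :* e :- t :* e := e) refl (times n 1ℚ) ε))))
      where
      0<t : 0ℚ < times (suc n) 1ℚ
      0<t = 0<+ 0<1 (times-nonneg n (<⇒≤ 0<1))
      w≤ : w ≤ times n 1ℚ * ε
      w≤ = subst (_≤ times n 1ℚ * ε)
        (trans (ℚ.*-assoc w ε⁻¹ ε) (trans (cong (w *_) (ℚ.*-inverseˡ ε)) (ℚ.*-identityʳ w)))
        (ℚ.*-monoʳ-≤-nonNeg ε {{ℚ.pos⇒nonNeg ε}} w/ε≤n)

∣∣-≤ : ∀ {a b} → a ≤ b → - a ≤ b → ∣ a ∣ ≤ b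
∣∣-≤ {a} {b} a≤b -a≤b with ℚ.∣p∣≡p∨∣p∣≡-p a
... | inj₁ eq = subst (_≤ b) (sym eq) a≤b
... | inj₂ eq = subst (_≤ b) (sym eq) -a≤b

≤∣∣ : ∀ a → a ≤ ∣ a ∣
≤∣∣ a with ℚ.≤-total 0ℚ a
... | inj₁ 0≤a = ≤-reflexive (sym (ℚ.0≤p⇒∣p∣≡p 0≤a))
... | inj₂ a≤0 = ≤-trans a≤0 (ℚ.0≤∣p∣ a)

-≤∣∣ : ∀ a → - a ≤ ∣ a ∣
-≤∣∣ a = subst (- a ≤_) (ℚ.∣-p∣≡∣p∣ a) (≤∣∣ (- a))

module Continuity {n : ℕ} (G : Graph n) where
  open Independence G

  -- A common bound for the values and for the Lipschitz constants on [−K, K].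
  modulus : ℚ → ℕ → ℚ
  modulus K m = (1ℚ + 1ℚ + K) ^ m

  module _ {K : ℚ} (0≤K : 0ℚ ≤ K) where

    private
      0<c : 0ℚ < 1ℚ + 1ℚ + K
      0<c = 0<+ (ℚ.positive⁻¹ (1ℚ + 1ℚ)) 0≤K

    modulus-pos : ∀ m → 0ℚ < modulus K m
    modulus-pos m = ^-pos m 0<c

    modulus-≥1 : ∀ m → 1ℚ ≤ modulus K m
    modulus-≥1 zero    = ≤-refl
    modulus-≥1 (suc m) = ≤-trans (modulus-≥1 m)
      (≤-by (0≤* (0≤+ (<⇒≤ 0<1) 0≤K) (<⇒≤ (modulus-pos m)))
        (solve 2 (λ k e → (con 1ℚ :+ con 1ℚ :+ k) :* e :- e := (con 1ℚ :+ k) :* e) refl K (modulus K m)))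

    ind-bounded : ∀ {x} → ∣ x ∣ ≤ K → ∀ m L → length L ℕ.≤ m → ∣ ind x L ∣ ≤ modulus K m
    ind-bounded {x} x≤K m [] _ = subst (λ t → ∣ t ∣ ≤ modulus K m) (sym (ind-[] x)) (modulus-≥1 m)
    ind-bounded {x} x≤K (suc m) (v ∷ L) (s≤s ≤m) = ≤-trans
      (≤-trans (≤-reflexive (cong ∣_∣ (ind-∷ x v L))) (triangle (ind x L) (x * ind x (away v L))))
      (≤-trans
        (ℚ.+-mono-≤ (ind-bounded x≤K m L ≤m)
          (≤-trans (≤-reflexive (ℚ.∣p*q∣≡∣p∣*∣q∣ x (ind x (away v L))))
            (*-mono-≤ (ℚ.0≤∣p∣ x) x≤K (ℚ.0≤∣p∣ (ind x (away v L)))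
              (ind-bounded x≤K m (away v L) (ℕ.≤-trans (away-length v L) ≤m)))))
        (≤-by (<⇒≤ (modulus-pos m))
          (solve 2 (λ k e → (con 1ℚ :+ con 1ℚ :+ k) :* e :- (e :+ k :* e) := e) refl K (modulus K m))))
      where
      triangle : ∀ a b → ∣ a - b ∣ ≤ ∣ a ∣ + ∣ b ∣
      triangle = ℚ.∣p-q∣≤∣p∣+∣q∣

    -- The difference has three parts: the change on `L`, the change on `away v L` times `x`, and
    -- `x - y` times a value. They use up the summands 1, `K` and 1 of the base of `modulus`.
    ind-lipschitz : ∀ {x y} → ∣ x ∣ ≤ K → ∣ y ∣ ≤ K → ∀ m L → length L ℕ.≤ m →
      ∣ ind x L - ind y L ∣ ≤ modulus K m * ∣ x - y ∣
    ind-lipschitz {x} {y} x≤K y≤K m [] _ = subst (_≤ modulus K m * ∣ x - y ∣)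
      (sym (trans (cong₂ (λ a b → ∣ a - b ∣) (ind-[] x) (ind-[] y)) refl))
      (0≤* (<⇒≤ (modulus-pos m)) (ℚ.0≤∣p∣ (x - y)))
    ind-lipschitz {x} {y} x≤K y≤K (suc m) (v ∷ L) (s≤s ≤m) = ≤-trans
      (≤-reflexive (cong ∣_∣ (trans (cong₂ _-_ (ind-∷ x v L) (ind-∷ y v L))
        (solve 6 (λ x y a a′ b b′ → (a :- x :* b) :- (a′ :- y :* b′)
            := (a :- a′) :+ ((:- x) :* (b :- b′) :+ (:- (x :- y)) :* b′)) refl x y a a′ b b′))))
      (≤-trans (ℚ.∣p+q∣≤∣p∣+∣q∣ (a - a′) (- x * (b - b′) + - (x - y) * b′))
      (≤-trans (ℚ.+-monoʳ-≤ ∣ a - a′ ∣ (ℚ.∣p+q∣≤∣p∣+∣q∣ (- x * (b - b′)) (- (x - y) * b′)))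
      (≤-trans
        (ℚ.+-mono-≤ (ind-lipschitz x≤K y≤K m L ≤m)
          (ℚ.+-mono-≤
            (product x (b - b′) x≤K (ind-lipschitz x≤K y≤K m (away v L) ≤m′))
            (product (x - y) b′ ≤-refl (ind-bounded y≤K m (away v L) ≤m′))))
        (≤-reflexive
          (solve 3 (λ k e d → e :* d :+ (k :* (e :* d) :+ d :* e) := (con 1ℚ :+ con 1ℚ :+ k) :* e :* d)
            refl K (modulus K m) ∣ x - y ∣)))))
      where
      a  = ind x L
      a′ = ind y L
      b  = ind x (away v L)
      b′ = ind y (away v L)
      ≤m′ = ℕ.≤-trans (away-length v L) ≤m
      product : ∀ s t {A B} → ∣ s ∣ ≤ A → ∣ t ∣ ≤ B → ∣ - s * t ∣ ≤ A * B
      product s t s≤A t≤B = ≤-trans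
        (≤-reflexive (trans (ℚ.∣p*q∣≡∣p∣*∣q∣ (- s) t) (cong (_* ∣ t ∣) (ℚ.∣-p∣≡∣p∣ s))))
        (*-mono-≤ (ℚ.0≤∣p∣ s) s≤A (ℚ.0≤∣p∣ t) t≤B)

  Bad : ℚ → List V → Set
  Bad p L = ∃₂ λ H R → L ↭ H ++ R × ind p H ≤ 0ℚ

  -- The sublists that contain `v` are those of the tail, searched for `P ∘ (v ∷_)`. As the order of
  -- the rationals is decidable, this decides positivity of all induced subgraphs at a rational
  -- point, which is what bisection asks at every midpoint.
  all-sublists? : ∀ {P : List V → Set} → (∀ {H H′} → H ↭ H′ → P H → P H′) → (∀ H → Dec (P H)) →
    ∀ L → (∀ {H R} → L ↭ H ++ R → P H) ⊎ (∃₂ λ H R → L ↭ H ++ R × ¬ P H)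
  all-sublists? resp P? [] with P? []
  ... | no ¬p = inj₂ ([] , [] , ↭-refl , ¬p)
  ... | yes p = inj₁ λ {H} {R} σ → empty H R σ
    where
    empty : ∀ H R → [] ↭ H ++ R → _
    empty []      R σ = p
    empty (_ ∷ _) R σ with () ← ↭-length σ
  all-sublists? {P} resp P? (v ∷ L)
    with all-sublists? resp P? L
       | all-sublists? {P ∘ (v ∷_)} (resp ∘ prep v) (P? ∘ (v ∷_)) L
  ... | inj₂ (H , R , σ , ¬p) | _ = inj₂ (H , v ∷ R , ↭-trans (prep v σ) (↭-sym (shift v H R)) , ¬p)
  ... | inj₁ _ | inj₂ (H , R , σ , ¬p) = inj₂ (v ∷ H , R , prep v σ , ¬p)
  ... | inj₁ without | inj₁ with-v = inj₁ λ {H} {R} σ → go H R σ (∈-++⁻ H (∈-resp-↭ σ (here refl)))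
    where
    go : ∀ H R → v ∷ L ↭ H ++ R → v ∈ H ⊎ v ∈ R → P H
    go H R σ (inj₁ v∈H) with ++-∈⇒↭ˡ R ↭-refl σ v∈H
    ... | H₀ , ρ , τ = resp (↭-sym ρ) (with-v τ)
    go H R σ (inj₂ v∈R) with ++-∈⇒↭ˡ H ↭-refl (↭-trans σ (++-comm H R)) v∈R
    ... | R₀ , ρ , τ = without (↭-trans τ (++-comm R₀ H))

  pos-or-bad : ∀ p L → Pos p L ⊎ Bad p L
  pos-or-bad p L with all-sublists? {λ H → 0ℚ < ind p H} (λ σ → subst (0ℚ <_) (ind-↭ p σ))
                        (λ H → 0ℚ ℚ.<? ind p H) L
  ... | inj₁ pos             = inj₁ pos
  ... | inj₂ (H , R , σ , ≮) = inj₂ (H , R , σ , ℚ.≮⇒≥ ≮)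

  ind-0 : ∀ L → ind 0ℚ L ≡ 1ℚ
  ind-0 []      = ind-[] 0ℚ
  ind-0 (v ∷ L) = trans (ind-∷ 0ℚ v L) (trans (cong₂ _-_ (ind-0 L) (ℚ.*-zeroˡ (ind 0ℚ (away v L)))) refl)

  pos-0 : ∀ L → Pos 0ℚ L
  pos-0 L {H} _ = subst (0ℚ <_) (sym (ind-0 H)) 0<1

  -- If the sublist H of L has ind a H ≤ 0 while all sublists are positive at a nearby b,
  -- adding the remaining vertices one at a time cannot make ind a much larger than 0.
  growth-constant : ℚ → ℕ → ℚ
  growth-constant K m = times m (K * modulus K m)

  growth-nonneg : ∀ {K} m → 0ℚ ≤ K → 0ℚ ≤ growth-constant K m
  growth-nonneg m 0≤K = times-nonneg m (0≤* 0≤K (<⇒≤ (modulus-pos 0≤K m)))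

  bad-small : ∀ {K a b L} → 0ℚ ≤ K → 0ℚ ≤ a → ∣ a ∣ ≤ K → ∣ b ∣ ≤ K → Pos b L → Bad a L →
    ind a L ≤ growth-constant K (length L) * ∣ a - b ∣
  bad-small {K} {a} {b} {L} 0≤K 0≤a a≤K b≤K pos (H , R , σ , bad) = ≤-trans
    (≤-reflexive (ind-↭ a (↭-trans σ (++-comm H R))))
    (≤-trans (go R (pos-↭ (↭-trans σ (++-comm H R)) pos)
        (ℕ.≤-reflexive (sym (↭-length (↭-trans σ (++-comm H R))))))
      (≤-trans (times-mono 0≤e (ℕ.≤-trans (ℕ.m≤m+n (length R) (length H))
          (ℕ.≤-reflexive (trans (sym (length-++ R)) (trans (↭-length (++-comm R H)) (sym (↭-length σ)))))))
        (≤-reflexive (trans (cong (times (length L)) (sym (ℚ.*-assoc K M ∣ a - b ∣)))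
          (sym (times-* (length L) (K * M) ∣ a - b ∣))))))
    where
    M = modulus K (length L)
    e = K * (M * ∣ a - b ∣)
    0≤Mδ : 0ℚ ≤ M * ∣ a - b ∣
    0≤Mδ = 0≤* (<⇒≤ (modulus-pos 0≤K (length L))) (ℚ.0≤∣p∣ (a - b))
    0≤e : 0ℚ ≤ e
    0≤e = 0≤* 0≤K 0≤Mδ
    a≤K′ : a ≤ K
    a≤K′ = ≤-trans (≤∣∣ a) a≤K
    go : ∀ R → Pos b (R ++ H) → length (R ++ H) ℕ.≤ length L → ind a (R ++ H) ≤ times (length R) e
    go []      _   _  = bad
    go (x ∷ R) pos ≤L = ≤-trans (≤-reflexive (ind-∷ a x X))
      (≤-by (0≤+ (0≤- (go R (pos-tail pos) (ℕ.≤-trans (ℕ.n≤1+n _) ≤L)))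
              (0≤+ (0≤* 0≤a (0≤- near)) (0≤* (0≤- a≤K′) 0≤Mδ)))
        (solve 6 (λ k d t i a w → k :* d :+ t :- (i :- a :* w)
            := (t :- i) :+ (a :* (w :- (:- d)) :+ (k :- a) :* d)) refl
          K (M * ∣ a - b ∣) (times (length R) e) (ind a X) a (ind a (away x X))))
      where
      X = R ++ H
      -- The value at `b` is positive and the value at `a` is close to it. Hence adding `x` raises
      -- the value by at most `e`.
      near : - (M * ∣ a - b ∣) ≤ ind a (away x X)
      near = ≤-by (0≤+ (0≤- (≤-trans (-≤∣∣ (ind a (away x X) - ind b (away x X)))
                (ind-lipschitz 0≤K a≤K b≤K (length L) (away x X)
                  (ℕ.≤-trans (away-length x X) (ℕ.≤-trans (ℕ.n≤1+n _) ≤L)))))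
              (<⇒≤ (pos-self (pos-away x (pos-tail pos)))))
        (solve 3 (λ d u w → u :- (:- d) := (d :- (:- (u :- w))) :+ w) refl
          (M * ∣ a - b ∣) (ind a (away x X)) (ind b (away x X)))

  -- Neither property is assumed to be monotone in the point. Keeping one end of each kind is enough
  -- to make the value of `L` tend to 0.
  record Bracket (L : List V) (w : ℚ) : Set where
    field
      lo hi : ℚ
      good  : Pos lo L
      bad   : Bad hi L
      width : hi - lo ≡ w
      0≤lo  : 0ℚ ≤ lo

  open Bracket

  bisect : ∀ {L w} → 0ℚ < w → (B : Bracket L w) →
    Σ (Bracket L (w * ½)) λ B′ → lo B ≤ lo B′ × hi B′ ≤ hi B
  bisect {L} {w} 0<w B with pos-or-bad ((lo B + hi B) * ½) L
  ... | inj₁ good′ = record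
    { lo = (lo B + hi B) * ½ ; hi = hi B ; good = good′ ; bad = bad B
    ; width = trans (upper (lo B) (hi B)) (cong (_* ½) (width B))
    ; 0≤lo = ≤-trans (0≤lo B) lo≤
    } , lo≤ , ≤-refl
    where
    upper : ∀ l h → h - (l + h) * ½ ≡ (h - l) * ½
    upper = solve 2 (λ l h → h :- (l :+ h) :* con ½ := (h :- l) :* con ½) refl
    lo≤ : lo B ≤ (lo B + hi B) * ½
    lo≤ = ≤-by (<⇒≤ (0<* 0<w (ℚ.positive⁻¹ ½)))
      (trans (solve 2 (λ l h → (l :+ h) :* con ½ :- l := (h :- l) :* con ½) refl (lo B) (hi B))
        (cong (_* ½) (width B)))
  ... | inj₂ bad′ = record
    { lo = lo B ; hi = (lo B + hi B) * ½ ; good = good B ; bad = bad′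
    ; width = trans (lower (lo B) (hi B)) (cong (_* ½) (width B))
    ; 0≤lo = 0≤lo B
    } , ≤-refl , ≤-by (<⇒≤ (0<* 0<w (ℚ.positive⁻¹ ½)))
      (trans (solve 2 (λ l h → h :- (l :+ h) :* con ½ := (h :- l) :* con ½) refl (lo B) (hi B))
        (cong (_* ½) (width B)))
    where
    lower : ∀ l h → (l + h) * ½ - l ≡ (h - l) * ½
    lower = solve 2 (λ l h → (l :+ h) :* con ½ :- l := (h :- l) :* con ½) refl

  module Bisection {L p} (0<p : 0ℚ < p) (bad-p : Bad p L) where

    abstract
      bracket : ∀ k → Bracket L (halves p k)
      bracket zero = record
        { lo = 0ℚ ; hi = p ; good = pos-0 L ; bad = bad-p
        ; width = solve 1 (λ p → p :- con 0ℚ := p) refl p ; 0≤lo = ≤-refl }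
      bracket (suc k) = proj₁ (bisect (halves-pos k 0<p) (bracket k))

      bracket-0 : hi (bracket 0) ≡ p
      bracket-0 = refl

      lo-step : ∀ k → lo (bracket k) ≤ lo (bracket (suc k))
      lo-step k = proj₁ (proj₂ (bisect (halves-pos k 0<p) (bracket k)))

      hi-step : ∀ k → hi (bracket (suc k)) ≤ hi (bracket k)
      hi-step k = proj₂ (proj₂ (bisect (halves-pos k 0<p) (bracket k)))

    point : ℕ → ℚ
    point k = hi (bracket k)

    lo-mono : ∀ {j k} → j ℕ.≤′ k → lo (bracket j) ≤ lo (bracket k)
    lo-mono ℕ.≤′-refl                   = ≤-refl
    lo-mono {k = suc k} (ℕ.≤′-step j≤k) = ≤-trans (lo-mono j≤k) (lo-step k)

    point-mono : ∀ {j k} → j ℕ.≤′ k → point k ≤ point j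
    point-mono ℕ.≤′-refl                   = ≤-refl
    point-mono {k = suc k} (ℕ.≤′-step j≤k) = ≤-trans (hi-step k) (point-mono j≤k)

    lo≤point : ∀ k → lo (bracket k) ≤ point k
    lo≤point k = ≤-by (<⇒≤ (halves-pos k 0<p)) (width (bracket k))

    0≤point : ∀ k → 0ℚ ≤ point k
    0≤point k = ≤-trans (0≤lo (bracket k)) (lo≤point k)

    point≤p : ∀ k → point k ≤ p
    point≤p k = subst (point k ≤_) bracket-0 (point-mono (ℕ.≤⇒≤′ z≤n))

    point-close : ∀ {j k} → j ℕ.≤ k → point j - point k ≤ halves p j
    point-close {j} {k} j≤k = ≤-by
      (0≤- (≤-trans (lo-mono (ℕ.≤⇒≤′ j≤k)) (lo≤point k)))
      (trans (cong (_- (point j - point k)) (sym (width (bracket j))))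
        (solve 3 (λ a l b → (a :- l) :- (a :- b) := b :- l) refl (point j) (lo (bracket j)) (point k)))

    private
      0≤p = <⇒≤ 0<p
      in-range : ∀ {x} → 0ℚ ≤ x → x ≤ p → ∣ x ∣ ≤ p
      in-range {x} 0≤x x≤p = subst (_≤ p) (sym (ℚ.0≤p⇒∣p∣≡p 0≤x)) x≤p
      gap : ∀ k → ∣ point k - lo (bracket k) ∣ ≡ halves p k
      gap k = trans (cong ∣_∣ (width (bracket k))) (ℚ.0≤p⇒∣p∣≡p (<⇒≤ (halves-pos k 0<p)))
      range-lo : ∀ k → ∣ lo (bracket k) ∣ ≤ p
      range-lo k = in-range (0≤lo (bracket k)) (≤-trans (lo≤point k) (point≤p k))

    -- One constant for both estimates: its first summand controls the value from above, through the
    -- bad end, and its second from below, through the good end.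
    constant : ℚ
    constant = growth-constant p (length L) + modulus p (length L)

    constant-pos : 0ℚ < constant
    constant-pos = subst (0ℚ <_) (ℚ.+-comm (modulus p (length L)) (growth-constant p (length L)))
      (0<+ (modulus-pos 0≤p (length L)) (growth-nonneg (length L) 0≤p))

    value-≤ : ∀ k → ind (point k) L ≤ constant * halves p k
    value-≤ k = ≤-trans
      (subst (λ d → ind (point k) L ≤ growth-constant p (length L) * d) (gap k)
        (bad-small 0≤p (0≤point k) (in-range (0≤point k) (point≤p k)) (range-lo k)
          (good (bracket k)) (bad (bracket k))))
      (≤-by (<⇒≤ (0<* (modulus-pos 0≤p (length L)) (halves-pos k 0<p)))
        (solve 3 (λ g m h → (g :+ m) :* h :- g :* h := m :* h) refl
          (growth-constant p (length L)) (modulus p (length L)) (halves p k)))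

    value-≥ : ∀ k → - ind (point k) L ≤ constant * halves p k
    value-≥ k = ≤-by
      (0≤+ (0≤- (subst (λ d → - (ind (point k) L - ind (lo (bracket k)) L) ≤ modulus p (length L) * d) (gap k)
              (≤-trans (-≤∣∣ (ind (point k) L - ind (lo (bracket k)) L))
                (ind-lipschitz 0≤p (in-range (0≤point k) (point≤p k)) (range-lo k) (length L) L ℕ.≤-refl))))
        (0≤+ (<⇒≤ (pos-self (good (bracket k))))
          (0≤* (growth-nonneg (length L) 0≤p) (<⇒≤ (halves-pos k 0<p)))))
      (solve 5 (λ g m h i j → (g :+ m) :* h :- (:- i) := (m :* h :- (:- (i :- j))) :+ (j :+ g :* h)) refl
        (growth-constant p (length L)) (modulus p (length L)) (halves p k)
        (ind (point k) L) (ind (lo (bracket k)) L))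

    value-small : ∀ {ε} → 0ℚ < ε → ∃ λ N → ∀ k → N ℕ.≤ k → ∣ ind (point k) L ∣ ≤ ε
    value-small {ε} 0<ε = conclude (halves-small (0<* constant-pos 0<p) 0<ε)
      where
      halves-mono : ∀ {j k} → j ℕ.≤′ k → halves p k ≤ halves p j
      halves-mono ℕ.≤′-refl = ≤-refl
      halves-mono {k = suc k} (ℕ.≤′-step j≤k) = ≤-trans
        (≤-by (<⇒≤ (0<* (halves-pos k 0<p) (ℚ.positive⁻¹ ½)))
          (solve 1 (λ h → h :- h :* con ½ := h :* con ½) refl (halves p k)))
        (halves-mono j≤k)
      conclude : (∃ λ N → halves (constant * p) N ≤ ε) →
        ∃ λ N → ∀ k → N ℕ.≤ k → ∣ ind (point k) L ∣ ≤ ε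
      conclude (N , small) = N , λ k N≤k → ≤-trans (∣∣-≤ (value-≤ k) (value-≥ k))
        (≤-trans (*-mono-≤ (<⇒≤ constant-pos) ≤-refl (<⇒≤ (halves-pos k 0<p)) (halves-mono (ℕ.≤⇒≤′ N≤k)))
          (≤-trans (≤-reflexive (halves-scale constant p N)) small))

  -- Turns a lower bound for the whole graph, on a whole interval, into positivity of all its
  -- induced subgraphs: a bad `p` would lead bisection to a point of the interval where `ind` is at
  -- most `δ * ½`.
  pos-from-bound : ∀ {p δ L} → 0ℚ < p → 0ℚ < δ →
    (∀ p′ → 0ℚ ≤ p′ → p′ ≤ p → δ ≤ ind p′ L) → Pos p L
  pos-from-bound {p} {δ} {L} 0<p 0<δ bound with pos-or-bad p L
  ... | inj₁ pos   = pos
  ... | inj₂ bad-p = contradiction (absurd (value-small (0<* 0<δ (ℚ.positive⁻¹ ½)))) (ℚ.<-irrefl refl)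
    where
    open Bisection 0<p bad-p
    absurd : (∃ λ N → ∀ k → N ℕ.≤ k → ∣ ind (point k) L ∣ ≤ δ * ½) → δ * ½ < δ * ½
    absurd (N , small) = <-≤-trans
      (<-by (0<* 0<δ (ℚ.positive⁻¹ ½)) (solve 1 (λ d → d :- d :* con ½ := d :* con ½) refl δ))
      (≤-trans (bound (point N) (0≤point N) (point≤p N))
        (≤-trans (≤∣∣ (ind (point N) L)) (small N ℕ.≤-refl)))

-- Comparison with Uₙ

^-mono : ∀ {a b} n → 0ℚ ≤ a → a ≤ b → a ^ n ≤ b ^ n
^-mono zero    0≤a a≤b = ≤-refl
^-mono (suc n) 0≤a a≤b = *-mono-≤ 0≤a a≤b (^-nonneg n) (^-mono n 0≤a a≤b)
  where
  ^-nonneg : ∀ n → 0ℚ ≤ _ ^ n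
  ^-nonneg zero    = <⇒≤ 0<1
  ^-nonneg (suc n) = 0≤* 0≤a (^-nonneg n)

1^ : ∀ n → 1ℚ ^ n ≡ 1ℚ
1^ zero    = refl
1^ (suc n) = trans (ℚ.*-identityˡ (1ℚ ^ n)) (1^ n)

-- I(Uₙ, −p) for n = 3 + j.
us : ℚ → ℕ → ℚ
us p j = (1ℚ - p) ^ j * (1ℚ - p - p) - p

module _ {p : ℚ} (0≤p : 0ℚ ≤ p) (0<1-2p : 0ℚ < 1ℚ - p - p) where

  0<1-p : 0ℚ < 1ℚ - p
  0<1-p = subst (0ℚ <_) (solve 1 (λ p → con 1ℚ :- p :- p :+ p := con 1ℚ :- p) refl p) (0<+ 0<1-2p 0≤p)

  us-mono-p : ∀ {p′} j → 0ℚ ≤ p′ → p′ ≤ p → us p j ≤ us p′ j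
  us-mono-p {p′} j 0≤p′ p′≤p = ≤-by
    (0≤+ (0≤- (*-mono-≤ (<⇒≤ (^-pos j 0<1-p))
              (^-mono j (<⇒≤ 0<1-p) 1-p≤) (<⇒≤ 0<1-2p) 1-2p≤)) (0≤- p′≤p))
    (solve 4 (λ a b p q → (b :- q) :- (a :- p) := (b :- a) :+ (p :- q)) refl
      ((1ℚ - p) ^ j * (1ℚ - p - p)) ((1ℚ - p′) ^ j * (1ℚ - p′ - p′)) p p′)
    where
    1-p≤ : 1ℚ - p ≤ 1ℚ - p′
    1-p≤ = ≤-by (0≤- p′≤p) (solve 2 (λ p q → con 1ℚ :- q :- (con 1ℚ :- p) := p :- q) refl p p′)
    1-2p≤ : 1ℚ - p - p ≤ 1ℚ - p′ - p′
    1-2p≤ = ≤-by (0≤+ (0≤- p′≤p) (0≤- p′≤p))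
      (solve 2 (λ p q → con 1ℚ :- q :- q :- (con 1ℚ :- p :- p) := (p :- q) :+ (p :- q)) refl p p′)

  us-≤1 : ∀ j → us p j ≤ 1ℚ
  us-≤1 j = ≤-trans (us-mono-p j ≤-refl 0≤p) (≤-reflexive (trans
    (cong (λ t → t * (1ℚ - 0ℚ - 0ℚ) - 0ℚ) (1^ j)) refl))

  us-step : ∀ j → us p (suc j) ≡ us p j - p * ((1ℚ - p - p) * (1ℚ - p) ^ j)
  us-step j = solve 2 (λ p x →
      (con 1ℚ :- p) :* x :* (con 1ℚ :- p :- p) :- p := x :* (con 1ℚ :- p :- p) :- p :- p :* ((con 1ℚ :- p :- p) :* x))
    refl p ((1ℚ - p) ^ j)

  us-antitone : ∀ j → us p (suc j) ≤ us p j
  us-antitone j = ≤-by (0≤* 0≤p (<⇒≤ (0<* 0<1-2p (^-pos j 0<1-p))))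
    (trans (cong (λ t → us p j - t) (us-step j))
      (solve 2 (λ a b → a :- (a :- b) := b) refl (us p j) (p * ((1ℚ - p - p) * (1ℚ - p) ^ j))))

  open Recurrence p

  private
    e = 1ℚ - p

    -- `e ^ i - p` is the value of the star with i leaves and `e ^ i` that of i isolated vertices; a
    -- path is compared with both.
    record PathBounds (i : ℕ) : Set where
      field
        lower : e ^ i - p ≤ pa (3 ℕ.+ i)
        ratio : pa (3 ℕ.+ i) ≤ e * pa (2 ℕ.+ i)
        upper : pa (2 ℕ.+ i) ≤ e ^ i
        pos   : 0ℚ < pa (2 ℕ.+ i)

    path-bounds : ∀ i → (∀ i′ → i′ ℕ.< i → 0ℚ < e ^ i′ - p) → PathBounds i
    path-bounds zero _ = record
      { lower = ≤-reflexive (solve 1 (λ p → con 1ℚ :- p := (con 1ℚ :- p :* con 0ℚ) :- p :* con 1ℚ) refl p)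
      ; ratio = ≤-reflexive (solve 1 (λ p → (con 1ℚ :- p :* con 0ℚ) :- p :* con 1ℚ
                                := (con 1ℚ :- p) :* (con 1ℚ :- p :* con 0ℚ)) refl p)
      ; upper = ≤-reflexive (solve 1 (λ p → con 1ℚ :- p :* con 0ℚ := con 1ℚ) refl p)
      ; pos   = subst (0ℚ <_) (solve 1 (λ p → con 1ℚ := con 1ℚ :- p :* con 0ℚ) refl p) 0<1
      }
    path-bounds (suc i) cond = record
      { lower = ≤-by (0≤+ (0≤- IH.lower) (0≤* 0≤p (0≤- IH.upper)))
          (solve 4 (λ p x a b → (b :- p :* a) :- ((con 1ℚ :- p) :* x :- p)
                      := (b :- (x :- p)) :+ p :* (x :- a)) refl p (e ^ i) (pa (2 ℕ.+ i)) (pa (3 ℕ.+ i)))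
      ; ratio = ≤-by (0≤* 0≤p (0≤- (≤-trans IH.ratio e*≤)))
          (solve 3 (λ p a b → (con 1ℚ :- p) :* b :- (b :- p :* a) := p :* (a :- b)) refl
            p (pa (2 ℕ.+ i)) (pa (3 ℕ.+ i)))
      ; upper = ≤-trans IH.ratio (*-mono-≤ (<⇒≤ 0<1-p) ≤-refl (<⇒≤ IH.pos) IH.upper)
      ; pos   = <-≤-trans (cond i ℕ.≤-refl) IH.lower
      }
      where
      module IH = PathBounds (path-bounds i (λ i′ i′< → cond i′ (ℕ.m≤n⇒m≤1+n i′<)))
      e*≤ : e * pa (2 ℕ.+ i) ≤ pa (2 ℕ.+ i)
      e*≤ = ≤-by (0≤* 0≤p (<⇒≤ IH.pos))
        (solve 2 (λ p a → a :- (con 1ℚ :- p) :* a := p :* a) refl p (pa (2 ℕ.+ i)))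

  -- A vertex of the cycle is deleted: the path on n - 1 vertices is bounded below by the star, the
  -- path on n - 3 vertices above by isolated vertices, and the combination is exactly `us p j`.
  us-≤-cy : ∀ j → 0ℚ < us p j → us p j ≤ cy (3 ℕ.+ j)
  us-≤-cy j 0<u = ≤-trans
    (≤-by (0≤+ (0≤- (PathBounds.lower (path-bounds (suc j) cond)))
               (0≤* 0≤p (0≤- (PathBounds.upper (path-bounds j (λ i i< → cond i (ℕ.m≤n⇒m≤1+n i<)))))))
      (solve 4 (λ p x a b → (b :- p :* a) :- (x :* (con 1ℚ :- p :- p) :- p)
            := (b :- ((con 1ℚ :- p) :* x :- p)) :+ p :* (x :- a)) refl
        p (e ^ j) (pa (2 ℕ.+ j)) (pa (4 ℕ.+ j))))
    (≤-reflexive (sym (cy-cycle (suc j))))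
    where
    us-antitone′ : ∀ {i k} → i ℕ.≤′ k → us p k ≤ us p i
    us-antitone′ ℕ.≤′-refl                   = ≤-refl
    us-antitone′ {k = suc k} (ℕ.≤′-step i≤k) = ≤-trans (us-antitone k) (us-antitone′ i≤k)
    cond : ∀ i → i ℕ.< suc j → 0ℚ < e ^ i - p
    cond i (s≤s i≤j) = <-≤-trans 0<u (≤-trans (us-antitone′ (ℕ.≤⇒≤′ i≤j))
      (≤-by (0≤* (<⇒≤ (^-pos i 0<1-p)) (0≤+ 0≤p 0≤p))
        (solve 2 (λ p x → (x :- p) :- (x :* (con 1ℚ :- p :- p) :- p) := x :* (p :+ p)) refl p (e ^ i))))

module StarBound {n : ℕ} (G : Graph n) where
  open Independence G
  open Shapes G
  open Continuity G

  OneEdge : List V → Set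
  OneEdge L = ∃₂ λ a b → ∃ λ E → L ↭ a ∷ b ∷ E × a ~ b ×
    All (a ≁_) E × All (b ≁_) E × AllPairs _≁_ E

  -- A cycle without one vertex still has an edge. If `u` is the last leaf, the claim is applied to
  -- the rest at the neighbour of this leaf, which is then put back.
  uni-edge : ∀ {L u L₀} → Uni L → L ↭ u ∷ L₀ → ∃₂ λ a b → ∃ λ E → L₀ ↭ a ∷ b ∷ E × a ~ b
  uni-edge {L} (cycle {j = j} {c} cyc σ) τ with arc-∈ c 0 (3 ℕ.+ j) (∈-resp-↭ σ (↭⇒∈ τ))
  ... | i , _ , refl rewrite ℕ.+-identityʳ i =
    c (1 ℕ.+ i) , c (2 ℕ.+ i) , arc c (3 ℕ.+ i) j ,
    drop-∷ (↭-trans (↭-sym τ) (↭-trans σ (arc-rotate cyc i))) , CyclicOrder.next cyc (suc i)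
  uni-edge {u = u} {L₀} (leaf {L = L₁} {z = z} t l σ) τ with ∈-resp-↭ σ (↭⇒∈ τ)
  ... | here refl with ∈⇒↭ (leaf-∈ l)
  ... | _ , ρ with uni-edge t ρ
  ... | a , b , E , π , a~b = a , b , _ ∷ E ,
    ↭-trans (drop-∷ (↭-trans (↭-sym τ) σ)) (↭-trans ρ (↭-trans (prep _ π) (↭-sym (shift _ (a ∷ b ∷ []) E)))) , a~b
  uni-edge {u = u} {L₀} (leaf {L = L₁} {z = z} t l σ) τ | there u∈L₁ with ∈⇒↭ u∈L₁
  ... | X , ρ with uni-edge t ρ
  ... | a , b , E , π , a~b = a , b , z ∷ E ,
    ↭-trans (drop-∷ (↭-trans (↭-sym τ) (↭-trans σ (↭-trans (prep z ρ) (swap z u ↭-refl)))))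
      (↭-trans (prep z π) (↭-sym (shift z (a ∷ b ∷ []) E))) , a~b

  module _ {p : ℚ} (0<p : 0ℚ < p) where

    -- Either `x` has no neighbour in `E`, or removing its neighbours strictly raises the value.
    -- This dichotomy is the source of all equality cases for Uₙ.
    away-grows : ∀ x {E} → Pos p E → All (x ≁_) E ⊎ ind p E < ind p (away x E)
    away-grows x {E} pos with away-complement x E
    ... | [] , σ = inj₁ (All-resp-↭ (↭-sym (↭-trans σ (↭-reflexive (++-identityʳ (away x E)))))
                          (All.all-filter (λ w → ¬? (adj? G x w)) E))
    ... | r ∷ R , σ = inj₂ (subst (_< ind p (away x E)) (sym (ind-↭ p τ)) (ind-++-< r R 0<p (pos-↭ τ pos)))
      where
      τ : E ↭ r ∷ R ++ away x E
      τ = ↭-trans σ (++-comm (away x E) (r ∷ R))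

    away-≤ : ∀ x {E} → Pos p E → ind p E ≤ ind p (away x E)
    away-≤ x pos with away-grows x pos
    ... | inj₁ none = ≤-reflexive (cong (ind p) (sym (away-none none)))
    ... | inj₂ lt   = <⇒≤ lt

  module _ {p : ℚ} (0<p : 0ℚ < p) (0<1-2p : 0ℚ < 1ℚ - p - p) where

    private
      e = 1ℚ - p
      0<e = 0<1-p (<⇒≤ 0<p) 0<1-2p

      cons-eq : ∀ x E → e * ind p E - ind p (x ∷ E) ≡ p * (ind p (away x E) - ind p E)
      cons-eq x E = trans (cong (λ t → e * ind p E - t) (ind-∷ p x E))
        (solve 3 (λ p a b → (con 1ℚ :- p) :* a :- (a :- p :* b) := p :* (b :- a)) refl
          p (ind p E) (ind p (away x E)))

    edgeless-≤ : ∀ E → Pos p E → ind p E ≤ e ^ length E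
    edgeless-≤ []      pos = ≤-reflexive (ind-[] p)
    edgeless-≤ (x ∷ E) pos = ≤-trans
      (≤-by (0≤* (<⇒≤ 0<p) (0≤- (away-≤ 0<p x (pos-tail pos)))) (cons-eq x E))
      (*-mono-≤ (<⇒≤ 0<e) ≤-refl (<⇒≤ (pos-self (pos-tail pos))) (edgeless-≤ E (pos-tail pos)))

    edgeless-< : ∀ E → Pos p E → AllPairs _≁_ E ⊎ ind p E < e ^ length E
    edgeless-< []      pos = inj₁ []
    edgeless-< (x ∷ E) pos with edgeless-< E (pos-tail pos) | away-grows 0<p x (pos-tail pos)
    ... | inj₁ pairs | inj₁ none = inj₁ (none ∷ pairs)
    ... | inj₂ lt    | _         = inj₂ (≤-<-trans
      (≤-by (0≤* (<⇒≤ 0<p) (0≤- (away-≤ 0<p x (pos-tail pos)))) (cons-eq x E))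
      (*-mono-<ʳ 0<e ≤-refl (<⇒≤ (pos-self (pos-tail pos))) lt))
    ... | inj₁ _     | inj₂ lt   = inj₂ (<-≤-trans
      (<-by (0<* 0<p (0<- lt)) (cons-eq x E))
      (*-mono-≤ (<⇒≤ 0<e) ≤-refl (<⇒≤ (pos-self (pos-tail pos))) (edgeless-≤ E (pos-tail pos))))

    private
      one-edge-eq : ∀ {a b} E → a ~ b →
        (1ℚ - p - p) * ind p E - ind p (a ∷ b ∷ E) ≡
        p * (ind p (away a E) - ind p E) + p * (ind p (away b E) - ind p E)
      one-edge-eq {a} {b} E a~b = trans
        (cong (λ t → (1ℚ - p - p) * ind p E - t)
          (trans (ind-∷ p a (b ∷ E)) (cong₂ (λ x Y → x - p * ind p Y) (ind-∷ p b E) (away-adj E a~b))))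
        (solve 4 (λ p x y z → (con 1ℚ :- p :- p) :* x :- (x :- p :* z :- p :* y)
            := p :* (y :- x) :+ p :* (z :- x)) refl p (ind p E) (ind p (away a E)) (ind p (away b E)))

    one-edge-bound : ∀ {L a b E} → L ↭ a ∷ b ∷ E → a ~ b → Pos p L →
      ind p L < (1ℚ - p - p) * e ^ length E ⊎
      ind p L ≤ (1ℚ - p - p) * e ^ length E × OneEdge L
    one-edge-bound {L} {a} {b} {E} σ a~b pos =
      go (away-grows 0<p a posE) (away-grows 0<p b posE) (edgeless-< E posE)
      where
      posE : Pos p E
      posE = pos-tail (pos-tail (pos-↭ σ pos))
      0≤a = 0≤* (<⇒≤ 0<p) (0≤- (away-≤ 0<p a posE))
      0≤b = 0≤* (<⇒≤ 0<p) (0≤- (away-≤ 0<p b posE))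
      first-≤ : ind p L ≤ (1ℚ - p - p) * ind p E
      first-≤ = ≤-trans (≤-reflexive (ind-↭ p σ)) (≤-by (0≤+ 0≤a 0≤b) (one-edge-eq E a~b))
      second-≤ : (1ℚ - p - p) * ind p E ≤ (1ℚ - p - p) * e ^ length E
      second-≤ = *-mono-≤ (<⇒≤ 0<1-2p) ≤-refl (<⇒≤ (pos-self posE)) (edgeless-≤ E posE)
      strict : 0ℚ < p * (ind p (away a E) - ind p E) + p * (ind p (away b E) - ind p E) →
        ind p L < (1ℚ - p - p) * e ^ length E
      strict 0<d = <-≤-trans (≤-<-trans (≤-reflexive (ind-↭ p σ)) (<-by 0<d (one-edge-eq E a~b))) second-≤
      go : All (a ≁_) E ⊎ ind p E < ind p (away a E) → All (b ≁_) E ⊎ ind p E < ind p (away b E) →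
        AllPairs _≁_ E ⊎ ind p E < e ^ length E →
        ind p L < (1ℚ - p - p) * e ^ length E ⊎ ind p L ≤ (1ℚ - p - p) * e ^ length E × OneEdge L
      go (inj₂ lt) _ _ = inj₁ (strict (0<+ (0<* 0<p (0<- lt)) 0≤b))
      go (inj₁ _) (inj₂ lt) _ = inj₁ (strict (ℚ.+-mono-≤-< 0≤a (0<* 0<p (0<- lt))))
      go (inj₁ _) (inj₁ _) (inj₂ lt) = inj₁ (≤-<-trans first-≤
        (*-mono-<ʳ 0<1-2p ≤-refl (<⇒≤ (pos-self posE)) lt))
      go (inj₁ na) (inj₁ nb) (inj₁ pairs) =
        inj₂ (≤-trans first-≤ second-≤ , a , b , E , σ , a~b , na , nb , pairs)

    -- By `us-step` the corresponding leaf of Uₙ sits at the centre, where it costs `p` times the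
    -- bound of `one-edge-bound`. No other leaf costs more.
    leaf-bound : ∀ {L z u j} → Uni L → (l : LeafAt z u L) → Pos p L → length L ≡ 3 ℕ.+ j →
      us p j ≤ ind p L →
      us p (suc j) < ind p (z ∷ L) ⊎ us p (suc j) ≤ ind p (z ∷ L) × OneEdge (LeafAt.others l)
    leaf-bound {L} {z} {u} {j} t l pos |L| u≤ with uni-edge t (LeafAt.perm l)
    ... | a , b , E , σ , a~b = conclude
        (one-edge-bound σ a~b (pos-tail (pos-↭ (LeafAt.perm l) pos)))
      where
      open Comparison G p 0<p using (ind-leaf)
      X = LeafAt.others l
      |E| : length E ≡ j
      |E| = ℕ.suc-injective (ℕ.suc-injective (ℕ.suc-injective
        (trans (sym (trans (↭-length (LeafAt.perm l)) (cong suc (↭-length σ)))) |L|)))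
      eq : ind p (z ∷ L) - us p (suc j) ≡
        (ind p L - us p j) + p * ((1ℚ - p - p) * e ^ length E - ind p X)
      eq = trans (cong₂ _-_ (ind-leaf l)
               (trans (us-step (<⇒≤ 0<p) 0<1-2p j) (cong (λ k → us p j - p * ((1ℚ - p - p) * e ^ k)) (sym |E|))))
        (solve 5 (λ p i x s w → (i :- p :* x) :- (s :- p :* w) := (i :- s) :+ p :* (w :- x)) refl
          p (ind p L) (ind p X) (us p j) ((1ℚ - p - p) * e ^ length E))
      conclude : ind p X < (1ℚ - p - p) * e ^ length E ⊎
        ind p X ≤ (1ℚ - p - p) * e ^ length E × OneEdge X →
        us p (suc j) < ind p (z ∷ L) ⊎ us p (suc j) ≤ ind p (z ∷ L) × OneEdge X
      conclude (inj₁ lt) = inj₁ (<-by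
        (ℚ.+-mono-≤-< (0≤- u≤) (0<* 0<p (0<- lt))) eq)
      conclude (inj₂ (le , one)) = inj₂ (≤-by (0≤+ (0≤- u≤) (0≤* (<⇒≤ 0<p) (0≤- le))) eq , one)

  -- The two statements feed each other. The bound for a graph holds on all of [0, p], since `us`
  -- decreases in the point, and gives positivity by `pos-from-bound`; positivity of the graph
  -- without its last leaf gives the bound with that leaf.
  star-bound : ∀ {L} → Uni L → ∀ j → length L ≡ 3 ℕ.+ j → ∀ {p} → 0ℚ < p → 0ℚ < 1ℚ - p - p →
    0ℚ < us p j → us p j ≤ ind p L
  star-pos : ∀ {L} → Uni L → ∀ j → length L ≡ 3 ℕ.+ j → ∀ {p} → 0ℚ < p → 0ℚ < 1ℚ - p - p →
    0ℚ < us p j → Pos p L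

  star-pos {L} t j |L| {p} 0<p 0<1-2p 0<u = pos-from-bound 0<p 0<u bound
    where
    bound : ∀ p′ → 0ℚ ≤ p′ → p′ ≤ p → us p j ≤ ind p′ L
    bound p′ 0≤p′ p′≤p with 0ℚ ℚ.<? p′
    ... | yes 0<p′ = ≤-trans u≤u′ (star-bound t j |L| 0<p′
          (<-≤-trans 0<1-2p (≤-by (0≤+ (0≤- p′≤p) (0≤- p′≤p))
            (solve 2 (λ p q → con 1ℚ :- q :- q :- (con 1ℚ :- p :- p) := (p :- q) :+ (p :- q)) refl p p′)))
          (<-≤-trans 0<u u≤u′))
      where u≤u′ = us-mono-p (<⇒≤ 0<p) 0<1-2p j 0≤p′ p′≤p
    ... | no 0≮p′ with ℚ.≤-antisym (ℚ.≮⇒≥ 0≮p′) 0≤p′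
    ... | refl = ≤-trans (us-≤1 (<⇒≤ 0<p) 0<1-2p j) (≤-reflexive (sym (ind-0 L)))

  star-bound (cycle {j = j′} {c} cyc σ) j |L| {p} 0<p 0<1-2p 0<u
    with ℕ.+-cancelˡ-≡ 3 j j′ (trans (sym |L|) (trans (↭-length σ) (arc-length c 0 (3 ℕ.+ j′))))
  ... | refl = ≤-trans (us-≤-cy (<⇒≤ 0<p) 0<1-2p j 0<u)
    (≤-reflexive (sym (Comparison.ind-cycle G p 0<p cyc σ)))
  star-bound (leaf t l σ) j |L| {p} 0<p 0<1-2p 0<u with uni-length t
  ... | j₁ , |L₁| with ℕ.+-cancelˡ-≡ 3 j (suc j₁) (trans (sym |L|) (trans (↭-length σ) (cong suc |L₁|)))
  ... | refl = subst (us p (suc j₁) ≤_) (sym (ind-↭ p σ))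
      (weaken (leaf-bound 0<p 0<1-2p t l (star-pos t j₁ |L₁| 0<p 0<1-2p 0<u₁) |L₁|
        (star-bound t j₁ |L₁| 0<p 0<1-2p 0<u₁)))
    where
    0<u₁ = <-≤-trans 0<u (us-antitone (<⇒≤ 0<p) 0<1-2p j₁)
    weaken : ∀ {a b : ℚ} {S : Set} → a < b ⊎ a ≤ b × S → a ≤ b
    weaken (inj₁ lt)       = <⇒≤ lt
    weaken (inj₂ (le , _)) = le

-- Unicyclic graphs are cycles with leaves added

unique-↭ : ∀ {A : Set} {L L′ : List A} → L ↭ L′ → Unique L → Unique L′
unique-↭ {A} σ = SetoidPerm.Unique-resp-↭ (setoid A) (↭⇒↭ₛ σ)

head∉ : ∀ {A : Set} {x : A} {L} → Unique (x ∷ L) → x ∉ L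
head∉ (x≢ ∷ _) x∈L = All.lookup x≢ x∈L refl

unique-++ : ∀ {A : Set} {x : A} X {Y} → Unique (X ++ Y) → x ∈ X → x ∉ Y
unique-++ (x ∷ X) (x≢ ∷ _) (here refl) x∈Y = All.lookup x≢ (∈-++⁺ʳ X x∈Y) refl
unique-++ (x ∷ X) (_ ∷ u)  (there x∈X) x∈Y = unique-++ X u x∈X x∈Y

unique-lookup : ∀ {A : Set} {L : List A} → Unique L → ∀ {i j} → lookup L i ≡ lookup L j → i ≡ j
unique-lookup {L = x ∷ L} u       {zero}  {zero}  eq = refl
unique-lookup {L = x ∷ L} u       {zero}  {suc j} eq =
  contradiction (subst (_∈ L) (sym eq) (∈-lookup j)) (head∉ u)
unique-lookup {L = x ∷ L} u       {suc i} {zero}  eq =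
  contradiction (subst (_∈ L) eq (∈-lookup i)) (head∉ u)
unique-lookup {L = x ∷ L} (_ ∷ u) {suc i} {suc j} eq = cong suc (unique-lookup u eq)

unique-complement : ∀ {A : Set} {Y : List A} L → Unique L → All (_∈ Y) L → ∃ λ R → Y ↭ L ++ R
unique-complement {Y = Y} []      _          _         = Y , ↭-refl
unique-complement {Y = Y} (x ∷ L) (x≢ ∷ u) (x∈Y ∷ L⊆Y) with unique-complement L u L⊆Y
... | R , σ with ∈-++⁻ L (∈-resp-↭ σ x∈Y)
... | inj₁ x∈L = contradiction refl (All.lookup x≢ x∈L)
... | inj₂ x∈R with ∈⇒↭ x∈R
... | R₀ , ρ = R₀ , ↭-trans σ (↭-trans (++⁺ˡ L ρ) (shift x L R₀))

module StandardCycle (j : ℕ) where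

  k = 3 ℕ.+ j

  residue : ℕ → Fin k
  residue i = fromℕ< (m%n<n i k)

  toℕ-residue : ∀ i → toℕ (residue i) ≡ i % k
  toℕ-residue i = Fin.toℕ-fromℕ< (m%n<n i k)

  residue-toℕ : ∀ (i : Fin k) → residue (toℕ i) ≡ i
  residue-toℕ i = Fin.toℕ-injective (trans (toℕ-residue (toℕ i)) (m<n⇒m%n≡m (Fin.toℕ<n i)))

  residue-periodic : ∀ i → residue (i ℕ.+ k) ≡ residue i
  residue-periodic i = Fin.toℕ-injective
    (trans (toℕ-residue (i ℕ.+ k)) (trans ([m+n]%n≡m%n i k) (sym (toℕ-residue i))))

  -- A step of less than `k` wraps around at most once. This turns the later claims about remainders
  -- into two linear cases.
  residue-+ : ∀ d i → d ℕ.< k →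
    toℕ (residue (d ℕ.+ i)) ≡ d ℕ.+ toℕ (residue i) ⊎
    toℕ (residue (d ℕ.+ i)) ℕ.+ k ≡ d ℕ.+ toℕ (residue i)
  residue-+ d i d<k rewrite toℕ-residue (d ℕ.+ i) | toℕ-residue i = go (d ℕ.+ i % k ℕ.<? k)
    where
    eq : (d ℕ.+ i) % k ≡ (d ℕ.+ i % k) % k
    eq = trans (%-distribˡ-+ d i k) (cong (λ t → (t ℕ.+ i % k) % k) (m<n⇒m%n≡m d<k))
    go : Dec (d ℕ.+ i % k ℕ.< k) → (d ℕ.+ i) % k ≡ d ℕ.+ i % k ⊎ (d ℕ.+ i) % k ℕ.+ k ≡ d ℕ.+ i % k
    go (yes <k) = inj₁ (trans eq (m<n⇒m%n≡m <k))
    go (no ≮k)  = inj₂ (trans (cong (ℕ._+ k) (trans eq (trans (sym (m≤n⇒[n∸m]%m≡n%m k≤)) (m<n⇒m%n≡m t<k))))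
                         (ℕ.m∸n+n≡m k≤))
      where
      k≤ : k ℕ.≤ d ℕ.+ i % k
      k≤ = ℕ.≮⇒≥ ≮k
      t<k : d ℕ.+ i % k ℕ.∸ k ℕ.< k
      t<k = ℕ.+-cancelʳ-< k (d ℕ.+ i % k ℕ.∸ k) k
        (subst (ℕ._< k ℕ.+ k) (sym (ℕ.m∸n+n≡m k≤)) (ℕ.+-mono-< d<k (m%n<n i k)))

  residue-distinct : ∀ i d → suc d ℕ.< k → residue i ≢ residue (suc d ℕ.+ i)
  residue-distinct i d d<k eq with residue-+ (suc d) i d<k
  ... | inj₁ h = ℕ.m≢1+n+m (toℕ (residue i)) (trans (cong toℕ eq) h)
  ... | inj₂ h = ℕ.<⇒≢ d<k (sym (ℕ.+-cancelʳ-≡ (toℕ (residue i)) k (suc d)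
    (trans (ℕ.+-comm k _) (trans (cong (λ t → toℕ t ℕ.+ k) eq) h))))

  residue-next : ∀ i → Adj (C k) (residue i) (residue (suc i))
  residue-next i = residue-distinct i 0 (s≤s (s≤s z≤n)) , edge (residue-+ 1 i (s≤s (s≤s z≤n)))
    where
    r = toℕ (residue i)
    r′ = toℕ (residue (suc i))
    edge : r′ ≡ 1 ℕ.+ r ⊎ r′ ℕ.+ k ≡ 1 ℕ.+ r → _
    edge (inj₁ h) = inj₁ (inj₁ (sym h))
    edge (inj₂ h) = inj₂ (inj₂ (r′≡0 , trans (sym h) (cong (ℕ._+ k) r′≡0)))
      where
      r′≡0 : r′ ≡ 0
      r′≡0 = ℕ.n≤0⇒n≡0 (ℕ.+-cancelʳ-≤ k r′ 0 (ℕ.≤-trans (ℕ.≤-reflexive h) (Fin.toℕ<n (residue i))))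

  residue-last : ∀ i → Adj (C k) (residue i) (residue (2 ℕ.+ j ℕ.+ i))
  residue-last i = residue-distinct i (suc j) ℕ.≤-refl , edge (residue-+ (2 ℕ.+ j) i ℕ.≤-refl)
    where
    r = toℕ (residue i)
    r′ = toℕ (residue (2 ℕ.+ j ℕ.+ i))
    edge : r′ ≡ 2 ℕ.+ j ℕ.+ r ⊎ r′ ℕ.+ k ≡ 2 ℕ.+ j ℕ.+ r → _
    edge (inj₁ h) = inj₁ (inj₂ (r≡0 , cong suc (trans h (trans (cong (2 ℕ.+ j ℕ.+_) r≡0) (ℕ.+-identityʳ _)))))
      where
      r≡0 : r ≡ 0
      r≡0 = ℕ.n≤0⇒n≡0 (ℕ.+-cancelˡ-≤ (3 ℕ.+ j) r 0 (subst₂ ℕ._≤_ (cong suc h) (sym (ℕ.+-identityʳ k))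
        (Fin.toℕ<n (residue (2 ℕ.+ j ℕ.+ i)))))
    edge (inj₂ h) = inj₂ (inj₁ (ℕ.+-cancelʳ-≡ (2 ℕ.+ j) (suc r′) r
      (trans (sym (ℕ.+-suc r′ (2 ℕ.+ j))) (trans h (ℕ.+-comm (2 ℕ.+ j) r)))))

  residue-chord : ∀ i d → d ℕ.< j → ¬ Adj (C k) (residue i) (residue (2 ℕ.+ d ℕ.+ i))
  residue-chord i d d<j (_ , edge) = go (residue-+ (2 ℕ.+ d) i (s≤s (s≤s (ℕ.m≤n⇒m≤1+n d<j)))) edge
    where
    r = toℕ (residue i)
    r′ = toℕ (residue (2 ℕ.+ d ℕ.+ i))
    below : ∀ x → 2 ℕ.+ d ℕ.+ x ℕ.< x ℕ.+ k
    below x = subst (2 ℕ.+ d ℕ.+ x ℕ.<_) (ℕ.+-comm k x) (ℕ.+-monoˡ-< x (s≤s (s≤s (ℕ.m≤n⇒m≤1+n d<j))))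
    go : r′ ≡ 2 ℕ.+ d ℕ.+ r ⊎ r′ ℕ.+ k ≡ 2 ℕ.+ d ℕ.+ r →
      ¬ ((suc r ≡ r′ ⊎ r ≡ 0 × suc r′ ≡ k) ⊎ (suc r′ ≡ r ⊎ r′ ≡ 0 × suc r ≡ k))
    go (inj₁ h) (inj₁ (inj₁ e))        = ℕ.m≢1+n+m r (ℕ.suc-injective (trans e h))
    go (inj₁ h) (inj₁ (inj₂ (e , e′))) = ℕ.<⇒≢ d<j (ℕ.suc-injective (ℕ.suc-injective (ℕ.suc-injective
      (trans (cong suc (trans (sym (ℕ.+-identityʳ (2 ℕ.+ d))) (trans (cong (2 ℕ.+ d ℕ.+_) (sym e)) (sym h)))) e′))))
    go (inj₁ h) (inj₂ (inj₁ e))        = ℕ.m≢1+n+m r {2 ℕ.+ d} (trans (sym e) (cong suc h))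
    go (inj₁ h) (inj₂ (inj₂ (e , _)))  with () ← trans (sym e) h
    go (inj₂ h) (inj₁ (inj₁ e)) = ℕ.<⇒≢ (ℕ.<-≤-trans (below r) (ℕ.n≤1+n (r ℕ.+ k)))
      (trans (sym h) (cong (ℕ._+ k) (sym e)))
    go (inj₂ h) (inj₁ (inj₂ (e , _))) = ℕ.<⇒≢ (ℕ.<-≤-trans (below r)
      (ℕ.+-monoˡ-≤ k (subst (ℕ._≤ r′) (sym e) z≤n))) (sym h)
    go (inj₂ h) (inj₂ (inj₁ e)) = ℕ.<⇒≢ (ℕ.+-monoˡ-< r′ (s≤s (s≤s (s≤s d<j))))
      (trans (sym (ℕ.+-suc (2 ℕ.+ d) r′)) (trans (cong (2 ℕ.+ d ℕ.+_) e) (trans (sym h) (ℕ.+-comm r′ k))))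
    go (inj₂ h) (inj₂ (inj₂ (e , e′))) = ℕ.m≢1+n+m k {d} (trans (trans (cong (ℕ._+ k) (sym e)) h)
      (trans (sym (ℕ.+-suc (suc d) r)) (trans (cong (suc d ℕ.+_) e′) refl)))

module Decomposition {n : ℕ} (G : Graph n) where
  open Independence G using (V; _~_; _≁_)
  open Shapes G
  open DecMembership (Fin._≟_ {n}) using (_∈?_)

  data SimplePath : V → V → List V → Set where
    stop : ∀ {a} → SimplePath a a [ a ]
    step : ∀ {a b c l} → a ~ b → a ∉ l → SimplePath b c l → SimplePath a c (a ∷ l)

  path-snoc : ∀ {a b z l} → SimplePath a b l → b ~ z → z ∉ l → SimplePath a z (l ++ [ z ])
  path-snoc stop b~z z∉ = step b~z (λ { (here eq) → z∉ (here (sym eq)) }) stop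
  path-snoc {a} {z = z} (step {l = l} a~b a∉l P) b~z z∉ = step a~b a∉ (path-snoc P b~z (z∉ ∘ there))
    where
    a∉ : a ∉ l ++ [ z ]
    a∉ a∈ with ∈-++⁻ l a∈
    ... | inj₁ a∈l        = a∉l a∈l
    ... | inj₂ (here refl) = z∉ (here refl)

  path-unique : ∀ {a b l} → SimplePath a b l → Unique l
  path-unique stop            = [] ∷ []
  path-unique (step {a} _ a∉l P) = All.tabulate (λ x∈l a≡x → a∉l (subst (_∈ _) (sym a≡x) x∈l)) ∷ path-unique P

  path-first : ∀ {a b l} → SimplePath a b l → ∀ i → toℕ i ≡ 0 → lookup l i ≡ a
  path-first stop         zero _ = refl
  path-first (step _ _ _) zero _ = refl

  path-next : ∀ {a b l} → SimplePath a b l → ∀ i i′ → suc (toℕ i) ≡ toℕ i′ → lookup l i ~ lookup l i′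
  path-next (step a~b _ P) zero    (suc i′) eq = subst (_ ~_) (sym (path-first P i′ (sym (ℕ.suc-injective eq)))) a~b
  path-next (step _ _ P)   (suc i) (suc i′) eq = path-next P i i′ (ℕ.suc-injective eq)
  path-next stop           zero    zero     ()

  path-last : ∀ {a b l} → SimplePath a b l → ∀ i → suc (toℕ i) ≡ length l → lookup l i ≡ b
  path-last stop                  zero    _  = refl
  path-last (step _ _ stop)       zero    ()
  path-last (step _ _ (step _ _ _)) zero  ()
  path-last (step _ _ P)          (suc i) eq = path-last P i (ℕ.suc-injective eq)

  closed-path : ∀ {a b l} → SimplePath a b l → b ~ a → 3 ℕ.≤ length l → Cycle G
  closed-path {l = l} P b~a 3≤ = record
    { len = length l ; 3≤len = 3≤ ; vertex = lookup l
    ; injective = unique-lookup (path-unique P)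
    ; adjacent = λ { i i′ (_ , inj₁ e) → one-way i i′ e ; i i′ (_ , inj₂ e) → symm G (one-way i′ i e) }
    }
    where
    one-way : ∀ i i′ → suc (toℕ i) ≡ toℕ i′ ⊎ toℕ i ≡ 0 × suc (toℕ i′) ≡ length l → lookup l i ~ lookup l i′
    one-way i i′ (inj₁ e) = path-next P i i′ e
    one-way i i′ (inj₂ (e , e′)) = subst₂ _~_ (sym (path-first P i e)) (sym (path-last P i′ e′)) (symm G b~a)

  closed-path-edge : ∀ {a b l} (P : SimplePath a b l) (b~a : b ~ a) (3≤ : 3 ℕ.≤ length l) →
    Cycle.Edge (closed-path P b~a 3≤) a b
  closed-path-edge {l = l@(_ ∷ l′)} P b~a (s≤s 3≤) =
    zero , last , ((λ eq → absurd (trans (cong toℕ eq) toℕ-last)) , inj₁ (inj₂ (refl , cong suc toℕ-last))) ,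
    path-first P zero refl , path-last P last (cong suc toℕ-last)
    where
    last : Fin (length l)
    last = fromℕ< (ℕ.n<1+n (length l′))
    toℕ-last : toℕ last ≡ length l′
    toℕ-last = Fin.toℕ-fromℕ< (ℕ.n<1+n (length l′))
    absurd : 0 ≢ length l′
    absurd eq with () ← subst (2 ℕ.≤_) (sym eq) 3≤

  -- The paths stay inside `L`, so a vertex outside can close them to a cycle without repetition.
  Connecting : List V → Set
  Connecting L = ∀ {a b} → a ∈ L → b ∈ L → ∃ λ l → SimplePath a b l × All (_∈ L) l

  connecting-leaf : ∀ {L z u} → Connecting L → u ∈ L → z ~ u → z ∉ L → Connecting (z ∷ L)
  connecting-leaf conn u∈ z~u z∉ (here refl) (here refl) = _ , stop , here refl ∷ []
  connecting-leaf conn u∈ z~u z∉ (here refl) (there b∈) with conn u∈ b∈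
  ... | l , P , l⊆ = _ , step z~u (λ z∈l → z∉ (All.lookup l⊆ z∈l)) P , here refl ∷ All.map there l⊆
  connecting-leaf conn u∈ z~u z∉ (there a∈) (here refl) with conn a∈ u∈
  ... | l , P , l⊆ = _ , path-snoc P (symm G z~u) (λ z∈l → z∉ (All.lookup l⊆ z∈l)) ,
    All.++⁺ (All.map there l⊆) (here refl ∷ [])
  connecting-leaf conn u∈ z~u z∉ (there a∈) (there b∈) with conn a∈ b∈
  ... | l , P , l⊆ = l , P , All.map there l⊆

  module _ (connected : Connected G)
    (c : Cycle G) (unique : ∀ d → SameCycle c d) where

    -- The place where uniqueness enters: the path and its closing edge form a cycle, which must
    -- have the same edges as `c`.
    closing-edge : ∀ {a b l} → SimplePath a b l → b ~ a → 3 ℕ.≤ length l → Cycle.Edge c a b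
    closing-edge P b~a 3≤ = Equivalence.from (unique (closed-path P b~a 3≤) _ _) (closed-path-edge P b~a 3≤)

    -- With a second neighbour in `L`, the vertex `v` would close a path of `L` to a cycle. Then `v`
    -- would lie on `c`, but all vertices of `c` are in `L`.
    leaf-of-growth : ∀ {L v u} → (∀ i → Cycle.vertex c i ∈ L) → Connecting L → Unique L →
      v ∉ L → u ∈ L → v ~ u → LeafAt v u L
    leaf-of-growth {L} {v} {u} core conn uniq v∉ u∈ v~u with ∈⇒↭ u∈
    ... | X , σ = leafAt σ v~u (All.tabulate λ {w} w∈X v~w → nonadjacent w∈X v~w)
      where
      nonadjacent : ∀ {w} → w ∈ X → v ≁ w
      nonadjacent {w} w∈X v~w with conn u∈ (∈-resp-↭ (↭-sym σ) (there w∈X))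
      ... | _ , stop , _ = head∉ (unique-↭ σ uniq) w∈X
      ... | l@(_ ∷ _ ∷ _) , P@(step _ _ _) , l⊆
        with closing-edge (step v~u (λ v∈l → v∉ (All.lookup l⊆ v∈l)) P) (symm G v~w) (s≤s (s≤s (s≤s z≤n)))
      ... | i , _ , _ , eq , _ = v∉ (subst (_∈ L) eq (core i))
      nonadjacent {w} w∈X v~w | _ ∷ [] , step _ _ () , _

    exit : ∀ {x y} L → x ∈ L → y ∉ L → Star _~_ x y → ∃₂ λ u v → u ∈ L × v ∉ L × u ~ v
    exit L x∈ y∉ stay = contradiction x∈ y∉
    exit L x∈ y∉ (_◅_ {j = z} x~z path) with z ∈? L
    ... | yes z∈ = exit L z∈ y∉ path
    ... | no z∉  = _ , z , x∈ , z∉ , x~z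

    grow : ∀ m {L R} → length R ≡ m → allFin n ↭ L ++ R → (∀ i → Cycle.vertex c i ∈ L) →
      Connecting L → Uni L → Uni (allFin n)
    grow zero    {L} {[]} _ σ core conn uni =
      uni-↭ (↭-trans σ (↭-reflexive (++-identityʳ L))) uni
    grow (suc m) {L} {r ∷ R} |R| σ core conn uni
      with exit L (core v₀) (λ r∈L → unique-++ L uniq r∈L (here refl)) (connected (Cycle.vertex c v₀) r)
      where
      v₀ : Fin (Cycle.len c)
      v₀ = fromℕ< (ℕ.≤-trans (s≤s z≤n) (Cycle.3≤len c))
      uniq : Unique (L ++ r ∷ R)
      uniq = unique-↭ σ (allFin⁺ n)
    ... | u , v , u∈ , v∉ , u~v with ∈-++⁻ L (∈-resp-↭ σ (∈-allFin v))
    ... | inj₁ v∈L = contradiction v∈L v∉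
    ... | inj₂ v∈R with ∈⇒↭ v∈R
    ... | R′ , ρ = grow m (ℕ.suc-injective (trans (sym (↭-length ρ)) |R|))
        (↭-trans σ (↭-trans (++⁺ˡ L ρ) (shift v L R′)))
        (there ∘ core) (connecting-leaf conn u∈ (symm G u~v) v∉)
        (leaf uni (leaf-of-growth core conn uniq-L v∉ u∈ (symm G u~v)) ↭-refl)
      where
      uniq-prefix : ∀ {A : Set} X {Y : List A} → Unique (X ++ Y) → Unique X
      uniq-prefix []      _        = []
      uniq-prefix (x ∷ X) (x≢ ∷ u) = All.++⁻ˡ X x≢ ∷ uniq-prefix X u
      uniq-L : Unique L
      uniq-L = uniq-prefix L (unique-↭ σ (allFin⁺ n))

  arc-∈⁺ : ∀ f i m {d} → d ℕ.< m → f (d ℕ.+ i) ∈ arc f i m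
  arc-∈⁺ f i (suc m) {zero}  _         = here refl
  arc-∈⁺ f i (suc m) {suc d} (s≤s d<m) =
    there (subst (λ t → f t ∈ arc f (suc i) m) (ℕ.+-suc d i) (arc-∈⁺ f (suc i) m d<m))

  module _ {k : ℕ} {f : ℕ → V} (distinct : ∀ i d → suc d ℕ.< k → f i ≢ f (suc d ℕ.+ i)) where

    arc-distinct : ∀ i m → m ℕ.< k → All (f i ≢_) (arc f (suc i) m)
    arc-distinct i m m<k = arc-All f (suc i) m λ d d<m →
      subst (λ t → f i ≢ f t) (sym (ℕ.+-suc d i)) (distinct i d (ℕ.≤-trans (s≤s d<m) m<k))

    arc-unique : ∀ i m → m ℕ.≤ k → Unique (arc f i m)
    arc-unique i zero    _   = []
    arc-unique i (suc m) m<k = arc-distinct i m m<k ∷ arc-unique (suc i) m (ℕ.<⇒≤ m<k)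

    arc-path : (∀ i → f i ~ f (suc i)) → ∀ i m → m ℕ.< k → SimplePath (f i) (f (m ℕ.+ i)) (arc f i (suc m))
    arc-path next i zero    _   = stop
    arc-path next i (suc m) m<k = step (next i)
      (λ fi∈ → All.lookup (arc-distinct i (suc m) m<k) fi∈ refl)
      (subst (λ t → SimplePath (f (suc i)) (f t) (arc f (suc i) (suc m))) (ℕ.+-suc m i)
        (arc-path next (suc i) m (ℕ.<⇒≤ m<k)))

  unicyclic⇒uni : Connected G → Unicyclic G → Uni (allFin n)
  unicyclic⇒uni connected (c@record { len = suc (suc (suc j)) } , unique) =
    build (unique-complement (arc f 0 k) (arc-unique {k} distinct 0 k ℕ.≤-refl)
      (All.tabulate λ {v} _ → ∈-allFin v))
    where
    open Cycle c using (vertex; injective; adjacent)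
    open StandardCycle j
    f : ℕ → V
    f = vertex ∘ residue
    distinct : ∀ i d → suc d ℕ.< k → f i ≢ f (suc d ℕ.+ i)
    distinct i d d<k eq = residue-distinct i d d<k (injective eq)
    next : ∀ i → f i ~ f (suc i)
    next i = adjacent _ _ (residue-next i)
    -- A chord closes the arc that it spans, so it would be an edge of `c` itself, which
    -- `residue-chord` excludes.
    chord : ∀ i d → d ℕ.< j → f i ≁ f (2 ℕ.+ d ℕ.+ i)
    chord i d d<j adj
      with closing-edge connected c unique
             (arc-path {k} distinct next i (2 ℕ.+ d) (s≤s (s≤s (ℕ.m≤n⇒m≤1+n d<j)))) (symm G adj) (s≤s (s≤s (s≤s z≤n)))
    ... | a , b , e , eqa , eqb = residue-chord i d d<j (subst₂ (Adj (C k)) (injective eqa) (injective eqb) e)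
    order : CyclicOrder j f
    order = record
      { periodic = λ i → cong vertex (residue-periodic i)
      ; next     = next
      ; last     = λ i → adjacent _ _ (residue-last i)
      ; chord    = chord
      }
    core : ∀ i → vertex i ∈ arc f 0 k
    core i = subst (_∈ arc f 0 k) (trans (cong f (ℕ.+-identityʳ (toℕ i))) (cong vertex (residue-toℕ i)))
      (arc-∈⁺ f 0 k (Fin.toℕ<n i))
    conn : Connecting (arc f 0 k)
    conn a∈ b∈ with arc-∈ f 0 k a∈ | arc-∈ f 0 k b∈
    ... | x , x<k , refl | y , y<k , refl rewrite ℕ.+-identityʳ x | ℕ.+-identityʳ y = go (x ℕ.≤? y)
      where
      inside-arc : ∀ i m → All (_∈ arc f 0 k) (arc f i m)
      inside-arc i m = arc-All f i m (λ d _ → core (residue (d ℕ.+ i)))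
      go : Dec (x ℕ.≤ y) → ∃ λ l → SimplePath (f x) (f y) l × All (_∈ arc f 0 k) l
      go (yes x≤y) = _ , subst (λ t → SimplePath (f x) (f t) (arc f x (suc (y ℕ.∸ x)))) (ℕ.m∸n+n≡m x≤y)
          (arc-path {k} distinct next x (y ℕ.∸ x) (ℕ.≤-<-trans (ℕ.m∸n≤m y x) y<k)) ,
        inside-arc x (suc (y ℕ.∸ x))
      -- Here `y` precedes `x`, so the arc runs on past the starting point up to `y ℕ.+ k`.
      go (no x≰y) = _ , subst (λ v → SimplePath (f x) v (arc f x (suc (y ℕ.+ k ℕ.∸ x))))
          (trans (cong f (ℕ.m∸n+n≡m x≤y+k)) (cong vertex (residue-periodic y)))
          (arc-path {k} distinct next x (y ℕ.+ k ℕ.∸ x) m<k) ,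
        inside-arc x (suc (y ℕ.+ k ℕ.∸ x))
        where
        x≤y+k : x ℕ.≤ y ℕ.+ k
        x≤y+k = ℕ.≤-trans (ℕ.<⇒≤ x<k) (ℕ.m≤n+m k y)
        m<k : y ℕ.+ k ℕ.∸ x ℕ.< k
        m<k = ℕ.+-cancelʳ-< x (y ℕ.+ k ℕ.∸ x) k (subst (ℕ._< k ℕ.+ x) (sym (ℕ.m∸n+n≡m x≤y+k))
          (subst (y ℕ.+ k ℕ.<_) (ℕ.+-comm x k) (ℕ.+-monoˡ-< k (ℕ.≰⇒> x≰y))))
    build : (∃ λ R → allFin n ↭ arc f 0 k ++ R) → Uni (allFin n)
    build (R , σ) = grow connected c unique (length R) refl σ core conn (cycle order ↭-refl)
  unicyclic⇒uni connected (record { len = 0 ; 3≤len = () } , _)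
  unicyclic⇒uni connected (record { len = 1 ; 3≤len = s≤s () } , _)
  unicyclic⇒uni connected (record { len = 2 ; 3≤len = s≤s (s≤s ()) } , _)

-- Recognising Cₙ, Dₙ and Uₙ

complete : ∀ {n} {L : List (Fin n)} → Unique L → length L ≡ n → allFin n ↭ L
complete {n} {L} u |L| with unique-complement L u (All.tabulate λ {v} _ → ∈-allFin v)
... | [] , σ    = ↭-trans σ (↭-reflexive (++-identityʳ L))
... | r ∷ R , σ = contradiction
  (trans (sym (length-tabulate {n = n} id)) (trans (↭-length σ)
    (trans (length-++ L) (trans (cong (ℕ._+ length (r ∷ R)) |L|) (ℕ.+-suc n (length R))))))
  (ℕ.m≢1+m+n n)

module Isomorphisms {n : ℕ} (G : Graph n) where
  open Independence G using (V; _~_; _≁_; ≁-sym)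
  open Shapes G
  open StarBound G using (OneEdge)
  open Decomposition G using (unicyclic⇒uni)

  adjacency-iso : ∀ {m} (H : Graph m) (φ : Fin m → V) (ψ : V → Fin m) →
    (∀ {i j} → φ i ≡ φ j → i ≡ j) → (∀ v → φ (ψ v) ≡ v) →
    (∀ i j → φ i ~ φ j ⇔ Adj H i j) → G ≅ H
  adjacency-iso H φ ψ φ-inj φψ spec = record
    { bijection = mk↔ₛ′ ψ φ (λ i → φ-inj (φψ (φ i))) φψ
    ; adj-⇔     = λ u v → subst₂ (λ a b → a ~ b ⇔ Adj H (ψ u) (ψ v)) (φψ u) (φψ v) (spec (ψ u) (ψ v))
    }

  by-order : ∀ {m} (H : Graph m) (φ : Fin m → V) (θ : Fin m → Fin m) →
    (∀ i j → toℕ i ℕ.< toℕ j → φ i ~ φ j ⇔ Adj H (θ i) (θ j)) →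
    ∀ i j → φ i ~ φ j ⇔ Adj H (θ i) (θ j)
  by-order H φ θ spec i j with ℕ.<-cmp (toℕ i) (toℕ j)
  ... | tri< lt _ _ = spec i j lt
  ... | tri> _ _ gt = mk⇔ (symm H ∘ Equivalence.to (spec j i gt) ∘ symm G)
                          (symm G ∘ Equivalence.from (spec j i gt) ∘ symm H)
  ... | tri≈ _ eq _ with Fin.toℕ-injective eq
  ... | refl = mk⇔ (λ a → contradiction a (irrefl G refl)) (λ a → contradiction a (irrefl H refl))

  cycle-iso : IsCycle (allFin n) → G ≅ C n
  cycle-iso (j , c , order , σ) = subst (λ m → G ≅ C m) k≡n
    (adjacency-iso (C k) φ ψ φ-inj φψ (by-order (C k) φ id spec))
    where
    open CyclicOrder order
    k = 3 ℕ.+ j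
    k≡n : k ≡ n
    k≡n = trans (sym (arc-length c 0 k)) (trans (sym (↭-length σ)) (length-tabulate {n = n} id))
    φ : Fin k → V
    φ i = c (toℕ i)
    on-arc : ∀ v → ∃ λ d → d ℕ.< k × v ≡ c (d ℕ.+ 0)
    on-arc v = arc-∈ c 0 k (∈-resp-↭ σ (∈-allFin v))
    ψ : V → Fin k
    ψ v = fromℕ< (proj₁ (proj₂ (on-arc v)))
    φψ : ∀ v → φ (ψ v) ≡ v
    φψ v = trans (cong c (trans (Fin.toℕ-fromℕ< _) (sym (ℕ.+-identityʳ _)))) (sym (proj₂ (proj₂ (on-arc v))))
    arc-injective : ∀ i m {x y} → Unique (arc c i m) → x ℕ.< y → y ℕ.< m → c (x ℕ.+ i) ≢ c (y ℕ.+ i)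
    arc-injective i (suc m) {zero} {suc y} (ci≢ ∷ _) _ (s≤s y<m) eq = All.lookup ci≢
      (subst (_∈ arc c (suc i) m) (cong c (ℕ.+-suc y i)) (Decomposition.arc-∈⁺ G c (suc i) m y<m)) eq
    arc-injective i (suc m) {suc x} {suc y} (_ ∷ u) (s≤s x<y) (s≤s y<m) eq = arc-injective (suc i) m u x<y y<m
      (trans (cong c (ℕ.+-suc x i)) (trans eq (cong c (sym (ℕ.+-suc y i)))))
    φ-≢ : ∀ i j → toℕ i ℕ.< toℕ j → φ i ≢ φ j
    φ-≢ i j i<j eq = arc-injective 0 k (unique-↭ σ (allFin⁺ n)) i<j (Fin.toℕ<n j)
      (trans (cong c (ℕ.+-identityʳ (toℕ i))) (trans eq (cong c (sym (ℕ.+-identityʳ (toℕ j))))))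
    φ-inj : ∀ {i j} → φ i ≡ φ j → i ≡ j
    φ-inj {i} {j} eq with ℕ.<-cmp (toℕ i) (toℕ j)
    ... | tri< lt _ _ = contradiction eq (φ-≢ i j lt)
    ... | tri≈ _ e _  = Fin.toℕ-injective e
    ... | tri> _ _ gt = contradiction (sym eq) (φ-≢ j i gt)
    spec : ∀ x y → toℕ x ℕ.< toℕ y → φ x ~ φ y ⇔ Adj (C k) x y
    spec x y x<y = mk⇔ (to (toℕ y ℕ.∸ toℕ x) refl) from
      where
      x≢y : x ≢ y
      x≢y refl = ℕ.<-irrefl refl x<y
      y≡ : toℕ y ≡ toℕ y ℕ.∸ toℕ x ℕ.+ toℕ x
      y≡ = sym (ℕ.m∸n+n≡m (ℕ.<⇒≤ x<y))
      to : ∀ d → d ≡ toℕ y ℕ.∸ toℕ x → φ x ~ φ y → Adj (C k) x y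
      to zero eq _ = contradiction (trans y≡ (cong (ℕ._+ toℕ x) (sym eq))) (ℕ.<⇒≢ x<y ∘ sym)
      to (suc zero) eq _ = x≢y , inj₁ (inj₁ (sym (trans y≡ (cong (ℕ._+ toℕ x) (sym eq)))))
      to (suc (suc d)) eq x~y with d ℕ.<? j
      ... | yes d<j = contradiction (subst (λ t → c (toℕ x) ~ c t) (trans y≡ (cong (ℕ._+ toℕ x) (sym eq))) x~y)
                        (chord (toℕ x) d d<j)
      -- The distance exceeds that of every chord while `y` is still below `k`. So it is `2 ℕ.+ j`,
      -- with `x` the first and `y` the last vertex.
      ... | no d≮j  = x≢y , inj₁ (inj₂ (x≡0 , cong suc (trans y≡′
          (trans (cong₂ (λ a b → 2 ℕ.+ a ℕ.+ b) d≡j x≡0) (ℕ.+-identityʳ (2 ℕ.+ j))))))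
        where
        y≡′ : toℕ y ≡ 2 ℕ.+ d ℕ.+ toℕ x
        y≡′ = trans y≡ (cong (ℕ._+ toℕ x) (sym eq))
        d+x≤j : d ℕ.+ toℕ x ℕ.≤ j
        d+x≤j = ℕ.≤-pred (ℕ.≤-pred (ℕ.≤-pred (subst (ℕ._< k) y≡′ (Fin.toℕ<n y))))
        d≡j : d ≡ j
        d≡j = ℕ.≤-antisym (ℕ.≤-trans (ℕ.m≤m+n d (toℕ x)) d+x≤j) (ℕ.≮⇒≥ d≮j)
        x≡0 : toℕ x ≡ 0
        x≡0 = ℕ.n≤0⇒n≡0 (ℕ.+-cancelˡ-≤ d (toℕ x) 0
          (ℕ.≤-trans d+x≤j (ℕ.≤-reflexive (trans (sym d≡j) (sym (ℕ.+-identityʳ d))))))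
      from : Adj (C k) x y → φ x ~ φ y
      from (_ , inj₁ (inj₁ e)) = subst (λ t → c (toℕ x) ~ c t) e (next (toℕ x))
      from (_ , inj₁ (inj₂ (e , e′))) = subst₂ (λ s t → c s ~ c t) (sym e)
        (trans (ℕ.+-identityʳ (2 ℕ.+ j)) (sym (ℕ.suc-injective e′))) (last 0)
      from (_ , inj₂ (inj₁ e)) = contradiction (ℕ.≤-trans (ℕ.n≤1+n (toℕ y)) (ℕ.≤-reflexive e)) (ℕ.<⇒≱ x<y)
      from (_ , inj₂ (inj₂ (e , _))) with () ← subst (toℕ x ℕ.<_) e x<y

  module _ {l : List V} (σ : allFin n ↭ l) where

    private
      position : ∀ v → v ∈ l
      position v = ∈-resp-↭ σ (∈-allFin v)

      ψ : V → Fin (length l)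
      ψ v = Any.index (position v)

      lookup-injective : ∀ {i j} → lookup l i ≡ lookup l j → i ≡ j
      lookup-injective = unique-lookup (unique-↭ σ (allFin⁺ n))

    list-iso : (H : Graph (length l)) → (∀ i j → lookup l i ~ lookup l j ⇔ Adj H i j) → G ≅ H
    list-iso H = adjacency-iso H (lookup l) ψ lookup-injective (λ v → sym (lookup-index (position v)))

    -- `DList` begins at the end of the path, whereas `D` numbers the triangle first.
    list-iso-opposite : (H : Graph (length l)) →
      (∀ i j → lookup l i ~ lookup l j ⇔ Adj H (opposite i) (opposite j)) → G ≅ H
    list-iso-opposite H spec = adjacency-iso H (lookup l ∘ opposite) (opposite ∘ ψ)
      (λ eq → opposite-injective (lookup-injective eq))
      (λ v → trans (cong (lookup l) (Fin.opposite-involutive (ψ v))) (sym (lookup-index (position v))))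
      (λ i j → subst₂ (λ a b → lookup l (opposite i) ~ lookup l (opposite j) ⇔ Adj H a b)
        (Fin.opposite-involutive i) (Fin.opposite-involutive j) (spec (opposite i) (opposite j)))
      where
      opposite-injective : ∀ {m} {i j : Fin m} → opposite i ≡ opposite j → i ≡ j
      opposite-injective {i = i} {j} eq = trans (sym (Fin.opposite-involutive i))
        (trans (cong opposite eq) (Fin.opposite-involutive j))

    length-≡ : length l ≡ n
    length-≡ = trans (sym (↭-length σ)) (length-tabulate {n = n} id)

  dlist-length : ∀ {l} → DList l → 3 ℕ.≤ length l
  dlist-length (triangle _ _ _) = s≤s (s≤s (s≤s z≤n))
  dlist-length (extend _ _ d)   = ℕ.m≤n⇒m≤1+n (dlist-length d)

  private
    height : ∀ {m} → Fin m → ℕ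
    height i = toℕ (opposite i)

    height-suc : ∀ {m} (i : Fin m) → height (suc i) ≡ height i
    height-suc = Fin.opposite-suc

    height-zero : ∀ m → height (zero {m}) ≡ m
    height-zero m = Fin.toℕ-fromℕ m

    DEdge : ℕ → ℕ → Set
    DEdge x y = suc x ≡ y ⊎ (x ≡ 0 × y ≡ 2)

    dlist-spec : ∀ {l} → DList l → ∀ i j → toℕ i ℕ.< toℕ j → lookup l i ~ lookup l j ⇔ DEdge (height j) (height i)
    dlist-spec (triangle a~b a~c b~c) zero (suc zero) _ = mk⇔ (λ _ → inj₁ refl) (λ _ → a~b)
    dlist-spec (triangle a~b a~c b~c) zero (suc (suc zero)) _ = mk⇔ (λ _ → inj₂ (refl , refl)) (λ _ → a~c)
    dlist-spec (triangle a~b a~c b~c) (suc zero) (suc (suc zero)) _ = mk⇔ (λ _ → inj₁ refl) (λ _ → b~c)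
    dlist-spec (triangle a~b a~c b~c) (suc (suc zero)) (suc zero) (s≤s ())
    dlist-spec (triangle a~b a~c b~c) (suc zero) (suc zero) (s≤s ())
    dlist-spec (triangle a~b a~c b~c) (suc (suc zero)) (suc (suc zero)) (s≤s (s≤s ()))
    dlist-spec (extend {l = l} x~y x≁ d) zero (suc zero) _ = mk⇔
      (λ _ → inj₁ (trans (cong suc (trans (height-suc {suc (length l)} zero) (height-zero (length l))))
               (sym (height-zero (suc (length l))))))
      (λ _ → x~y)
    dlist-spec (extend {l = l} x~y x≁ d) zero (suc (suc j)) _ = mk⇔
      (λ x~ → contradiction x~ (All.lookup x≁ (∈-lookup j)))
      (λ e → contradiction e (no-edge ∘
        subst₂ DEdge (trans (height-suc (suc j)) (height-suc j)) (height-zero (suc (length l)))))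
      where
      no-edge : ¬ DEdge (height j) (suc (length l))
      no-edge (inj₁ e) = ℕ.<⇒≢ (Fin.toℕ<n (opposite j)) (ℕ.suc-injective e)
      no-edge (inj₂ (_ , e)) with s≤s (s≤s ()) ← subst (3 ℕ.≤_) e (dlist-length d)
    dlist-spec (extend {y = y} {l} x~y x≁ d) (suc i) (suc j) (s≤s i<j) =
      subst₂ (λ a b → lookup (y ∷ l) i ~ lookup (y ∷ l) j ⇔ DEdge a b)
        (sym (height-suc j)) (sym (height-suc i)) (dlist-spec d i j i<j)

  dshape-iso : ∀ {v} → DShape (allFin n) v → G ≅ D n
  dshape-iso {v} (l , σ , d) = subst (λ m → G ≅ D m) (length-≡ σ)
    (list-iso-opposite σ (D m) (by-order (D m) (lookup (v ∷ l)) opposite forward))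
    where
    m = length (v ∷ l)
    forward : ∀ i j → toℕ i ℕ.< toℕ j → lookup (v ∷ l) i ~ lookup (v ∷ l) j ⇔ Adj (D m) (opposite i) (opposite j)
    forward i j i<j = mk⇔
      (λ a → distinct , inj₂ (Equivalence.to (dlist-spec d i j i<j) a))
      (λ { (_ , inj₂ e) → Equivalence.from (dlist-spec d i j i<j) e
         ; (_ , inj₁ (inj₁ e)) → contradiction (ℕ.<-trans below (ℕ.≤-reflexive e)) (ℕ.<-irrefl refl)
         ; (_ , inj₁ (inj₂ (e , _))) → contradiction (subst (height j ℕ.<_) e below) (λ ()) })
      where
      below : height j ℕ.< height i
      below = subst₂ ℕ._<_ (sym (Fin.opposite-prop j)) (sym (Fin.opposite-prop i))
        (ℕ.∸-monoʳ-< (s≤s i<j) (Fin.toℕ<n j))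
      distinct : opposite i ≢ opposite j
      distinct eq = ℕ.<⇒≢ below (cong toℕ (sym eq))

  private
    pairs-lookup : ∀ {S} → AllPairs _≁_ S → ∀ i j → lookup S i ≁ lookup S j
    pairs-lookup (x≁ ∷ ps) zero    zero    = irrefl G refl
    pairs-lookup (x≁ ∷ ps) zero    (suc j) = All.lookup x≁ (∈-lookup j)
    pairs-lookup (x≁ ∷ ps) (suc i) zero    = ≁-sym (All.lookup x≁ (∈-lookup i))
    pairs-lookup (x≁ ∷ ps) (suc i) (suc j) = pairs-lookup ps i j

  star-iso : ∀ {u a b S} → allFin n ↭ u ∷ a ∷ b ∷ S → All (u ~_) (a ∷ b ∷ S) → a ~ b →
    All (a ≁_) S → All (b ≁_) S → AllPairs _≁_ S → G ≅ U n
  star-iso {u} {a} {b} {S} σ u~ a~b a≁ b≁ ps = subst (λ m → G ≅ U m) (length-≡ σ)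
    (list-iso σ (U m) (by-order (U m) (lookup l) id spec))
    where
    l = u ∷ a ∷ b ∷ S
    m = length l
    spec : ∀ i j → toℕ i ℕ.< toℕ j → lookup l i ~ lookup l j ⇔ Adj (U m) i j
    spec zero (suc j) _ = mk⇔ (λ _ → (λ ()) , inj₁ (inj₁ refl)) (λ _ → All.lookup u~ (∈-lookup j))
    spec (suc zero) (suc (suc zero)) _ = mk⇔ (λ _ → (λ ()) , inj₁ (inj₂ (refl , refl))) (λ _ → a~b)
    spec (suc zero) (suc (suc (suc j))) _ = mk⇔ (λ e → contradiction e (All.lookup a≁ (∈-lookup j)))
      λ { (_ , inj₁ (inj₁ ())) ; (_ , inj₁ (inj₂ (_ , ()))) ; (_ , inj₂ (inj₁ ())) ; (_ , inj₂ (inj₂ (() , _))) }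
    spec (suc (suc zero)) (suc (suc (suc j))) _ = mk⇔ (λ e → contradiction e (All.lookup b≁ (∈-lookup j)))
      λ { (_ , inj₁ (inj₁ ())) ; (_ , inj₁ (inj₂ (() , _))) ; (_ , inj₂ (inj₁ ())) ; (_ , inj₂ (inj₂ (() , _))) }
    spec (suc (suc (suc i))) (suc (suc (suc j))) _ = mk⇔ (λ e → contradiction e (pairs-lookup ps i j))
      λ { (_ , inj₁ (inj₁ ())) ; (_ , inj₁ (inj₂ (() , _))) ; (_ , inj₂ (inj₁ ())) ; (_ , inj₂ (inj₂ (() , _))) }
    spec (suc zero) (suc zero) (s≤s ())
    spec (suc (suc i)) (suc zero) (s≤s ())
    spec (suc (suc zero)) (suc (suc zero)) (s≤s (s≤s ()))
    spec (suc (suc (suc i))) (suc (suc zero)) (s≤s (s≤s ()))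

  -- An endless walk around the cycle that never turns back. It cannot visit a vertex with a single
  -- neighbour and cannot stay within two vertices.
  record ClosedWalk : Set where
    field
      at    : ℕ → V
      next  : ∀ i → at i ~ at (suc i)
      skip  : ∀ i → at i ≢ at (2 ℕ.+ i)

  closedWalk : Cycle G → ClosedWalk
  closedWalk c@record { len = suc (suc (suc j)) } = record
    { at   = vertex ∘ residue
    ; next = λ i → adjacent _ _ (residue-next i)
    ; skip = λ i eq → residue-distinct i 1 (s≤s (s≤s (s≤s z≤n))) (injective eq)
    }
    where
    open Cycle c using (vertex; injective; adjacent)
    open StandardCycle j
  closedWalk record { len = 0 ; 3≤len = () }
  closedWalk record { len = 1 ; 3≤len = s≤s () }
  closedWalk record { len = 2 ; 3≤len = s≤s (s≤s ()) }

  -- Connectedness joins each vertex of `E` to `u`, since it has no other possible neighbour. The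
  -- vertices of `E` and `z` are pendant, so the cycle stays within `u`, `a` and `b`; if `a` or `b`
  -- were not adjacent to `u`, it would be pendant as well and only two vertices would be left.
  one-edge-iso : Connected G → Cycle G → ∀ {z u L} → allFin n ↭ z ∷ L → (l : LeafAt z u L) →
    OneEdge (LeafAt.others l) → G ≅ U n
  one-edge-iso connected c {z} {u} {L} σ (leafAt {X} τ z~u z≁X) (a , b , E , π , a~b , a≁E , b≁E , ps) =
    star-iso σ′ (symm G a~u ∷ symm G b~u ∷ symm G z~u ∷ All.tabulate (λ x∈E → symm G (E~u x∈E)))
      a~b (≁-sym z≁a ∷ a≁E) (≁-sym z≁b ∷ b≁E) (z≁E ∷ ps)
    where
    σ₀ : allFin n ↭ z ∷ u ∷ a ∷ b ∷ E
    σ₀ = ↭-trans σ (prep z (↭-trans τ (prep u π)))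
    σ′ : allFin n ↭ u ∷ a ∷ b ∷ z ∷ E
    σ′ = ↭-trans σ₀ (↭-sym (shift z (u ∷ a ∷ b ∷ []) E))
    z≁abE : All (z ≁_) (a ∷ b ∷ E)
    z≁abE = All-resp-↭ π z≁X
    z≁a = All.head z≁abE
    z≁b = All.head (All.tail z≁abE)
    z≁E = All.tail (All.tail z≁abE)
    uniq : Unique (u ∷ a ∷ b ∷ z ∷ E)
    uniq = unique-↭ σ′ (allFin⁺ n)

    data Position (v : V) : Set where
      is-z : v ≡ z → Position v
      is-u : v ≡ u → Position v
      is-a : v ≡ a → Position v
      is-b : v ≡ b → Position v
      in-E : v ∈ E → Position v

    position : ∀ v → Position v
    position v with ∈-resp-↭ σ₀ (∈-allFin v)
    ... | here e                              = is-z e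
    ... | there (here e)                      = is-u e
    ... | there (there (here e))              = is-a e
    ... | there (there (there (here e)))      = is-b e
    ... | there (there (there (there v∈E)))   = in-E v∈E

    E-neighbour : ∀ {x w} → x ∈ E → x ~ w → w ≡ u
    E-neighbour {x} {w} x∈E x~w with position w
    ... | is-z refl = contradiction (symm G x~w) (All.lookup z≁E x∈E)
    ... | is-u e    = e
    ... | is-a refl = contradiction (symm G x~w) (All.lookup a≁E x∈E)
    ... | is-b refl = contradiction (symm G x~w) (All.lookup b≁E x∈E)
    ... | in-E w∈E  = contradiction x~w (subst₂ _≁_ (sym (lookup-index x∈E)) (sym (lookup-index w∈E))
                        (pairs-lookup ps (Any.index x∈E) (Any.index w∈E)))

    z-neighbour : ∀ {w} → z ~ w → w ≡ u
    z-neighbour {w} z~w with ∈-resp-↭ τ′ (∈-allFin w)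
      where
      τ′ : allFin n ↭ z ∷ u ∷ X
      τ′ = ↭-trans σ (prep z τ)
    ... | here refl         = contradiction z~w (irrefl G refl)
    ... | there (here e)    = e
    ... | there (there w∈X) = contradiction z~w (All.lookup z≁X w∈X)

    E~u : ∀ {x} → x ∈ E → x ~ u
    E~u {x} x∈E with connected x u
    ... | stay      = contradiction (there (there (there x∈E))) (head∉ uniq)
    ... | x~w ◅ _ = subst (x ~_) (E-neighbour x∈E x~w) x~w

    open ClosedWalk (closedWalk c)

    not-pendant : ∀ {x y} → (∀ {w} → x ~ w → w ≡ y) → ∀ i → at (suc i) ≢ x
    not-pendant only i refl = skip i (trans (only (symm G (next i))) (sym (only (next (suc i)))))

    not-two : ∀ {s t} → (∀ i → at (suc i) ≡ s ⊎ at (suc i) ≡ t) → ¬ V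
    not-two two _ with two 0 | two 1 | two 2
    ... | inj₁ e | _      | inj₁ e′ = skip 1 (trans e (sym e′))
    ... | inj₂ e | _      | inj₂ e′ = skip 1 (trans e (sym e′))
    ... | inj₁ e | inj₁ e′ | _ = irrefl G (trans e (sym e′)) (next 1)
    ... | inj₂ e | inj₂ e′ | _ = irrefl G (trans e (sym e′)) (next 1)
    ... | _ | inj₁ e | inj₁ e′ = irrefl G (trans e (sym e′)) (next 2)
    ... | _ | inj₂ e | inj₂ e′ = irrefl G (trans e (sym e′)) (next 2)

    on-walk : ∀ i → at (suc i) ≡ u ⊎ at (suc i) ≡ a ⊎ at (suc i) ≡ b
    on-walk i with position (at (suc i))
    ... | is-z e   = contradiction e (not-pendant z-neighbour i)
    ... | is-u e   = inj₁ e
    ... | is-a e   = inj₂ (inj₁ e)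
    ... | is-b e   = inj₂ (inj₂ e)
    ... | in-E ∈E = contradiction refl (not-pendant (E-neighbour ∈E) i)

    a~u : a ~ u
    a~u with adj? G a u
    ... | yes e = e
    ... | no a≁u = contradiction u (not-two {u} {b} λ i → pick i (on-walk i))
      where
      only-b : ∀ {w} → a ~ w → w ≡ b
      only-b {w} a~w with position w
      ... | is-z refl = contradiction (symm G a~w) z≁a
      ... | is-u refl = contradiction a~w a≁u
      ... | is-a refl = contradiction a~w (irrefl G refl)
      ... | is-b e    = e
      ... | in-E w∈E  = contradiction a~w (All.lookup a≁E w∈E)
      pick : ∀ i → at (suc i) ≡ u ⊎ at (suc i) ≡ a ⊎ at (suc i) ≡ b → at (suc i) ≡ u ⊎ at (suc i) ≡ b
      pick i (inj₁ e)        = inj₁ e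
      pick i (inj₂ (inj₁ e)) = contradiction e (not-pendant only-b i)
      pick i (inj₂ (inj₂ e)) = inj₂ e

    b~u : b ~ u
    b~u with adj? G b u
    ... | yes e = e
    ... | no b≁u = contradiction u (not-two {u} {a} λ i → pick i (on-walk i))
      where
      only-a : ∀ {w} → b ~ w → w ≡ a
      only-a {w} b~w with position w
      ... | is-z refl = contradiction (symm G b~w) z≁b
      ... | is-u refl = contradiction b~w b≁u
      ... | is-a e    = e
      ... | is-b refl = contradiction b~w (irrefl G refl)
      ... | in-E w∈E  = contradiction b~w (All.lookup b≁E w∈E)
      pick : ∀ i → at (suc i) ≡ u ⊎ at (suc i) ≡ a ⊎ at (suc i) ≡ b → at (suc i) ≡ u ⊎ at (suc i) ≡ a
      pick i (inj₁ e)        = inj₁ e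
      pick i (inj₂ (inj₁ e)) = inj₂ e
      pick i (inj₂ (inj₂ e)) = contradiction e (not-pendant only-a i)

ind-C : ∀ j {p} → 0ℚ < p → Independence.ind (C (3 ℕ.+ j)) p (allFin (3 ℕ.+ j)) ≡ Recurrence.cy p (3 ℕ.+ j)
ind-C j {p} 0<p = Comparison.ind-cycle (C k) p 0<p order
  (complete (Decomposition.arc-unique (C k) {k} {residue} residue-distinct 0 k ℕ.≤-refl)
    (Shapes.arc-length (C k) residue 0 k))
  where
  open StandardCycle j
  order : Shapes.CyclicOrder (C k) j residue
  order = record
    { periodic = residue-periodic ; next = residue-next ; last = residue-last ; chord = residue-chord }

module _ (j : ℕ) where
  private
    H = U (3 ℕ.+ j)
    open Independence H

    outer : Fin j → V
    outer i = suc (suc (suc i))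

    leaves : List V
    leaves = tabulate outer

    one two : V
    one = suc zero
    two = suc (suc zero)

    one~two : one ~ two
    one~two = (λ ()) , inj₁ (inj₂ (refl , refl))

    centre~ : ∀ i → zero ~ suc i
    centre~ i = (λ ()) , inj₁ (inj₁ refl)

    one≁ : All (one ≁_) leaves
    one≁ = All.tabulate⁺ {f = outer} λ i → λ
      { (_ , inj₁ (inj₁ ())) ; (_ , inj₁ (inj₂ (_ , ()))) ; (_ , inj₂ (inj₁ ())) ; (_ , inj₂ (inj₂ (() , _))) }

    two≁ : All (two ≁_) leaves
    two≁ = All.tabulate⁺ {f = outer} λ i → λ
      { (_ , inj₁ (inj₁ ())) ; (_ , inj₁ (inj₂ (() , _))) ; (_ , inj₂ (inj₁ ())) ; (_ , inj₂ (inj₂ (() , _))) }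

    leaves≁ : AllPairs _≁_ leaves
    leaves≁ = AllPairs.tabulate⁺ {f = outer} λ _ → λ
      { (_ , inj₁ (inj₁ ())) ; (_ , inj₁ (inj₂ (() , _))) ; (_ , inj₂ (inj₁ ())) ; (_ , inj₂ (inj₂ (() , _))) }

    away-all : ∀ {v} X → All (v ~_) X → away v X ≡ []
    away-all []      []         = refl
    away-all (x ∷ X) (v~x ∷ v~) = trans (away-adj X v~x) (away-all X v~)

    ind-edgeless : ∀ p {E} → AllPairs _≁_ E → ind p E ≡ (1ℚ - p) ^ length E
    ind-edgeless p []            = ind-[] p
    ind-edgeless p (none ∷ rest) = trans (ind-∷-none p none) (cong ((1ℚ - p) *_) (ind-edgeless p rest))

    ind-edge : ∀ p {E} → All (one ≁_) E → All (two ≁_) E → ind p (one ∷ two ∷ E) ≡ (1ℚ - p - p) * ind p E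
    ind-edge p {E} one≁E two≁E = trans (ind-∷ p one (two ∷ E))
      (trans (cong₂ (λ x Y → x - p * ind p Y) (ind-∷-none p two≁E) (trans (away-adj E one~two) (away-none one≁E)))
        (solve 2 (λ p x → (con 1ℚ :- p) :* x :- p :* x := (con 1ℚ :- p :- p) :* x) refl p (ind p E)))

  ind-U : ∀ p → ind p (allFin (3 ℕ.+ j)) ≡ us p j
  ind-U p = trans (ind-∷ p zero (one ∷ two ∷ leaves))
    (trans (cong₂ (λ x Y → x - p * ind p Y)
             (trans (ind-edge p one≁ two≁)
               (cong ((1ℚ - p - p) *_) (trans (ind-edgeless p leaves≁) (cong ((1ℚ - p) ^_) (length-tabulate outer)))))
             (away-all (one ∷ two ∷ leaves) (All.tabulate⁺ {n = 2 ℕ.+ j} centre~)))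
      (trans (cong (λ t → (1ℚ - p - p) * (1ℚ - p) ^ j - p * t) (ind-[] p))
        (solve 2 (λ p x → (con 1ℚ :- p :- p) :* x :- p :* con 1ℚ := x :* (con 1ℚ :- p :- p) :- p)
          refl p ((1ℚ - p) ^ j))))

  -- The two triangle vertices other than the centre induce an edge.
  pos-U-edge : ∀ {p} → Pos p (allFin (3 ℕ.+ j)) → 0ℚ < 1ℚ - p - p
  pos-U-edge {p} pos = subst (0ℚ <_)
    (trans (ind-edge p [] []) (trans (cong ((1ℚ - p - p) *_) (ind-[] p)) (ℚ.*-identityʳ (1ℚ - p - p))))
    (pos {H = one ∷ two ∷ []} {R = zero ∷ leaves} (↭-sym (shift zero (one ∷ two ∷ []) leaves)))

-- Evaluation of the independence polynomial

Σ̂ : ∀ {m} → (Fin m → ℚ) → ℚ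
Σ̂ {zero}  f = 0ℚ
Σ̂ {suc m} f = f zero + Σ̂ (f ∘ suc)

Σ̂-cong : ∀ {m} {f g : Fin m → ℚ} → (∀ i → f i ≡ g i) → Σ̂ f ≡ Σ̂ g
Σ̂-cong {zero}  eq = refl
Σ̂-cong {suc m} eq = cong₂ _+_ (eq zero) (Σ̂-cong (eq ∘ suc))

Σ̂-zero : ∀ m {f : Fin m → ℚ} → (∀ i → f i ≡ 0ℚ) → Σ̂ f ≡ 0ℚ
Σ̂-zero zero    eq = refl
Σ̂-zero (suc m) eq = trans (cong₂ _+_ (eq zero) (Σ̂-zero m (eq ∘ suc))) (ℚ.+-identityˡ 0ℚ)

-- For `weight-by-size`, where one more set raises exactly one coefficient by one.
Σ̂-bump : ∀ {m} (f g : Fin m → ℚ) x i → f i ≡ x + g i → (∀ j → j ≢ i → f j ≡ g j) → Σ̂ f ≡ x + Σ̂ g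
Σ̂-bump f g x zero eq same = trans
  (cong₂ _+_ eq (Σ̂-cong (λ j → same (suc j) (λ ())))) (ℚ.+-assoc x (g zero) (Σ̂ (g ∘ suc)))
Σ̂-bump f g x (suc i) eq same = trans
  (cong₂ _+_ (same zero (λ ())) (Σ̂-bump (f ∘ suc) (g ∘ suc) x i eq
    (λ j j≢i → same (suc j) (j≢i ∘ Fin.suc-injective))))
  (solve 3 (λ a b c → a :+ (b :+ c) := b :+ (a :+ c)) refl (g zero) x (Σ̂ (g ∘ suc)))

neg-involutive : ∀ q → - - q ≡ q
neg-involutive = solve 1 (λ q → :- (:- q) := q) refl

module _ (q : ℚ) where

  weight : ∀ {m} → List (Subset m) → ℚ
  weight []       = 0ℚ
  weight (S ∷ Ss) = q ^ Subset.∣ S ∣ + weight Ss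

  weight-++ : ∀ {m} (Ss Ts : List (Subset m)) → weight (Ss ++ Ts) ≡ weight Ss + weight Ts
  weight-++ []       Ts = sym (ℚ.+-identityˡ (weight Ts))
  weight-++ (S ∷ Ss) Ts = trans (cong (q ^ Subset.∣ S ∣ +_) (weight-++ Ss Ts))
    (sym (ℚ.+-assoc (q ^ Subset.∣ S ∣) (weight Ss) (weight Ts)))

  weight-outside : ∀ {m} (Ss : List (Subset m)) → weight (map (outside ∷_) Ss) ≡ weight Ss
  weight-outside []       = refl
  weight-outside (S ∷ Ss) = cong (q ^ Subset.∣ S ∣ +_) (weight-outside Ss)

  weight-inside : ∀ {m} (Ss : List (Subset m)) → weight (map (inside ∷_) Ss) ≡ q * weight Ss
  weight-inside []       = sym (ℚ.*-zeroʳ q)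
  weight-inside (S ∷ Ss) = trans (cong (q * q ^ Subset.∣ S ∣ +_) (weight-inside Ss))
    (sym (ℚ.*-distribˡ-+ q (q ^ Subset.∣ S ∣) (weight Ss)))

  weight-by-size : ∀ {m} {P : Pred (Subset m) 0ℓ} (P? : Decidable P) Ss →
    Σ̂ {suc m} (λ k → times (length (filter (λ S → P? S ×-dec (Subset.∣ S ∣ ℕ.≟ toℕ k)) Ss)) (q ^ toℕ k)) ≡
    weight (filter P? Ss)
  weight-by-size {m} {P} P? = go
    where
    Q? : ∀ k → Decidable (λ S → P S × Subset.∣ S ∣ ≡ k)
    Q? k S = P? S ×-dec (Subset.∣ S ∣ ℕ.≟ k)
    term : List (Subset m) → Fin (suc m) → ℚ
    term Ss k = times (length (filter (Q? (toℕ k)) Ss)) (q ^ toℕ k)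
    go : ∀ Ss → Σ̂ (term Ss) ≡ weight (filter P? Ss)
    extend : ∀ S Ss → Dec (P S) → Σ̂ (term (S ∷ Ss)) ≡ weight (filter P? (S ∷ Ss))
    go []       = Σ̂-zero (suc m) (λ _ → refl)
    go (S ∷ Ss) = extend S Ss (P? S)
    extend S Ss (no ¬p) = trans
      (Σ̂-cong {suc m} {term (S ∷ Ss)} {term Ss} (λ k → cong (λ Ts → times (length Ts) (q ^ toℕ k))
        (filter-reject (Q? (toℕ k)) {xs = Ss} (¬p ∘ proj₁))))
      (trans (go Ss) (cong weight (sym (filter-reject P? ¬p))))
    extend S Ss (yes p) = trans (Σ̂-bump (term (S ∷ Ss)) (term Ss) (q ^ Subset.∣ S ∣) size bump same)
      (trans (cong (q ^ Subset.∣ S ∣ +_) (go Ss)) (cong weight (sym (filter-accept P? p))))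
      where
      size : Fin (suc m)
      size = fromℕ< (s≤s (Subset.∣p∣≤n S))
      toℕ-size : toℕ size ≡ Subset.∣ S ∣
      toℕ-size = Fin.toℕ-fromℕ< (s≤s (Subset.∣p∣≤n S))
      bump : term (S ∷ Ss) size ≡ q ^ Subset.∣ S ∣ + term Ss size
      bump = trans (cong (λ Ts → times (length Ts) (q ^ toℕ size)) (filter-accept (Q? (toℕ size)) (p , sym toℕ-size)))
        (cong (λ k → q ^ k + term Ss size) toℕ-size)
      same : ∀ k → k ≢ size → term (S ∷ Ss) k ≡ term Ss k
      same k k≢ = cong (λ Ts → times (length Ts) (q ^ toℕ k)) (filter-reject (Q? (toℕ k))
        (λ (_ , eq) → k≢ (Fin.toℕ-injective (trans (sym eq) (sym toℕ-size)))))

filter-map : ∀ {A B : Set} {P : Pred B 0ℓ} (P? : Decidable P) (f : A → B) L →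
  filter P? (map f L) ≡ map f (filter (P? ∘ f) L)
filter-map P? f [] = refl
filter-map P? f (x ∷ L) with P? (f x)
... | yes _ = cong (f x ∷_) (filter-map P? f L)
... | no _  = filter-map P? f L

module Evaluation {n : ℕ} (G : Graph n) where
  open Independence G

  away-filter : ∀ {Q : Pred V 0ℓ} (Q? : Decidable Q) v L →
    filter (λ w → Q? w ×-dec ¬? (adj? G v w)) L ≡ away v (filter Q? L)
  away-filter Q? v [] = refl
  away-filter Q? v (w ∷ L) with Q? w
  ... | no _ = away-filter Q? v L
  ... | yes _ with adj? G v w
  ... | yes _ = away-filter Q? v L
  ... | no _  = cong (w ∷_) (away-filter Q? v L)

  IndependentVia : ∀ {m} → (Fin m → V) → Pred V 0ℓ → Subset m → Set
  IndependentVia e Q S = (∀ x y → x Subset.∈ S → y Subset.∈ S → e x ≁ e y) × (∀ x → x Subset.∈ S → Q (e x))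

  -- `Q` holds the vertices still admissible: once `e zero` is chosen, it is narrowed to the
  -- non-neighbours of `e zero`, which matches `away` on lists. `P?` is any decision procedure with
  -- the right meaning, because fixing the first entry of a subset changes the procedure.
  weight-ind : ∀ p {m} (e : Fin m → V) {Q : Pred V 0ℓ} (Q? : Decidable Q)
    {P : Pred (Subset m) 0ℓ} (P? : Decidable P) → (∀ S → P S ⇔ IndependentVia e Q S) →
    weight (- p) (filter P? (subsets m)) ≡ ind p (filter Q? (tabulate e))
  weight-ind p {zero} e Q? P? spec = trans
    (cong (weight (- p)) (filter-accept P? (Equivalence.from (spec []) ((λ ()) , λ ()))))
    (trans (ℚ.+-identityʳ 1ℚ) (sym (ind-[] p)))
  weight-ind p {suc m} e {Q} Q? {P} P? spec = trans
    (cong (weight (- p)) (trans (filter-++ P? (map (outside ∷_) (subsets m)) (map (inside ∷_) (subsets m)))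
      (cong₂ _++_ (filter-map P? (outside ∷_) (subsets m)) (filter-map P? (inside ∷_) (subsets m)))))
    (trans (weight-++ (- p) (map (outside ∷_) without) (map (inside ∷_) with-e₀))
    (trans (cong₂ _+_ (trans (weight-outside (- p) without)
                        (weight-ind p (e ∘ suc) Q? (P? ∘ (outside ∷_)) spec-out))
             (weight-inside (- p) with-e₀))
      (case (Q? (e zero)))))
    where
    e₀ = e zero
    F = filter Q? (tabulate (e ∘ suc))
    without = filter (P? ∘ (outside ∷_)) (subsets m)
    with-e₀ = filter (P? ∘ (inside ∷_)) (subsets m)
    spec-out : ∀ S → P (outside ∷ S) ⇔ IndependentVia (e ∘ suc) Q S
    spec-out S = mk⇔
      (λ P → let i , q = Equivalence.to (spec (outside ∷ S)) P in
        (λ x y x∈ y∈ → i (suc x) (suc y) (there x∈) (there y∈)) , λ x x∈ → q (suc x) (there x∈))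
      (λ (i , q) → Equivalence.from (spec (outside ∷ S))
        ((λ { (suc x) (suc y) (there x∈) (there y∈) → i x y x∈ y∈ }) , λ { (suc x) (there x∈) → q x x∈ }))
    case : Dec (Q e₀) → ind p F + - p * weight (- p) with-e₀ ≡ ind p (filter Q? (tabulate e))
    case (no ¬q) = trans (cong (ind p F +_) (trans (cong (λ Ss → - p * weight (- p) Ss) none) (ℚ.*-zeroʳ (- p))))
      (trans (ℚ.+-identityʳ (ind p F)) (cong (ind p) (sym (filter-reject Q? ¬q))))
      where
      none : with-e₀ ≡ []
      none = filter-none (P? ∘ (inside ∷_)) {xs = subsets m} (All.tabulate λ {S} _ P →
        ¬q (proj₂ (Equivalence.to (spec (inside ∷ S)) P) zero here))
    case (yes q₀) = trans
      (cong (λ t → ind p F + - p * t) (trans (weight-ind p (e ∘ suc) Q′? (P? ∘ (inside ∷_)) spec-in)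
        (cong (ind p) (away-filter Q? e₀ (tabulate (e ∘ suc))))))
      (trans (solve 3 (λ p a b → a :+ (:- p) :* b := a :- p :* b) refl p (ind p F) (ind p (away e₀ F)))
        (trans (sym (ind-∷ p e₀ F)) (cong (ind p) (sym (filter-accept Q? q₀)))))
      where
      Q′? : Decidable (λ w → Q w × e₀ ≁ w)
      Q′? w = Q? w ×-dec ¬? (adj? G e₀ w)
      spec-in : ∀ S → P (inside ∷ S) ⇔ IndependentVia (e ∘ suc) (λ w → Q w × e₀ ≁ w) S
      spec-in S = mk⇔
        (λ P → let i , q = Equivalence.to (spec (inside ∷ S)) P in
          (λ x y x∈ y∈ → i (suc x) (suc y) (there x∈) (there y∈)) ,
          λ x x∈ → q (suc x) (there x∈) , i zero (suc x) here (there x∈))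
        (λ (i , q) → Equivalence.from (spec (inside ∷ S))
          ( (λ { zero    zero    _ _ → irrefl G refl
               ; zero    (suc y) _ (there y∈) → proj₂ (q y y∈)
               ; (suc x) zero    (there x∈) _ → ≁-sym (proj₂ (q x x∈))
               ; (suc x) (suc y) (there x∈) (there y∈) → i x y x∈ y∈ })
          , λ { zero _ → q₀ ; (suc x) (there x∈) → proj₁ (q x x∈) }))

  vertices : List V
  vertices = allFin n

  evaluate : ℚ → ℚ
  evaluate q = Σ̂ {suc n} (λ k → times (numIndependent G (toℕ k)) (q ^ toℕ k))

  evaluate-ind : ∀ p → evaluate (- p) ≡ ind p vertices
  evaluate-ind p = trans (weight-by-size (- p) (independent? G) (subsets n))
    (trans (weight-ind p id {λ _ → ⊤} (λ _ → yes tt) (independent? G)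
             (λ S → mk⇔ (λ i → i , λ _ _ → tt) proj₁))
      (cong (ind p) (filter-all (λ _ → yes tt) (All.tabulate (λ _ → tt)))))

  seq-· : ∀ m y k → seq (m ·ᴿ y) k ≡ times m (seq y k)
  seq-· zero    y k = refl
  seq-· (suc m) y k = cong (seq y k +_) (seq-· m y k)

  seq-^ : ∀ y m k → seq (y ^ᴿ m) k ≡ seq y k ^ m
  seq-^ y zero    k = refl
  seq-^ y (suc m) k = cong (seq y k *_) (seq-^ y m k)

  seq-sum : ∀ {m} (t : Fin m → ℝ) k → seq (sumᴿ t) k ≡ Σ̂ (λ i → seq (t i) k)
  seq-sum {zero}  t k = refl
  seq-sum {suc m} t k = cong (seq (t zero) k +_) (seq-sum (t ∘ suc) k)

  -- Real arithmetic acts termwise, so every term of `I G x` is a value of the polynomial at a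
  -- rational point.
  seq-I : ∀ x k → seq (I G x) k ≡ ind (- seq x k) vertices
  seq-I x k = trans (seq-sum {suc n} (λ i → numIndependent G (toℕ i) ·ᴿ (x ^ᴿ toℕ i)) k)
    (trans (Σ̂-cong {suc n} (λ i → trans (seq-· (numIndependent G (toℕ i)) (x ^ᴿ toℕ i) k)
             (cong (times (numIndependent G (toℕ i))) (seq-^ x (toℕ i) k))))
    (trans (cong evaluate (sym (neg-involutive (seq x k)))) (evaluate-ind (- seq x k))))

samePolynomial⇒ind : ∀ {n} (H G : Graph n) → SamePolynomial H G → ∀ p →
  Independence.ind H p (allFin n) ≡ Independence.ind G p (allFin n)
samePolynomial⇒ind {n} H G same p = trans (sym (Evaluation.evaluate-ind H p))
  (trans (Σ̂-cong {suc n} (λ k → cong (λ m → times m ((- p) ^ toℕ k)) (same (toℕ k))))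
    (Evaluation.evaluate-ind G p))

-- The largest root

0<½ : 0ℚ < ½
0<½ = ℚ.positive⁻¹ ½

half-< : ∀ {δ} → 0ℚ < δ → δ * ½ < δ
half-< {δ} 0<δ = <-by (0<* 0<δ 0<½) (solve 1 (λ d → d :- d :* con ½ := d :* con ½) refl δ)

minus-zero : ∀ a → a ≡ a - 0ℚ
minus-zero = solve 1 (λ a → a := a :- con 0ℚ) refl

module LargestRoot {n : ℕ} (G : Graph n) where
  open Independence G
  open Continuity G
  open Evaluation G

  private
    module Root {p} (0<p : 0ℚ < p) (bad : Bad p vertices) where
      open Bisection 0<p bad

      close : ∀ {j k l} → j ℕ.≤ k → j ℕ.≤ l → - point k - - point l ≤ halves p j
      close {j} {k} {l} j≤k j≤l = ≤-by
        (0≤+ (0≤- (point-close j≤k)) (0≤- (point-mono (ℕ.≤⇒≤′ j≤l))))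
        (solve 4 (λ h a k l → h :- (:- k :- (:- l)) := (h :- (a :- k)) :+ (a :- l)) refl
          (halves p j) (point j) (point k) (point l))

      root-cauchy : IsCauchy (λ k → - point k)
      root-cauchy ε 0<ε = conclude (halves-small 0<p 0<ε)
        where
        conclude : (∃ λ N → halves p N ≤ ε) →
          ∃ λ N → ∀ k l → N ℕ.≤ k → N ℕ.≤ l → ∣ - point k - - point l ∣ ≤ ε
        conclude (N , small) = N , λ k l N≤k N≤l → ∣∣-≤
          (≤-trans (close N≤k N≤l) small)
          (≤-trans (≤-reflexive (solve 2 (λ a b → :- (a :- b) := b :- a) refl (- point k) (- point l)))
            (≤-trans (close N≤l N≤k) small))

      root : ℝ
      root = mkℝ (λ k → - point k) root-cauchy

      root-value : I G root ≈ᴿ 0ᴿ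
      root-value ε 0<ε = conclude (value-small 0<ε)
        where
        conclude : (∃ λ N → ∀ k → N ℕ.≤ k → ∣ ind (point k) vertices ∣ ≤ ε) →
          ∃ λ N → ∀ k → N ℕ.≤ k → ∣ seq (I G root) k - seq 0ᴿ k ∣ ≤ ε
        conclude (N , small) = N , λ k N≤k → subst (λ t → ∣ t ∣ ≤ ε) (eq k) (small k N≤k)
          where
          eq : ∀ k → ind (point k) vertices ≡ seq (I G root) k - seq 0ᴿ k
          eq k = trans (cong (λ t → ind t vertices) (sym (neg-involutive (point k))))
            (trans (sym (seq-I root k)) (minus-zero (seq (I G root) k)))

  -- A bad `p` would yield a root that is at least -p and hence exceeds `ξ` by `δ`. The gap is
  -- explicit because `_≤ᴿ_` tolerates any positive error; here half of the gap is conceded.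
  pos-above-root : ∀ {ξ} → IsLargestRoot G ξ → ∀ {p δ} → 0ℚ < p → 0ℚ < δ →
    (∃ λ N → ∀ k → N ℕ.≤ k → seq ξ k + δ ≤ - p) → Pos p vertices
  pos-above-root {ξ} (_ , largest) {p} {δ} 0<p 0<δ (N , ξ<) = conclude (pos-or-bad p vertices)
    where
    impossible : ¬ Bad p vertices
    impossible bad = ℚ.<-irrefl refl (absurd (largest root root-value (δ * ½) (0<* 0<δ 0<½)))
      where
      open Root 0<p bad
      open Bisection 0<p bad
      absurd : (∃ λ M → ∀ k → M ℕ.≤ k → - point k ≤ seq ξ k + δ * ½) → δ * ½ < δ * ½
      absurd (M , above) = <-≤-trans (half-< 0<δ) (≤-by
        (0≤+ (0≤- (ξ< k (ℕ.m≤m⊔n N M))) (0≤+ (0≤- (above k (ℕ.m≤n⊔m N M))) (0≤- (point≤p k))))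
        (solve 4 (λ d x p a → d :* con ½ :- d := (:- p :- (x :+ d)) :+ ((x :+ d :* con ½ :- (:- a)) :+ (p :- a))) refl
          δ (seq ξ k) p (point k)))
        where k = N ℕ.⊔ M
    conclude : Pos p vertices ⊎ Bad p vertices → Pos p vertices
    conclude (inj₁ pos) = pos
    conclude (inj₂ bad) = contradiction bad impossible

-- Passage from rational to real arguments

module Compare {m n : ℕ} (H : Graph m) (G : Graph n) where
  open Independence using (ind; Pos)
  open Continuity using (modulus; modulus-pos; ind-lipschitz; ind-0)
  open Evaluation using (vertices; seq-I)

  private
    transfer : ∀ {K y p η ε} → 0ℚ ≤ K → ∣ y ∣ ≤ K → ∣ p ∣ ≤ K → ∣ y - p ∣ ≤ η →
      (modulus G K (length (vertices G)) + modulus H K (length (vertices H))) * η ≤ ε →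
      ind G p (vertices G) ≤ ind H p (vertices H) → ind G y (vertices G) ≤ ind H y (vertices H) + ε
    transfer {K} {y} {p} {η} {ε} 0≤K y≤K p≤K near small le = ≤-by
      (0≤+ (0≤- le) (0≤+ (0≤- (one G)) (0≤+ (0≤- (other H)) (0≤- small))))
      (solve 8 (λ gy gp hy hp a b η ε → hy :+ ε :- gy :=
          (hp :- gp) :+ ((a :* η :- (gy :- gp)) :+ ((b :* η :- (:- (hy :- hp))) :+ (ε :- (a :+ b) :* η)))) refl
        (ind G y (vertices G)) (ind G p (vertices G)) (ind H y (vertices H)) (ind H p (vertices H))
        (modulus G K (length (vertices G))) (modulus H K (length (vertices H))) η ε)
      where
      gap lip : ∀ {k} → Graph k → ℚ
      gap F = ind F y (vertices F) - ind F p (vertices F)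
      lip F = modulus F K (length (vertices F))
      close : ∀ {k} (F : Graph k) → ∣ gap F ∣ ≤ lip F * η
      close F = ≤-trans (ind-lipschitz F 0≤K y≤K p≤K (length (vertices F)) (vertices F) ℕ.≤-refl)
        (*-mono-≤ (<⇒≤ (modulus-pos F 0≤K (length (vertices F)))) ≤-refl (ℚ.0≤∣p∣ (y - p)) near)
      one : ∀ {k} (F : Graph k) → gap F ≤ lip F * η
      one F = ≤-trans (≤∣∣ (gap F)) (close F)
      other : ∀ {k} (F : Graph k) → - gap F ≤ lip F * η
      other F = ≤-trans (-≤∣∣ (gap F)) (close F)

    Lip : ℚ → ℚ
    Lip K = modulus G K (length (vertices G)) + modulus H K (length (vertices H))

    Lip-pos : ∀ {K} → 0ℚ ≤ K → 0ℚ < Lip K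
    Lip-pos 0≤K = 0<+ (modulus-pos G 0≤K (length (vertices G))) (<⇒≤ (modulus-pos H 0≤K (length (vertices H))))

    -- Approximate y by y − 3δ, or by 0 when that is not positive.
    near-root : ∀ {K y δ ε} → 0ℚ ≤ K → ∣ y ∣ ≤ K → 0ℚ < δ → - δ ≤ y → Lip K * (δ + δ + δ) ≤ ε →
      (0ℚ < y - (δ + δ + δ) → ind G (y - (δ + δ + δ)) (vertices G) ≤ ind H (y - (δ + δ + δ)) (vertices H)) →
      ind G y (vertices G) ≤ ind H y (vertices H) + ε
    near-root {K} {y} {δ} {ε} 0≤K y≤K 0<δ -δ≤y small compare = choose (0ℚ ℚ.<? y - (δ + δ + δ))
      where
      0<3δ : 0ℚ < δ + δ + δ
      0<3δ = 0<+ (0<+ 0<δ (<⇒≤ 0<δ)) (<⇒≤ 0<δ)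
      choose : Dec (0ℚ < y - (δ + δ + δ)) → ind G y (vertices G) ≤ ind H y (vertices H) + ε
      choose (yes 0<p) = transfer 0≤K y≤K p≤K near small (compare 0<p)
        where
        p≤K : ∣ y - (δ + δ + δ) ∣ ≤ K
        p≤K = subst (_≤ K) (sym (ℚ.0≤p⇒∣p∣≡p (<⇒≤ 0<p))) (≤-by
          (0≤+ (0≤- (≤-trans (≤∣∣ y) y≤K)) (<⇒≤ 0<3δ))
          (solve 3 (λ K y d → K :- (y :- d) := (K :- y) :+ d) refl K y (δ + δ + δ)))
        near : ∣ y - (y - (δ + δ + δ)) ∣ ≤ δ + δ + δ
        near = ≤-reflexive (trans
          (cong ∣_∣ (solve 2 (λ y d → y :- (y :- d) := d) refl y (δ + δ + δ)))
          (ℚ.0≤p⇒∣p∣≡p (<⇒≤ 0<3δ)))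
      choose (no 0≮p) = transfer 0≤K y≤K 0≤K near small
        (≤-reflexive (trans (ind-0 G (vertices G)) (sym (ind-0 H (vertices H)))))
        where
        near : ∣ y - 0ℚ ∣ ≤ δ + δ + δ
        near = subst (λ t → ∣ t ∣ ≤ δ + δ + δ) (minus-zero y) (∣∣-≤
          (≤-by (0≤- (ℚ.≮⇒≥ 0≮p)) (solve 2 (λ y d → d :- y := con 0ℚ :- (y :- d)) refl y (δ + δ + δ)))
          (≤-by (0≤+ (0≤- -δ≤y) (<⇒≤ (0<+ 0<δ (<⇒≤ 0<δ))))
            (solve 2 (λ d y → d :+ d :+ d :- (:- y) := (y :- (:- d)) :+ (d :+ d)) refl δ y)))

    module _ (x : ℝ) where

      bounded : (∃ λ N → ∀ k l → N ℕ.≤ k → N ℕ.≤ l → ∣ seq x k - seq x l ∣ ≤ 1ℚ) →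
        ∃ λ N → ∃ λ K → 0ℚ ≤ K × (∀ k → N ℕ.≤ k → ∣ - seq x k ∣ ≤ K)
      bounded (N , within) = N , 1ℚ + ∣ seq x N ∣ , 0≤+ (<⇒≤ 0<1) (ℚ.0≤∣p∣ (seq x N)) , λ k N≤k → ≤-trans
        (≤-reflexive (trans (ℚ.∣-p∣≡∣p∣ (seq x k))
          (cong ∣_∣ (solve 2 (λ a b → a := (a :- b) :+ b) refl (seq x k) (seq x N)))))
        (≤-trans (ℚ.∣p+q∣≤∣p∣+∣q∣ (seq x k - seq x N) (seq x N))
          (ℚ.+-monoˡ-≤ ∣ seq x N ∣ (within k N N≤k ℕ.≤-refl)))

      module Tail (ξ : ℝ) (root : IsLargestRoot G ξ)
        (compare : ∀ {p} → 0ℚ < p → Pos G p (vertices G) → ind G p (vertices G) ≤ ind H p (vertices H))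
        {K δ ε} (0≤K : 0ℚ ≤ K) (0<δ : 0ℚ < δ) (small : Lip K * (δ + δ + δ) ≤ ε)
        {N₀ N₁ N₂ N₃}
        (bound : ∀ k → N₀ ℕ.≤ k → ∣ - seq x k ∣ ≤ K)
        (ξ≤ : ∀ k → N₁ ℕ.≤ k → seq ξ k ≤ seq x k + δ)
        (≤0 : ∀ k → N₂ ℕ.≤ k → seq x k ≤ 0ℚ + δ)
        (within : ∀ k l → N₃ ℕ.≤ k → N₃ ℕ.≤ l → ∣ seq x k - seq x l ∣ ≤ δ) where

        start : ℕ
        start = (N₀ ℕ.⊔ N₁) ℕ.⊔ (N₂ ℕ.⊔ N₃)

        tail : ∀ k → start ℕ.≤ k → ind G (- seq x k) (vertices G) ≤ ind H (- seq x k) (vertices H) + ε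
        tail k start≤k = near-root 0≤K (bound k (ℕ.m⊔n≤o⇒m≤o N₀ N₁ left)) 0<δ
          (≤-by (0≤- (≤0 k (ℕ.m⊔n≤o⇒m≤o N₂ N₃ right)))
            (solve 2 (λ d a → :- a :- (:- d) := con 0ℚ :+ d :- a) refl δ (seq x k)))
          small
          (λ 0<p → compare 0<p (LargestRoot.pos-above-root G {ξ} root 0<p 0<δ (N₁ ℕ.⊔ N₃ , above)))
          where
          left = ℕ.m⊔n≤o⇒m≤o (N₀ ℕ.⊔ N₁) (N₂ ℕ.⊔ N₃) start≤k
          right = ℕ.m⊔n≤o⇒n≤o (N₀ ℕ.⊔ N₁) (N₂ ℕ.⊔ N₃) start≤k
          -- Origin of 3δ: one δ for the error in `ξ ≤ᴿ x`, one for the variation of `x` along its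
          -- tail, and one for the gap that `pos-above-root` requires.
          above : ∀ l → N₁ ℕ.⊔ N₃ ℕ.≤ l → seq ξ l + δ ≤ - (- seq x k - (δ + δ + δ))
          above l ≤l = ≤-by
            (0≤+ (0≤- (ξ≤ l (ℕ.m⊔n≤o⇒m≤o N₁ N₃ ≤l)))
              (0≤- (≤-trans (≤∣∣ (seq x l - seq x k))
                (within l k (ℕ.m⊔n≤o⇒n≤o N₁ N₃ ≤l) (ℕ.m⊔n≤o⇒n≤o N₂ N₃ right)))))
            (solve 4 (λ z xl xk d → :- (:- xk :- (d :+ d :+ d)) :- (z :+ d)
                := (xl :+ d :- z) :+ (d :- (xl :- xk))) refl
              (seq ξ l) (seq x l) (seq x k) δ)

    choose-δ : ∀ {M ε} → 0ℚ < M → 0ℚ < ε → ∃ λ δ → 0ℚ < δ × M * (δ + δ + δ) ≤ ε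
    choose-δ {M} {ε} 0<M 0<ε = conclude (halves-small (0<+ (0<+ 0<M (<⇒≤ 0<M)) (<⇒≤ 0<M)) 0<ε)
      where
      conclude : (∃ λ i → halves (M + M + M) i ≤ ε) → ∃ λ δ → 0ℚ < δ × M * (δ + δ + δ) ≤ ε
      conclude (i , small) = halves 1ℚ i , halves-pos i 0<1 , ≤-trans (≤-reflexive
        (trans (solve 2 (λ m d → m :* (d :+ d :+ d) := (m :+ m :+ m) :* d) refl M (halves 1ℚ i))
          (trans (halves-scale (M + M + M) 1ℚ i) (cong (λ t → halves t i) (ℚ.*-identityʳ (M + M + M)))))) small

  ⪯-from-rational : (∀ {p} → 0ℚ < p → Pos G p (vertices G) → ind G p (vertices G) ≤ ind H p (vertices H)) → H ⪯ G
  ⪯-from-rational compare ξ root x ξ≤x x≤0 ε 0<ε =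
    let N₀ , K , 0≤K , bound = bounded x (cauchy x 1ℚ 0<1)
        δ , 0<δ , small      = choose-δ (Lip-pos 0≤K) 0<ε
        N₁ , ξ≤              = ξ≤x δ 0<δ
        N₂ , ≤0              = x≤0 δ 0<δ
        N₃ , within          = cauchy x δ 0<δ
    in conclude (Tail.start x ξ root compare 0≤K 0<δ small bound ξ≤ ≤0 within)
                (Tail.tail x ξ root compare 0≤K 0<δ small bound ξ≤ ≤0 within)
    where
    conclude : ∀ N → (∀ k → N ℕ.≤ k → ind G (- seq x k) (vertices G) ≤ ind H (- seq x k) (vertices H) + ε) →
      ∃ λ N → ∀ k → N ℕ.≤ k → seq (I G x) k ≤ seq (I H x) k + ε
    conclude N le = N , λ k N≤k →
      subst₂ (λ a b → a ≤ b + ε) (sym (seq-I G x k)) (sym (seq-I H x k)) (le k N≤k)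

-- Values at small arguments

module _ {n : ℕ} (G : Graph n) where
  open Independence G

  -- The bounds support each other: the upper one limits the subtracted term, and the lower one
  -- makes it nonnegative.
  small-values : ∀ {p} → 0ℚ ≤ p → ∀ m L → length L ℕ.≤ m → times m p ≤ 1ℚ →
    1ℚ - times m p ≤ ind p L × ind p L ≤ 1ℚ
  small-values {p} 0≤p m [] _ _ = ≤-by (times-nonneg m 0≤p)
      (trans (cong (λ t → t - (1ℚ - times m p)) (ind-[] p))
        (solve 1 (λ a → con 1ℚ :- (con 1ℚ :- a) := a) refl (times m p)))
    , ≤-reflexive (ind-[] p)
  small-values {p} 0≤p (suc m) (v ∷ L) (s≤s ≤m) small =
      ≤-by (0≤+ (0≤- (proj₁ tail)) (0≤* 0≤p (0≤- (proj₂ near))))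
        (trans (cong (λ t → t - (1ℚ - (p + times m p))) (ind-∷ p v L))
          (solve 4 (λ p a b t → a :- p :* b :- (con 1ℚ :- (p :+ t)) := (a :- (con 1ℚ :- t)) :+ p :* (con 1ℚ :- b))
            refl p (ind p L) (ind p (away v L)) (times m p)))
    , ≤-by (0≤+ (0≤- (proj₂ tail)) (0≤* 0≤p (≤-trans (0≤- small′) (proj₁ near))))
        (trans (cong (λ t → 1ℚ - t) (ind-∷ p v L))
          (solve 3 (λ p a b → con 1ℚ :- (a :- p :* b) := (con 1ℚ :- a) :+ p :* b) refl
            p (ind p L) (ind p (away v L))))
    where
    small′ : times m p ≤ 1ℚ
    small′ = ≤-trans (≤-by 0≤p (solve 2 (λ p t → p :+ t :- t := p) refl p (times m p))) small
    tail = small-values 0≤p m L ≤m small′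
    near = small-values 0≤p m (away v L) (ℕ.≤-trans (away-length v L) ≤m) small′

  small-pos : ∀ {p} → 0ℚ ≤ p → times n p < 1ℚ → Pos p (allFin n)
  small-pos 0≤p small {H} {R} σ = <-≤-trans (0<- small)
    (proj₁ (small-values 0≤p n H (ℕ.≤-trans (ℕ.m≤m+n (length H) (length R))
      (ℕ.≤-reflexive (trans (sym (length-++ H)) (trans (sym (↭-length σ)) (length-tabulate {n = n} id)))))
      (<⇒≤ small)))

small-point : ∀ n → ∃ λ p → 0ℚ < p × times n p < 1ℚ
small-point n = conclude (halves-small (0<+ 0<1 (times-nonneg n (<⇒≤ 0<1))) 0<½)
  where
  conclude : (∃ λ i → halves (times (suc n) 1ℚ) i ≤ ½) → ∃ λ p → 0ℚ < p × times n p < 1ℚ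
  conclude (i , small) = p , halves-pos i 0<1 , ≤-<-trans n≤
      (≤-<-trans small (<-by 0<½ refl))
    where
    p = halves 1ℚ i
    n≤ : times n p ≤ halves (times (suc n) 1ℚ) i
    n≤ = ≤-by (<⇒≤ (halves-pos i 0<1)) (trans
      (cong (λ t → t - times n p) (trans (cong (λ t → halves t i) (sym (ℚ.*-identityʳ (times (suc n) 1ℚ))))
        (trans (sym (halves-scale (times (suc n) 1ℚ) 1ℚ i))
          (trans (times-* (suc n) 1ℚ p) (cong (times (suc n)) (ℚ.*-identityˡ p))))))
      (solve 2 (λ p t → p :+ t :- t := p) refl p (times n p)))

-- The two extremes Cₙ and Uₙ

module Extremes (j : ℕ) (G : Graph (3 ℕ.+ j)) (connected : Connected G) (unicyclic : Unicyclic G)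
  (≇C : ¬ (G ≅ C (3 ℕ.+ j))) (≇D : ¬ (G ≅ D (3 ℕ.+ j))) (≇U : ¬ (G ≅ U (3 ℕ.+ j))) where
  open Independence
  open Shapes G
  open Isomorphisms G
  open StarBound G

  private
    L = allFin (3 ℕ.+ j)
    |L| : length L ≡ 3 ℕ.+ j
    |L| = length-tabulate {n = 3 ℕ.+ j} id
    uni : Uni L
    uni = Decomposition.unicyclic⇒uni G connected unicyclic

    module At {p} (0<p : 0ℚ < p) (pos : Pos G p L) where
      open Comparison G p 0<p
      open UniBounds (uni-bounds (length L) ℕ.≤-refl uni pos) public using (bound; bound-≤)

      cy-L : Recurrence.cy p (length L) ≡ ind (C (3 ℕ.+ j)) p L
      cy-L = trans (cong (Recurrence.cy p) |L|) (sym (ind-C j 0<p))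

      below-C : ind G p L ≤ ind (C (3 ℕ.+ j)) p L
      below-C = ≤-trans bound-≤ (≤-reflexive cy-L)

      strictly-below-C : ind G p L < ind (C (3 ℕ.+ j)) p L
      strictly-below-C = conclude bound
        where
        conclude : ind G p L < Recurrence.cy p (length L) ⊎
                   ind G p L ≤ Recurrence.cy p (length L) × Extremal L → ind G p L < ind (C (3 ℕ.+ j)) p L
        conclude (inj₁ lt)                   = <-≤-trans lt (≤-reflexive cy-L)
        conclude (inj₂ (_ , inj₁ cyc))       = contradiction (cycle-iso cyc) ≇C
        conclude (inj₂ (_ , inj₂ (_ , d)))   = contradiction (dshape-iso d) ≇D

    -- The interval for `G ⪯ U` ends at the root of Uₙ, so it is Uₙ that is given as positive.
    module AtU {p} (0<p : 0ℚ < p) (posU : Pos (U (3 ℕ.+ j)) p L) where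

      0<1-2p : 0ℚ < 1ℚ - p - p
      0<1-2p = pos-U-edge j posU

      0<us : 0ℚ < us p j
      0<us = subst (0ℚ <_) (ind-U j p) (pos-self (U (3 ℕ.+ j)) posU)

      above-U : ind (U (3 ℕ.+ j)) p L ≤ ind G p L
      above-U = ≤-trans (≤-reflexive (ind-U j p)) (star-bound uni j |L| 0<p 0<1-2p 0<us)

      strictly-above-U : Pos G p L → ind (U (3 ℕ.+ j)) p L < ind G p L
      strictly-above-U pos = go uni
        where
        go : Uni L → ind (U (3 ℕ.+ j)) p L < ind G p L
        go (cycle {j = j′} {c} cyc σ) = contradiction (cycle-iso (j′ , c , cyc , σ)) ≇C
        go (leaf {L = L₁} {z = z} t l σ) = size (uni-length t)
          where
          size : (∃ λ j₁ → length L₁ ≡ 3 ℕ.+ j₁) → ind (U (3 ℕ.+ j)) p L < ind G p L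
          size (j₁ , |L₁|) = conclude (leaf-bound 0<p 0<1-2p t l (pos-tail G (pos-↭ G σ pos)) |L₁|
              (star-bound t j₁ |L₁| 0<p 0<1-2p (<-≤-trans 0<us′ (us-antitone (<⇒≤ 0<p) 0<1-2p j₁))))
            where
            j≡ : j ≡ suc j₁
            j≡ = ℕ.+-cancelˡ-≡ 3 j (suc j₁) (trans (sym |L|) (trans (↭-length σ) (cong suc |L₁|)))
            0<us′ : 0ℚ < us p (suc j₁)
            0<us′ = subst (λ k → 0ℚ < us p k) j≡ 0<us
            conclude : us p (suc j₁) < ind G p (z ∷ L₁) ⊎
              us p (suc j₁) ≤ ind G p (z ∷ L₁) × OneEdge (LeafAt.others l) → ind (U (3 ℕ.+ j)) p L < ind G p L
            conclude (inj₁ lt) = subst₂ _<_ (trans (cong (us p) (sym j≡)) (sym (ind-U j p))) (sym (ind-↭ G p σ)) lt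
            conclude (inj₂ (_ , one)) = contradiction (one-edge-iso connected (proj₁ unicyclic) σ l one) ≇U

  C≺G : C (3 ℕ.+ j) ≺ G
  C≺G = Compare.⪯-from-rational (C (3 ℕ.+ j)) G At.below-C , distinct (small-point (3 ℕ.+ j))
    where
    distinct : (∃ λ p → 0ℚ < p × times (3 ℕ.+ j) p < 1ℚ) → ¬ SamePolynomial (C (3 ℕ.+ j)) G
    distinct (p , 0<p , small) same = ℚ.<⇒≢
      (At.strictly-below-C 0<p (small-pos G (<⇒≤ 0<p) small)) (sym (samePolynomial⇒ind (C (3 ℕ.+ j)) G same p))

  G≺U : G ≺ U (3 ℕ.+ j)
  G≺U = Compare.⪯-from-rational G (U (3 ℕ.+ j)) AtU.above-U , distinct (small-point (3 ℕ.+ j))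
    where
    distinct : (∃ λ p → 0ℚ < p × times (3 ℕ.+ j) p < 1ℚ) → ¬ SamePolynomial G (U (3 ℕ.+ j))
    distinct (p , 0<p , small) same = ℚ.<⇒≢
      (AtU.strictly-above-U 0<p (small-pos (U (3 ℕ.+ j)) (<⇒≤ 0<p) small) (small-pos G (<⇒≤ 0<p) small))
      (sym (samePolynomial⇒ind G (U (3 ℕ.+ j)) same p))

theorem2p7 : ∀ {n : ℕ} (G : Graph n) → Connected G → Unicyclic G →
    ¬ (G ≅ C n) → ¬ (G ≅ D n) → ¬ (G ≅ U n) →
    (C n ≺ G) × (G ≺ U n)
theorem2p7 {n} G connected unicyclic =
    subst Claim (trans (sym (proj₂ size)) (length-tabulate {n = n} id)) (extremes (proj₁ size))
      G connected unicyclic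
  where
  Claim : ℕ → Set₁
  Claim n = (G : Graph n) → Connected G → Unicyclic G →
    ¬ (G ≅ C n) → ¬ (G ≅ D n) → ¬ (G ≅ U n) → (C n ≺ G) × (G ≺ U n)
  extremes : ∀ j → Claim (3 ℕ.+ j)
  extremes j G connected unicyclic ≇C ≇D ≇U = C≺G , G≺U
    where open Extremes j G connected unicyclic ≇C ≇D ≇U
  size : ∃ λ j → length (allFin n) ≡ 3 ℕ.+ j
  size = Shapes.uni-length G (Decomposition.unicyclic⇒uni G connected unicyclic)
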